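{- Let $S$ and $S'$ be composition series of finite groups of order $n$ such that $\alpha$ is an upper bound for the order of any factor (of $S$ or of $S'$). Then we can test if $S \cong S'$ in $n^{O(\alpha)}$ time.
   Context: Groups are given by multiplication tables, and a composition series by its chain of subgroups. A composition series of a group $G$ is a maximal subnormal series $G_0 = 1 \triangleleft \cdots \triangleleft G_m = G$; its factors are the groups $G_{i+1}/G_i$. Two composition series $G_0 = 1 \triangleleft \cdots \triangleleft G_m = G$ and $H_0 = 1 \triangleleft \cdots \triangleleft H_{m'} = H$ are isomorphic if there is a group isomorphism $\phi : G \to H$ with $\phi[G_i] = H_i$ for each $i$ (in particular $m=m'$). The constant in $O(\cdot)$ is absolute. -}

module Defs where

open import Algebra.Bundles using (Group)
open import Algebra.Morphism.Structures using (module GroupMorphisms)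
open import Algebra.Structures using (IsGroup)
import Algebra.Properties.Group as GroupProperties
open import Data.Bool.Base using (Bool; true; false)
open import Data.Fin.Base using (Fin; zero; suc; fromℕ; inject₁; cast)
open import Data.Fin.Subset using (Subset; _∈_; _⊂_; ⁅_⁆; ⊤)
open import Data.List.Base as List using (List)
open import Data.Nat.Base using (ℕ; suc; _+_; _≤_)
open import Data.Product.Base using (∃; ∃₂; _×_; _,_; proj₁)
open import Data.Vec.Base as Vec using (Vec; []; _∷_; lookup)
open import Function.Bundles using (Bijection; _⇔_)
open import Level using (0ℓ)
open import Relation.Binary.PropositionalEquality
  using (_≡_; refl; sym; trans; cong; subst; setoid; module ≡-Reasoning)

------------------------------------------------------------------------
-- Finite groups, subgroups and quotients

record FiniteGroup (n : ℕ) : Set where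
  infixl 7 _∙_
  field
    _∙_     : Fin n → Fin n → Fin n
    ε       : Fin n
    _⁻¹     : Fin n → Fin n
    isGroup : IsGroup _≡_ _∙_ ε _⁻¹

  group : Group 0ℓ 0ℓ
  group = record { isGroup = isGroup }

module _ {n : ℕ} (G : FiniteGroup n) where
  open FiniteGroup G using (group)
  open Group group using (_∙_; ε; _⁻¹; _\\_; assoc; identityˡ; identityʳ; inverseˡ; inverseʳ)
  open GroupProperties group using (⁻¹-involutive; ⁻¹-anti-homo-∙; \\-leftDividesˡ)

  record IsSubgroup (H : Subset n) : Set where
    field
      ε∈  : ε ∈ H
      ∙∈  : ∀ {x y} → x ∈ H → y ∈ H → x ∙ y ∈ H
      ⁻¹∈ : ∀ {x} → x ∈ H → x ⁻¹ ∈ H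

  Normalizes : Subset n → Subset n → Set
  Normalizes H N = ∀ {h x} → h ∈ H → x ∈ N → h ∙ x ∙ h ⁻¹ ∈ N

  -- H / N as a setoid group: elements of H, identified when they lie in
  -- the same coset of N.
  quotient : {H N : Subset n} → IsSubgroup H → IsSubgroup N → Normalizes H N → Group 0ℓ 0ℓ
  quotient {H} {N} H≤G N≤G N◁H = record
    { Carrier = ∃ λ x → x ∈ H
    ; _≈_     = λ (x , _) (y , _) → x \\ y ∈ N
    ; _∙_     = λ (x , x∈H) (y , y∈H) → x ∙ y , H.∙∈ x∈H y∈H
    ; ε       = ε , H.ε∈
    ; _⁻¹     = λ (x , x∈H) → x ⁻¹ , H.⁻¹∈ x∈H
    ; isGroup = record
      { isMonoid = record
        { isSemigroup = record
          { isMagma = record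
            { isEquivalence = record
              { refl  = ≡⇒≈ refl
              ; sym   = λ {(x , _)} {(y , _)} x≈y → subst (_∈ N) (flip-\\ x y) (N.⁻¹∈ x≈y)
              ; trans = λ {(x , _)} {(y , _)} {(z , _)} x≈y y≈z →
                          subst (_∈ N) (\\-trans x y z) (N.∙∈ x≈y y≈z)
              }
            ; ∙-cong = λ {(x , _)} {(y , _)} {(u , u∈H)} {(v , _)} x≈y u≈v →
                subst (_∈ N) (∙-cong-eq x y u v)
                  (N.∙∈ (N◁H (H.⁻¹∈ u∈H) x≈y) u≈v)
            }
          ; assoc = λ (x , _) (y , _) (z , _) → ≡⇒≈ (assoc x y z)
          }
        ; identity = (λ (x , _) → ≡⇒≈ (identityˡ x)) , (λ (x , _) → ≡⇒≈ (identityʳ x))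
        }
      ; inverse = (λ (x , _) → ≡⇒≈ (inverseˡ x)) , (λ (x , _) → ≡⇒≈ (inverseʳ x))
      ; ⁻¹-cong = λ {(x , x∈H)} {(y , y∈H)} x≈y →
          subst (_∈ N) (⁻¹-cong-eq x y)
            (N◁H y∈H (subst (_∈ N) (flip-\\ x y) (N.⁻¹∈ x≈y)))
      }
    }
    where
    module H = IsSubgroup H≤G
    module N = IsSubgroup N≤G
    open ≡-Reasoning

    ≡⇒≈ : ∀ {x y} → x ≡ y → x \\ y ∈ N
    ≡⇒≈ {x} refl = subst (_∈ N) (sym (inverseˡ x)) N.ε∈

    flip-\\ : ∀ x y → (x \\ y) ⁻¹ ≡ y \\ x
    flip-\\ x y = trans (⁻¹-anti-homo-∙ (x ⁻¹) y) (cong (y ⁻¹ ∙_) (⁻¹-involutive x))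

    \\-trans : ∀ x y z → (x \\ y) ∙ (y \\ z) ≡ x \\ z
    \\-trans x y z = trans (assoc (x ⁻¹) y (y \\ z)) (cong (x ⁻¹ ∙_) (\\-leftDividesˡ y z))

    ∙-cong-eq : ∀ x y u v → (u ⁻¹ ∙ (x \\ y) ∙ u ⁻¹ ⁻¹) ∙ (u \\ v) ≡ (x ∙ u) \\ (y ∙ v)
    ∙-cong-eq x y u v = begin
      (u ⁻¹ ∙ (x \\ y) ∙ u ⁻¹ ⁻¹) ∙ (u \\ v)
        ≡⟨ cong (λ w → (u ⁻¹ ∙ (x \\ y) ∙ w) ∙ (u \\ v)) (⁻¹-involutive u) ⟩
      (u ⁻¹ ∙ (x \\ y) ∙ u) ∙ (u \\ v)
        ≡⟨ assoc (u ⁻¹ ∙ (x \\ y)) u (u \\ v) ⟩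
      u ⁻¹ ∙ (x \\ y) ∙ (u ∙ (u \\ v))
        ≡⟨ cong (u ⁻¹ ∙ (x \\ y) ∙_) (\\-leftDividesˡ u v) ⟩
      u ⁻¹ ∙ (x ⁻¹ ∙ y) ∙ v
        ≡⟨ cong (_∙ v) (sym (assoc (u ⁻¹) (x ⁻¹) y)) ⟩
      u ⁻¹ ∙ x ⁻¹ ∙ y ∙ v
        ≡⟨ cong (λ w → w ∙ y ∙ v) (sym (⁻¹-anti-homo-∙ x u)) ⟩
      (x ∙ u) ⁻¹ ∙ y ∙ v
        ≡⟨ assoc ((x ∙ u) ⁻¹) y v ⟩
      (x ∙ u) \\ (y ∙ v) ∎

    ⁻¹-cong-eq : ∀ x y → y ∙ (y \\ x) ∙ y ⁻¹ ≡ (x ⁻¹) \\ (y ⁻¹)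
    ⁻¹-cong-eq x y = cong (_∙ y ⁻¹) (trans (\\-leftDividesˡ y x) (sym (⁻¹-involutive x)))

HasOrder : Group 0ℓ 0ℓ → ℕ → Set
HasOrder Q k = Bijection (setoid (Fin k)) (Group.setoid Q)

------------------------------------------------------------------------
-- Composition series

-- Inclusions are strict: with repeated terms allowed, no subnormal
-- series would be maximal.
record SubnormalSeries {n : ℕ} (G : FiniteGroup n) : Set where
  open FiniteGroup G using (ε)
  field
    length   : ℕ
    term     : Fin (suc length) → Subset n
    subgroup : ∀ i → IsSubgroup G (term i)
    bottom   : term zero ≡ ⁅ ε ⁆
    top      : term (fromℕ length) ≡ ⊤
    strict   : ∀ i → term (inject₁ i) ⊂ term (suc i)
    normal   : ∀ i → Normalizes G (term (suc i)) (term (inject₁ i))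

  factor : Fin length → Group 0ℓ 0ℓ
  factor i = quotient G (subgroup (suc i)) (subgroup (inject₁ i)) (normal i)

module _ {n : ℕ} {G : FiniteGroup n} where
  open SubnormalSeries

  _RefinedBy_ : SubnormalSeries G → SubnormalSeries G → Set
  S RefinedBy T = ∀ i → ∃ λ j → term S i ≡ term T j

  IsMaximal : SubnormalSeries G → Set
  IsMaximal S = ∀ T → S RefinedBy T → T RefinedBy S

record CompositionSeries {n : ℕ} (G : FiniteGroup n) : Set where
  field
    series  : SubnormalSeries G
    maximal : IsMaximal series

  open SubnormalSeries series public

FactorOrders≤ : ∀ {n} {G : FiniteGroup n} → CompositionSeries G → ℕ → Set
FactorOrders≤ S α = ∀ i → ∃ λ k → HasOrder (factor i) k × k ≤ α
  where open CompositionSeries S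

module _ {n n′ : ℕ} {G : FiniteGroup n} {H : FiniteGroup n′} where
  open GroupMorphisms (Group.rawGroup (FiniteGroup.group G)) (Group.rawGroup (FiniteGroup.group H))
    using (IsGroupIsomorphism)

  infix 4 _≅_
  record _≅_ (S : CompositionSeries G) (T : CompositionSeries H) : Set where
    private
      module S = CompositionSeries S
      module T = CompositionSeries T
    field
      φ       : Fin n → Fin n′
      isIso   : IsGroupIsomorphism φ
      length≡ : S.length ≡ T.length
      image   : ∀ i {y} → y ∈ T.term (cast (cong suc length≡) i) ⇔ (∃ λ x → x ∈ S.term i × φ x ≡ y)

------------------------------------------------------------------------
-- Model of computation: call-by-value pure Lisp, i.e. recursive functions
-- over binary trees with leaf `nil`.  The running time is the number of
-- evaluation rules applied.  With values held as pointers (and closures as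
-- a code pointer and an environment pointer) each rule takes a number of
-- RAM operations bounded in terms of the program alone; conversely Turing machines
-- are simulated with polynomial overhead.

data Term (n : ℕ) : Set where
  var  : Fin n → Term n
  nil  : Term n
  cons : Term n → Term n → Term n
  -- `case e a b`: a if e is nil; b if e is a cons, with its head as
  -- variable 0 and its tail as variable 1.
  case : Term n → Term n → Term (2 + n) → Term n
  -- In `fun b`, variable 0 is the argument and variable 1 the function itself.
  fun  : Term (2 + n) → Term n
  app  : Term n → Term n → Term n

data Value : Set where
  nil     : Value
  cons    : Value → Value → Value
  closure : ∀ {n} → Term (2 + n) → Vec Value n → Value

-- ρ ⊢ e ⇓ v [ t ]: in environment ρ, e evaluates to v in t steps.
infix 4 _⊢_⇓_[_]
data _⊢_⇓_[_] {n : ℕ} (ρ : Vec Value n) : Term n → Value → ℕ → Set where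
  var       : ∀ {x} → ρ ⊢ var x ⇓ lookup ρ x [ 1 ]
  nil       : ρ ⊢ nil ⇓ nil [ 1 ]
  cons      : ∀ {a b u v s t} →
              ρ ⊢ a ⇓ u [ s ] → ρ ⊢ b ⇓ v [ t ] →
              ρ ⊢ cons a b ⇓ cons u v [ suc (s + t) ]
  case-nil  : ∀ {e a b v s t} →
              ρ ⊢ e ⇓ nil [ s ] → ρ ⊢ a ⇓ v [ t ] →
              ρ ⊢ case e a b ⇓ v [ suc (s + t) ]
  case-cons : ∀ {e a b h r v s t} →
              ρ ⊢ e ⇓ cons h r [ s ] → (h ∷ r ∷ ρ) ⊢ b ⇓ v [ t ] →
              ρ ⊢ case e a b ⇓ v [ suc (s + t) ]
  fun       : ∀ {b} → ρ ⊢ fun b ⇓ closure b ρ [ 1 ]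
  app       : ∀ {f a m} {b : Term (2 + m)} {σ u v r s t} →
              ρ ⊢ f ⇓ closure b σ [ r ] → ρ ⊢ a ⇓ u [ s ] →
              (u ∷ closure b σ ∷ σ) ⊢ b ⇓ v [ t ] →
              ρ ⊢ app f a ⇓ v [ suc (r + s + t) ]

-- So "evaluates to v in t steps" is a property of the run of a program.
⇓-deterministic : ∀ {n} {ρ : Vec Value n} {e v v′ t t′} →
                  ρ ⊢ e ⇓ v [ t ] → ρ ⊢ e ⇓ v′ [ t′ ] → v ≡ v′ × t ≡ t′
⇓-deterministic var var = refl , refl
⇓-deterministic nil nil = refl , refl
⇓-deterministic (cons p q) (cons p′ q′)
  with refl , refl ← ⇓-deterministic p p′ | refl , refl ← ⇓-deterministic q q′ = refl , refl
⇓-deterministic (case-nil p q) (case-nil p′ q′)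
  with refl , refl ← ⇓-deterministic p p′ | refl , refl ← ⇓-deterministic q q′ = refl , refl
⇓-deterministic (case-nil p _) (case-cons p′ _) with () ← proj₁ (⇓-deterministic p p′)
⇓-deterministic (case-cons p _) (case-nil p′ _) with () ← proj₁ (⇓-deterministic p p′)
⇓-deterministic (case-cons p q) (case-cons p′ q′)
  with refl , refl ← ⇓-deterministic p p′
  with refl , refl ← ⇓-deterministic q q′ = refl , refl
⇓-deterministic fun fun = refl , refl
⇓-deterministic (app p q r) (app p′ q′ r′)
  with refl , refl ← ⇓-deterministic p p′ | refl , refl ← ⇓-deterministic q q′
  with refl , refl ← ⇓-deterministic r r′ = refl , refl

-- The input is variable 0.
Program : Set
Program = Term 1

------------------------------------------------------------------------
-- Input and output

encodeBool : Bool → Value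
encodeBool false = nil
encodeBool true  = cons nil nil

encodeList : {A : Set} → (A → Value) → List A → Value
encodeList f = List.foldr (λ a → cons (f a)) nil

-- Unary; since the elements of a group of order n are numbered 0, …, n - 1,
-- its table still has size polynomial in n.
encodeFin : ∀ {n} → Fin n → Value
encodeFin zero    = nil
encodeFin (suc i) = cons nil (encodeFin i)

encodeGroup : ∀ {n} → FiniteGroup n → Value
encodeGroup {n} G =
  encodeList (λ x → encodeList (λ y → encodeFin (x ∙ y)) (List.allFin n)) (List.allFin n)
  where open FiniteGroup G

encodeSubset : ∀ {n} → Subset n → Value
encodeSubset p = encodeList encodeBool (Vec.toList p)

encodeSeries : ∀ {n} {G : FiniteGroup n} → CompositionSeries G → Value
encodeSeries {G = G} S = cons (encodeGroup G) (encodeList encodeSubset (List.tabulate term))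
  where open CompositionSeries S

-- On input v, the program P decides the proposition A in at most T steps.
Decides : Program → Value → Set → ℕ → Set
Decides P v A T =
  ∃₂ λ b t → (v ∷ []) ⊢ P ⇓ encodeBool b [ t ] × t ≤ T × (b ≡ true ⇔ A)

-- Write L x for the last term of the series of G that does not contain x, and
-- fix a leader in every coset x · L x.  An isomorphism maps each leader to the
-- coset of a leader.  The images of all leaders can be guessed as α elements
-- of H: a factor has at most α leaders, and an element of H encodes one leader
-- per factor, as in a mixed-radix expansion.  Each of the n^α guesses takes
-- polynomial time, by Luks' method for groups with a fixed series.  Going up the
-- series, the automorphisms of Gᵢ that preserve all cosets x · L x are kept in a
-- table of coset representatives à la Sims.  Those bijections of Gᵢ₊₁ that extend
-- them with f (t u) = f t · f u for leaders t and u ∈ Gᵢ have known generators,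
-- and multiplicativity is imposed on them at one pair (x , y) after another, x
-- running up the series.  Every step passes to a subgroup of index at most n,
-- since the coset of f is determined by f⁻¹ (f x · f y); so sifting gives
-- generators of the next automorphism group, and the same table turns a map
-- Gᵢ₊₁ → Hᵢ₊₁ that extends an isomorphism into an isomorphism, if there is one.

module Submission where

open import Defs
open import Algebra.Bundles using (Group)
open import Algebra.Morphism.Structures using (module GroupMorphisms)
import Algebra.Properties.Group as GroupProperties
open import Data.Bool.Base using (Bool; true; false; if_then_else_; not)
open import Data.Empty using (⊥-elim)
open import Data.Fin.Base as Fin using (Fin; zero; suc; toℕ; _↑ʳ_)
import Data.Fin.Properties as Finₚ
import Data.Fin.Subset as Subset
import Data.Fin.Subset.Properties as Subsetₚ
open import Data.List.Base as List using (List; []; _∷_; _++_; length; foldl; allFin)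
open import Data.List.Membership.Propositional using () renaming (_∈_ to _∈ₗ_)
import Data.List.Membership.Propositional.Properties as ∈ₚ
import Data.List.Properties as Listₚ
open import Data.List.Relation.Unary.All as All using (All; []; _∷_)
import Data.List.Relation.Unary.All.Properties as Allₚ
open import Data.List.Relation.Unary.AllPairs as AllPairs using (AllPairs; []; _∷_)
import Data.List.Relation.Unary.AllPairs.Properties as AllPairsₚ
open import Data.List.Relation.Unary.Any as Any using (here; there)
import Data.List.Relation.Unary.Any.Properties as Anyₚ
open import Data.Nat.Base using (ℕ; zero; suc; _+_; _*_; _^_; _⊓_; _≤_; _<_; z≤n; s≤s; z<s)
import Data.Nat.Properties as ℕₚ
open import Data.Nat.Solver using (module +-*-Solver)
open import Data.Product.Base using (Σ-syntax; ∃; ∃₂; _×_; _,_; proj₁; proj₂)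
open import Data.Product.Properties using (≡-dec)
open import Data.Sum.Base using (_⊎_; inj₁; inj₂; [_,_]′)
open import Data.Unit.Base using (⊤; tt)
open import Data.Vec.Base as Vec using (Vec; []; _∷_; lookup; tabulate)
import Data.Vec.Properties as Vecₚ
open import Function.Base using (_∘_; id)
open import Function.Bundles using (module Bijection; _⇔_; mk⇔; module Equivalence)
open import Relation.Binary.PropositionalEquality
  using (_≡_; _≢_; refl; sym; trans; cong; cong₂; subst; subst₂; module ≡-Reasoning)
open import Relation.Nullary using (¬_; Dec; yes; no)
open import Relation.Nullary.Decidable using (does)

-- A language of bounded loops, with polynomial running times

-- The program is not told α: it branches over the elements of the group until the guess is
-- complete, and only the analysis knows that the depth is bounded by the number of leaders on a
-- level. The map that a complete guess leads to is verified from scratch, so soundness is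
-- immediate, and the tables have to be right only if some isomorphism φ exists. Then each
-- intermediate map is φ ∘ f on the part treated, for an unknown bijection f, and reducing it by a
-- table of G must mirror the reduction of f. As f cannot be computed, a representative is found by
-- trying all slots against the test in H instead of computing a coset. Multiplicativity at a single
-- pair does not define a subgroup, so each test stands for a condition on a whole pair of cosets.
-- One pair witnesses that condition only after it has been established for all left factors in
-- lower terms; this dictates the order of the tests. For a time bound on an actual program, the
-- algorithm is written in a small language whose loops run over all indices. Costs are then
-- polynomials read off from the syntax.

data Ty : Set where
  bool ix : Ty
  arr lst : Ty → Ty
  _⊗_     : Ty → Ty → Ty

infixr 6 _⊗_

Ctx : Set
Ctx = List Ty

mutual
  data Exp : Ctx → Ty → Set where
    var    : ∀ {Γ} (i : Fin (length Γ)) → Exp Γ (List.lookup Γ i)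
    zer    : ∀ {Γ} → Exp Γ ix
    tru    : ∀ {Γ} → Exp Γ bool
    fls    : ∀ {Γ} → Exp Γ bool
    ite    : ∀ {Γ τ} → Exp Γ bool → Exp Γ τ → Exp Γ τ → Exp Γ τ
    less   : ∀ {Γ} → Exp Γ ix → Exp Γ ix → Exp Γ bool
    pair   : ∀ {Γ σ τ} → Exp Γ σ → Exp Γ τ → Exp Γ (σ ⊗ τ)
    fst    : ∀ {Γ σ τ} → Exp Γ (σ ⊗ τ) → Exp Γ σ
    snd    : ∀ {Γ σ τ} → Exp Γ (σ ⊗ τ) → Exp Γ τ
    tab    : ∀ {Γ τ} → Exp (ix ∷ Γ) τ → Exp Γ (arr τ)
    look   : ∀ {Γ τ} → Exp Γ (arr τ) → Exp Γ ix → Exp Γ τ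
    -- The body sees the accumulator as variable 0 and the index as variable 1.
    fold   : ∀ {Γ τ} → Exp (τ ∷ ix ∷ Γ) τ → Exp Γ τ → Exp Γ τ
    uncons : ∀ {Γ σ τ} → Exp Γ (lst τ) → Exp Γ σ → Exp (τ ∷ lst τ ∷ Γ) σ → Exp Γ σ
    -- The body has a context of its own, so procedures compose as closed expressions; together with
    -- `under` this avoids renaming of variables.
    call   : ∀ {Γ Δ τ} → Exp Δ τ → Args Γ Δ → Exp Γ τ
    -- Evaluates the body with the variables Ξ replaced by the arguments.
    under  : ∀ Ξ {Γ Δ τ} → Args (Ξ ++ Γ) Δ → Exp (Δ ++ Γ) τ → Exp (Ξ ++ Γ) τ

  data Args : Ctx → Ctx → Set where
    []  : ∀ {Γ} → Args Γ []
    _∷_ : ∀ {Γ Δ τ} → Exp Γ τ → Args Γ Δ → Args Γ (τ ∷ Δ)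

_<ᵇ_ : ∀ {m n} → Fin m → Fin n → Bool
_     <ᵇ zero  = false
zero  <ᵇ suc _ = true
suc i <ᵇ suc j = i <ᵇ j

-- Indices range over the elements of a group of order suc n.
El : ℕ → Ty → Set
El n bool    = Bool
El n ix      = Fin (suc n)
El n (arr τ) = Vec (El n τ) (suc n)
El n (lst τ) = List (El n τ)
El n (σ ⊗ τ) = El n σ × El n τ

Env : ℕ → Ctx → Set
Env n []      = ⊤
Env n (τ ∷ Γ) = El n τ × Env n Γ

lookupEnv : ∀ {n} Γ (i : Fin (length Γ)) → Env n Γ → El n (List.lookup Γ i)
lookupEnv (τ ∷ Γ) zero    (x , ρ) = x
lookupEnv (τ ∷ Γ) (suc i) (x , ρ) = lookupEnv Γ i ρ

dropEnv : ∀ {n} Ξ {Γ} → Env n (Ξ ++ Γ) → Env n Γ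
dropEnv []      ρ       = ρ
dropEnv (_ ∷ Ξ) (_ , ρ) = dropEnv Ξ ρ

-- Opaque, so that loops over all indices do not unfold.
abstract
  indices : ∀ n → List (Fin (suc n))
  indices n = allFin (suc n)

  indices≡ : ∀ n → indices n ≡ allFin (suc n)
  indices≡ n = refl

  table : ∀ {A : Set} {n} → (Fin (suc n) → A) → Vec A (suc n)
  table = tabulate

  table≡ : ∀ {A : Set} {n} (f : Fin (suc n) → A) → table f ≡ tabulate f
  table≡ f = refl

module _ {n : ℕ} where
  mutual
    eval : ∀ {Γ τ} → Exp Γ τ → Env n Γ → El n τ
    eval {Γ} (var i)      ρ = lookupEnv Γ i ρ
    eval zer              ρ = zero
    eval tru              ρ = true
    eval fls              ρ = false
    eval (ite c a b)      ρ = if eval c ρ then eval a ρ else eval b ρ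
    eval (less i j)       ρ = eval i ρ <ᵇ eval j ρ
    eval (pair a b)       ρ = eval a ρ , eval b ρ
    eval (fst e)          ρ = proj₁ (eval e ρ)
    eval (snd e)          ρ = proj₂ (eval e ρ)
    eval (tab e)          ρ = table λ i → eval e (i , ρ)
    eval (look a i)       ρ = lookup (eval a ρ) (eval i ρ)
    eval (fold e a)       ρ = foldl (λ acc i → eval e (acc , i , ρ)) (eval a ρ) (indices n)
    eval (uncons e a b)   ρ = evalUncons b (eval e ρ) (eval a ρ) ρ
    eval (call e as)      ρ = eval e (evalArgs as ρ)
    eval (under Ξ as e)   ρ = eval e (evalArgs++ as ρ (dropEnv Ξ ρ))

    evalUncons : ∀ {Γ σ τ} → Exp (τ ∷ lst τ ∷ Γ) σ → List (El n τ) → El n σ → Env n Γ → El n σ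
    evalUncons b []       a ρ = a
    evalUncons b (x ∷ xs) a ρ = eval b (x , xs , ρ)

    evalArgs : ∀ {Γ Δ} → Args Γ Δ → Env n Γ → Env n Δ
    evalArgs []       ρ = tt
    evalArgs (a ∷ as) ρ = eval a ρ , evalArgs as ρ

    evalArgs++ : ∀ {Γ Δ Γ₀} → Args Γ Δ → Env n Γ → Env n Γ₀ → Env n (Δ ++ Γ₀)
    evalArgs++ []       ρ ρ₀ = ρ₀
    evalArgs++ (a ∷ as) ρ ρ₀ = eval a ρ , evalArgs++ as ρ ρ₀

encode : ∀ {n} τ → El n τ → Value
encode bool    b       = encodeBool b
encode ix      i       = encodeFin i
encode (arr τ) v       = encodeList (encode τ) (Vec.toList v)
encode (lst τ) l       = encodeList (encode τ) l
encode (σ ⊗ τ) (x , y) = cons (encode σ x) (encode τ y)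

encodeEnv : ∀ {n} Γ → Env n Γ → Value
encodeEnv []      _       = nil
encodeEnv (τ ∷ Γ) (x , ρ) = cons (encode τ x) (encodeEnv Γ ρ)

rangeOf : ℕ → Value
rangeOf n = encodeList encodeFin (allFin (suc n))

-- Compilation to Lisp: variable r holds the list of all indices, and
-- variable p the list of the values of the context.

pattern v0 = zero
pattern v1 = suc zero
pattern v2 = suc (suc zero)
pattern v3 = suc (suc (suc zero))
pattern v4 = suc (suc (suc (suc zero)))
pattern v5 = suc (suc (suc (suc (suc zero))))
pattern v6 = suc (suc (suc (suc (suc (suc zero)))))
pattern v7 = suc (suc (suc (suc (suc (suc (suc zero))))))
pattern v8 = suc (suc (suc (suc (suc (suc (suc (suc zero)))))))
pattern v9 = suc (suc (suc (suc (suc (suc (suc (suc (suc zero))))))))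

hdT tlT : ∀ {m} → Term m → Term m
hdT t = case t nil (var v0)
tlT t = case t nil (var v1)

tlsT : ∀ {m} → ℕ → Term m → Term m
tlsT zero    t = t
tlsT (suc k) t = tlsT k (tlT t)

-- A one-element list is taken apart at once: the body sees the value as variable 0 and `nil` as
-- variable 1, hence all shifts by two.
letT : ∀ {m} → Term m → Term (2 + m) → Term m
letT a b = case (cons a nil) nil b

-- Two arguments travel as one pair. Every `case` around a recursive call pushes two variables, so
-- the function itself, first variable 1, has become variable 5 or 7.
nthT lessT : ∀ {m} → Term m
nthT = fun (case (var v0) nil (case (var v0) (hdT (var v1)) (app (var v5) (cons (var v1) (tlT (var v3))))))
lessT = fun (case (var v0) nil (case (var v1) nil
  (case (var v2) (cons nil nil) (app (var v7) (cons (var v1) (var v3))))))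

tabT : ∀ {m} → Fin m → Term (6 + m) → Term (2 + m)
tabT p e = case (var v0) nil (cons (letT (cons (var v0) (var (4 ↑ʳ p))) e) (app (var v3) (var v1)))

foldT : ∀ {m} → Fin m → Term (8 + m) → Term (2 + m)
foldT p e = case (var v0) nil (case (var v0) (var v1)
  (app (var v5) (cons (var v1) (letT (cons (var v3) (cons (var v0) (var (6 ↑ʳ p)))) e))))

mutual
  compile : ∀ {m Γ τ} (r p : Fin m) → Exp Γ τ → Term m
  compile r p (var i)        = hdT (tlsT (toℕ i) (var p))
  compile r p zer            = nil
  compile r p tru            = cons nil nil
  compile r p fls            = nil
  compile r p (ite c a b)    = case (compile r p c) (compile r p b) (compile (2 ↑ʳ r) (2 ↑ʳ p) a)
  compile r p (less i j)     = app lessT (cons (compile r p i) (compile r p j))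
  compile r p (pair a b)     = cons (compile r p a) (compile r p b)
  compile r p (fst e)        = hdT (compile r p e)
  compile r p (snd e)        = tlT (compile r p e)
  compile r p (tab e)        = app (fun (tabT p (compile (6 ↑ʳ r) v0 e))) (var r)
  compile r p (look a i)     = app nthT (cons (compile r p i) (compile r p a))
  compile r p (fold e a)     = app (fun (foldT p (compile (8 ↑ʳ r) v0 e))) (cons (var r) (compile r p a))
  compile r p (uncons e a b) = case (compile r p e) (compile r p a)
    (letT (cons (var v0) (cons (var v1) (var (2 ↑ʳ p)))) (compile (4 ↑ʳ r) v0 b))
  compile r p (call e as)    = letT (compileArgs r p as nil) (compile (2 ↑ʳ r) v0 e)
  compile r p (under Ξ as e) = letT (compileArgs r p as (tlsT (length Ξ) (var p))) (compile (2 ↑ʳ r) v0 e)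

  compileArgs : ∀ {m Γ Δ} (r p : Fin m) → Args Γ Δ → Term m → Term m
  compileArgs r p []       t = t
  compileArgs r p (a ∷ as) t = cons (compile r p a) (compileArgs r p as t)

-- Running times of the compiled programs

infix 4 _⊢_⇓_within_
_⊢_⇓_within_ : ∀ {m} → Vec Value m → Term m → Value → ℕ → Set
ρ ⊢ e ⇓ v within T = ∃ λ t → ρ ⊢ e ⇓ v [ t ] × t ≤ T

within-≤ : ∀ {m} {ρ : Vec Value m} {e v S T} → S ≤ T → ρ ⊢ e ⇓ v within S → ρ ⊢ e ⇓ v within T
within-≤ S≤T (t , d , t≤S) = t , d , ℕₚ.≤-trans t≤S S≤T

module _ {m} {ρ : Vec Value m} where

  w-var : ∀ {x v} → lookup ρ x ≡ v → ρ ⊢ var x ⇓ v within 1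
  w-var refl = 1 , var , ℕₚ.≤-refl

  w-nil : ρ ⊢ nil ⇓ nil within 1
  w-nil = 1 , nil , ℕₚ.≤-refl

  w-cons : ∀ {a b u v S T} → ρ ⊢ a ⇓ u within S → ρ ⊢ b ⇓ v within T → ρ ⊢ cons a b ⇓ cons u v within suc (S + T)
  w-cons (_ , d , p) (_ , e , q) = _ , cons d e , s≤s (ℕₚ.+-mono-≤ p q)

  w-case-nil : ∀ {e a b v S T} → ρ ⊢ e ⇓ nil within S → ρ ⊢ a ⇓ v within T → ρ ⊢ case e a b ⇓ v within suc (S + T)
  w-case-nil (_ , d , p) (_ , e , q) = _ , case-nil d e , s≤s (ℕₚ.+-mono-≤ p q)

  w-case-cons : ∀ {e a b h r v S T} → ρ ⊢ e ⇓ cons h r within S → (h ∷ r ∷ ρ) ⊢ b ⇓ v within T →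
                ρ ⊢ case e a b ⇓ v within suc (S + T)
  w-case-cons (_ , d , p) (_ , e , q) = _ , case-cons d e , s≤s (ℕₚ.+-mono-≤ p q)

  w-fun : ∀ {b} → ρ ⊢ fun b ⇓ closure b ρ within 1
  w-fun = 1 , fun , ℕₚ.≤-refl

  w-app : ∀ {f a k} {b : Term (2 + k)} {σ u v R S T} → ρ ⊢ f ⇓ closure b σ within R → ρ ⊢ a ⇓ u within S →
          (u ∷ closure b σ ∷ σ) ⊢ b ⇓ v within T → ρ ⊢ app f a ⇓ v within suc (R + S + T)
  w-app (_ , d , p) (_ , e , q) (_ , f , r) = _ , app d e f , s≤s (ℕₚ.+-mono-≤ (ℕₚ.+-mono-≤ p q) r)

module _ {m} {ρ : Vec Value m} where

  w-let : ∀ {a b u v S T} → ρ ⊢ a ⇓ u within S → (u ∷ nil ∷ ρ) ⊢ b ⇓ v within T → ρ ⊢ letT a b ⇓ v within suc (suc (S + 1) + T)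
  w-let p q = w-case-cons (w-cons p w-nil) q

  w-hd : ∀ {a u v S} → ρ ⊢ a ⇓ cons u v within S → ρ ⊢ hdT a ⇓ u within suc (S + 1)
  w-hd p = w-case-cons p (w-var refl)

  w-tl : ∀ {a u v S} → ρ ⊢ a ⇓ cons u v within S → ρ ⊢ tlT a ⇓ v within suc (S + 1)
  w-tl p = w-case-cons p (w-var refl)

infixl 6 _⊕_
infixl 7 _⊛_
data Poly : Set where
  size    : Poly
  con     : ℕ → Poly
  _⊕_ _⊛_ : Poly → Poly → Poly

_at_ : Poly → ℕ → ℕ
size    at n = suc n
con k   at n = k
(p ⊕ q) at n = p at n + q at n
(p ⊛ q) at n = p at n * q at n

-- The base is the order plus one, hence at least 2 even for the trivial group; a power of it can
-- absorb constants, as `k ≤ 2 ^ k`, and the sum of two powers.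
poly-bound : ∀ p → ∃ λ c → ∀ n → p at n ≤ suc (suc n) ^ c
poly-bound size = 1 , λ n → ℕₚ.≤-trans (ℕₚ.n≤1+n _) (ℕₚ.≤-reflexive (sym (ℕₚ.*-identityʳ _)))
poly-bound (con k) = k , λ n → ℕₚ.≤-trans (k≤2^k k) (ℕₚ.^-monoˡ-≤ k (s≤s (s≤s z≤n)))
  where
  k≤2^k : ∀ k → k ≤ 2 ^ k
  k≤2^k zero    = z≤n
  k≤2^k (suc k) = ℕₚ.≤-trans (ℕₚ.+-mono-≤ (ℕₚ.m^n>0 2 k) (k≤2^k k))
                    (ℕₚ.≤-reflexive (cong (2 ^ k +_) (sym (ℕₚ.+-identityʳ _))))
poly-bound (p ⊕ q) with poly-bound p | poly-bound q
... | c , p≤ | d , q≤ = suc (c + d) , λ n →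
  let b = suc (suc n) in
  ℕₚ.≤-trans (ℕₚ.+-mono-≤ (ℕₚ.≤-trans (p≤ n) (ℕₚ.^-monoʳ-≤ b (ℕₚ.m≤m+n c d)))
                           (ℕₚ.≤-trans (q≤ n) (ℕₚ.^-monoʳ-≤ b (ℕₚ.m≤n+m d c))))
    (ℕₚ.≤-trans (ℕₚ.≤-reflexive (cong (b ^ (c + d) +_) (sym (ℕₚ.+-identityʳ _))))
      (ℕₚ.*-monoˡ-≤ (b ^ (c + d)) {2} {b} (s≤s (s≤s z≤n))))
poly-bound (p ⊛ q) with poly-bound p | poly-bound q
... | c , p≤ | d , q≤ = c + d , λ n →
  ℕₚ.≤-trans (ℕₚ.*-mono-≤ (p≤ n) (q≤ n)) (ℕₚ.≤-reflexive (sym (ℕₚ.^-distribˡ-+-* (suc (suc n)) c d)))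

mutual
  -- Loops always run through all indices and `uncons` inspects a single cell, so neither values nor
  -- lengths of lists enter. Both branches of a conditional are paid for.
  cost : ∀ {Γ τ} → Exp Γ τ → Poly
  cost (var i)        = con (suc (toℕ i * 2 + 1 + 1))
  cost zer            = con 1
  cost tru            = con 3
  cost fls            = con 1
  cost (ite c a b)    = con 1 ⊕ (cost c ⊕ (cost a ⊕ cost b))
  cost (less i j)     = con 1 ⊕ (con 1 ⊕ (con 1 ⊕ (cost i ⊕ cost j)) ⊕ (size ⊛ con 12 ⊕ con 20))
  cost (pair a b)     = con 1 ⊕ (cost a ⊕ cost b)
  cost (fst e)        = con 1 ⊕ (cost e ⊕ con 1)
  cost (snd e)        = con 1 ⊕ (cost e ⊕ con 1)
  cost (tab e)        = con 1 ⊕ (con 2 ⊕ (size ⊛ (con 12 ⊕ cost e) ⊕ con 3))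
  cost (look a i)     = con 1 ⊕ (con 1 ⊕ (con 1 ⊕ (cost i ⊕ cost a)) ⊕ (size ⊛ con 12 ⊕ con 20))
  cost (fold e a)     = con 1 ⊕ (con 1 ⊕ (con 1 ⊕ (con 1 ⊕ cost a)) ⊕ (size ⊛ (con 16 ⊕ cost e) ⊕ con 5))
  cost (uncons e a b) = con 1 ⊕ (cost e ⊕ (cost a ⊕ (con 1 ⊕ (con 7 ⊕ cost b))))
  cost (call e as)    = con 1 ⊕ (con 1 ⊕ (costArgs as ⊕ con 1 ⊕ con 1) ⊕ cost e)
  cost (under Ξ as e) = con 1 ⊕ (con 1 ⊕ (costArgs as ⊕ con (length Ξ * 2 + 1) ⊕ con 1) ⊕ cost e)

  costArgs : ∀ {Γ Δ} → Args Γ Δ → Poly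
  costArgs []       = con 0
  costArgs (a ∷ as) = con 1 ⊕ (cost a ⊕ costArgs as)

module _ {n : ℕ} {m : ℕ} {σ : Vec Value m} where

  run-tls : ∀ Ξ {Γ t S} (ρ : Env n (Ξ ++ Γ)) → σ ⊢ t ⇓ encodeEnv (Ξ ++ Γ) ρ within S →
            σ ⊢ tlsT (length Ξ) t ⇓ encodeEnv Γ (dropEnv Ξ ρ) within (length Ξ * 2 + S)
  run-tls []      ρ       run = run
  run-tls (_ ∷ Ξ) {S = S} (_ , ρ) run = within-≤ (ℕₚ.≤-reflexive (eq (length Ξ * 2) S)) (run-tls Ξ ρ (w-tl run))
    where
    eq : ∀ a b → a + suc (b + 1) ≡ suc (suc (a + b))
    eq = solve 2 (λ a b → a :+ (con 1 :+ (b :+ con 1)) := con 2 :+ (a :+ b)) refl where open +-*-Solver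

  run-var : ∀ Γ (i : Fin (length Γ)) {t S} (ρ : Env n Γ) → σ ⊢ t ⇓ encodeEnv Γ ρ within S →
            σ ⊢ hdT (tlsT (toℕ i) t) ⇓ encode (List.lookup Γ i) (lookupEnv Γ i ρ) within suc (toℕ i * 2 + S + 1)
  run-var (_ ∷ Γ) zero    (_ , ρ) run = w-hd run
  run-var (_ ∷ Γ) (suc i) {S = S} (_ , ρ) run =
    within-≤ (ℕₚ.≤-reflexive (eq (toℕ i * 2) S)) (run-var Γ i ρ (w-tl run))
    where
    eq : ∀ a b → suc (a + suc (b + 1) + 1) ≡ suc (suc (suc (a + b + 1)))
    eq = solve 2 (λ a b → con 1 :+ (a :+ (con 1 :+ (b :+ con 1)) :+ con 1) := con 3 :+ (a :+ b :+ con 1)) refl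
      where open +-*-Solver

-- A round takes 11 steps, rounded up to 12, and 20 covers every exit; the same constants serve
-- `run-nth`.
run-less : ∀ {m k l} (σ : Vec Value m) (i : Fin k) (j : Fin l) →
           let b = case (var v0) nil (case (var v1) nil (case (var v2) (cons nil nil) (app (var v7) (cons (var v1) (var v3))))) in
           (cons (encodeFin i) (encodeFin j) ∷ closure b σ ∷ σ) ⊢ b ⇓ encodeBool (i <ᵇ j) within (l * 12 + 20)
run-less {l = suc l} σ i zero = within-≤ (ℕₚ.≤-trans (ℕₚ.m≤m+n 5 15) (ℕₚ.m≤n+m 20 (suc l * 12)))
  (w-case-cons (w-var refl) (w-case-nil (w-var refl) w-nil))
run-less {l = suc l} σ zero (suc j) = within-≤ (ℕₚ.≤-trans (ℕₚ.m≤m+n 9 11) (ℕₚ.m≤n+m 20 (suc l * 12)))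
  (w-case-cons (w-var refl) (w-case-cons (w-var refl) (w-case-nil (w-var refl) (w-cons w-nil w-nil))))
run-less {l = suc l} σ (suc i) (suc j) = within-≤ (ℕₚ.+-monoˡ-≤ (l * 12 + 20) (ℕₚ.m≤m+n 11 1))
  (w-case-cons (w-var refl) (w-case-cons (w-var refl) (w-case-cons (w-var refl)
    (w-app (w-var refl) (w-cons (w-var refl) (w-var refl)) (run-less σ i j)))))

run-nth : ∀ {A : Set} (f : A → Value) {m l k} (σ : Vec Value m) (xs : Vec A l) (i : Fin l) → l ≤ k →
          let b = case (var v0) nil (case (var v0) (hdT (var v1)) (app (var v5) (cons (var v1) (tlT (var v3))))) in
          (cons (encodeFin i) (encodeList f (Vec.toList xs)) ∷ closure b σ ∷ σ) ⊢ b ⇓ f (lookup xs i) within (k * 12 + 20)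
run-nth f {k = suc k} σ (x ∷ xs) zero (s≤s _) = within-≤ (ℕₚ.≤-trans (ℕₚ.m≤m+n 7 13) (ℕₚ.m≤n+m 20 (suc k * 12)))
  (w-case-cons (w-var refl) (w-case-nil (w-var refl) (w-hd (w-var refl))))
run-nth f {k = suc k} σ (x ∷ xs) (suc i) (s≤s l≤k) = within-≤ (ℕₚ.+-monoˡ-≤ (k * 12 + 20) (ℕₚ.m≤m+n 11 1))
  (w-case-cons (w-var refl) (w-case-cons (w-var refl)
    (w-app (w-var refl) (w-cons (w-var refl) (w-tl (w-var refl))) (run-nth f σ xs i l≤k))))

run-tab : ∀ {A B : Set} (f : A → Value) (g : B → Value) (h : A → B) {m} {p : Fin m} {σ : Vec Value m} {e : Term (6 + m)} {T} →
          (∀ x {y z w u v} → (cons (f x) (lookup σ p) ∷ y ∷ z ∷ w ∷ u ∷ v ∷ σ) ⊢ e ⇓ g (h x) within T) →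
          ∀ xs → (encodeList f xs ∷ closure (tabT p e) σ ∷ σ) ⊢ tabT p e ⇓ encodeList g (List.map h xs) within (length xs * (12 + T) + 3)
run-tab f g h body []       = w-case-nil (w-var refl) w-nil
run-tab f g h {T = T} body (x ∷ xs) = within-≤ (ℕₚ.≤-reflexive (eq T (length xs * (12 + T))))
  (w-case-cons (w-var refl) (w-cons (w-let (w-cons (w-var refl) (w-var refl)) (body x))
    (w-app (w-var refl) (w-var refl) (run-tab f g h body xs))))
  where
  eq : ∀ t a → suc (suc (suc (6 + t + suc (2 + (a + 3))))) ≡ 12 + t + a + 3
  eq = solve 2 (λ t a → con 3 :+ (con 6 :+ t :+ (con 1 :+ (con 2 :+ (a :+ con 3)))) := con 12 :+ t :+ a :+ con 3) refl
    where open +-*-Solver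

run-fold : ∀ {A B : Set} (f : A → Value) (g : B → Value) (h : B → A → B) {m} {p : Fin m} {σ : Vec Value m} {e : Term (8 + m)} {T} →
           (∀ a x {y z w u v s t} → (cons (g a) (cons (f x) (lookup σ p)) ∷ y ∷ z ∷ w ∷ u ∷ v ∷ s ∷ t ∷ σ) ⊢ e ⇓ g (h a x) within T) →
           ∀ xs a → (cons (encodeList f xs) (g a) ∷ closure (foldT p e) σ ∷ σ) ⊢ foldT p e ⇓ g (foldl h a xs)
                      within (length xs * (16 + T) + 5)
run-fold f g h body []       a = w-case-cons (w-var refl) (w-case-nil (w-var refl) (w-var refl))
run-fold f g h {T = T} body (x ∷ xs) a = within-≤ (ℕₚ.≤-reflexive (eq T (length xs * (16 + T))))
  (w-case-cons (w-var refl) (w-case-cons (w-var refl)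
    (w-app (w-var refl) (w-cons (w-var refl) (w-let (w-cons (w-var refl) (w-cons (w-var refl) (w-var refl))) (body a x)))
      (run-fold f g h body xs (h a x)))))
  where
  eq : ∀ t a → suc (suc (suc (suc (suc (suc (suc (suc (8 + t))) + (a + 5)))))) ≡ 16 + t + a + 5
  eq = solve 2 (λ t a → con 8 :+ (con 8 :+ t) :+ (a :+ con 5) := con 16 :+ t :+ a :+ con 5) refl
    where open +-*-Solver

toList-tabulate : ∀ {A : Set} {k} (f : Fin k → A) → Vec.toList (tabulate f) ≡ List.tabulate f
toList-tabulate {k = zero}  f = refl
toList-tabulate {k = suc k} f = cong (f zero ∷_) (toList-tabulate (f ∘ suc))

module _ {n : ℕ} where
  mutual
    run : ∀ {m Γ τ} (e : Exp Γ τ) {r p : Fin m} {σ : Vec Value m} (ρ : Env n Γ) →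
          lookup σ r ≡ rangeOf n → lookup σ p ≡ encodeEnv Γ ρ →
          σ ⊢ compile r p e ⇓ encode τ (eval e ρ) within (cost e at n)
    run (var i) ρ r≡ p≡ = run-var _ i ρ (w-var p≡)
    run zer ρ r≡ p≡ = w-nil
    run tru ρ r≡ p≡ = w-cons w-nil w-nil
    run fls ρ r≡ p≡ = w-nil
    run (ite c a b) ρ r≡ p≡ with eval c ρ | run c ρ r≡ p≡
    ... | true  | c⇓ = within-≤ (s≤s (ℕₚ.+-monoʳ-≤ (cost c at n) (ℕₚ.m≤m+n (cost a at n) (cost b at n))))
                         (w-case-cons c⇓ (run a ρ r≡ p≡))
    ... | false | c⇓ = within-≤ (s≤s (ℕₚ.+-monoʳ-≤ (cost c at n) (ℕₚ.m≤n+m (cost b at n) (cost a at n))))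
                         (w-case-nil c⇓ (run b ρ r≡ p≡))
    run (less i j) {σ = σ} ρ r≡ p≡ = w-app w-fun (w-cons (run i ρ r≡ p≡) (run j ρ r≡ p≡)) (run-less σ (eval i ρ) (eval j ρ))
    run (pair a b) ρ r≡ p≡ = w-cons (run a ρ r≡ p≡) (run b ρ r≡ p≡)
    run (fst e) ρ r≡ p≡ = w-hd (run e ρ r≡ p≡)
    run (snd e) ρ r≡ p≡ = w-tl (run e ρ r≡ p≡)
    run (tab {τ = τ} e) {r} {p} {σ} ρ r≡ p≡ =
      subst (λ l → σ ⊢ compile r p (tab e) ⇓ encodeList (encode τ) l within (cost (tab e) at n))
        (trans (Listₚ.map-tabulate id (λ i → eval e (i , ρ))) (sym (trans (cong Vec.toList (table≡ (λ i → eval e (i , ρ)))) (toList-tabulate (λ i → eval e (i , ρ))))))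
        (subst (λ k → σ ⊢ compile r p (tab e) ⇓ encodeList (encode τ) (List.map (λ i → eval e (i , ρ)) (allFin (suc n))) within suc (2 + (k * (12 + (cost e at n)) + 3))) (Listₚ.length-tabulate {n = suc n} id)
          (w-app w-fun (w-var r≡) (run-tab encodeFin (encode τ) (λ i → eval e (i , ρ))
            (λ x → run e (x , ρ) r≡ (cong (λ z → Value.cons (encodeFin x) z) p≡)) (allFin (suc n)))))
    run (look {τ = τ} a i) {σ = σ} ρ r≡ p≡ = w-app w-fun (w-cons (run i ρ r≡ p≡) (run a ρ r≡ p≡))
      (run-nth (encode τ) σ (eval a ρ) (eval i ρ) ℕₚ.≤-refl)
    run (fold {τ = τ} e a) {r} {p} {σ} ρ r≡ p≡ =
      subst (λ l → σ ⊢ compile r p (fold e a) ⇓ encode τ (foldl (λ acc i → eval e (acc , i , ρ)) (eval a ρ) l) within (cost (fold e a) at n)) (sym (indices≡ n))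
      (subst (λ k → σ ⊢ compile r p (fold e a) ⇓ encode τ (foldl (λ acc i → eval e (acc , i , ρ)) (eval a ρ) (allFin (suc n))) within suc (1 + suc (1 + (cost a at n)) + (k * (16 + (cost e at n)) + 5))) (Listₚ.length-tabulate {n = suc n} id)
        (w-app w-fun (w-cons (w-var r≡) (run a ρ r≡ p≡)) (run-fold encodeFin (encode τ) (λ acc i → eval e (acc , i , ρ))
          (λ acc x → run e (acc , x , ρ) r≡ (cong (λ z → Value.cons (encode τ acc) (cons (encodeFin x) z)) p≡)) (allFin (suc n)) (eval a ρ))))
    run (uncons {τ = τ} e a b) ρ r≡ p≡ with eval e ρ | run e ρ r≡ p≡
    ... | []     | e⇓ = within-≤ (s≤s (ℕₚ.+-monoʳ-≤ (cost e at n) (ℕₚ.m≤m+n (cost a at n) _))) (w-case-nil e⇓ (run a ρ r≡ p≡))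
    ... | x ∷ xs | e⇓ = within-≤ (s≤s (ℕₚ.+-monoʳ-≤ (cost e at n) (ℕₚ.m≤n+m _ (cost a at n))))
      (w-case-cons e⇓ (w-let (w-cons (w-var refl) (w-cons (w-var refl) (w-var refl)))
        (run b (x , xs , ρ) r≡ (cong (λ z → Value.cons (encode τ x) (cons (encode (lst τ) xs) z)) p≡))))
    run (call e as) ρ r≡ p≡ = w-let (runArgs as ρ r≡ p≡) (run e (evalArgs as ρ) r≡ refl)
    run (under Ξ as e) ρ r≡ p≡ = w-let (runArgs++ as ρ (dropEnv Ξ ρ) r≡ p≡ (run-tls Ξ ρ (w-var p≡)))
      (run e (evalArgs++ as ρ (dropEnv Ξ ρ)) r≡ refl)

    runArgs : ∀ {m Γ Δ} (as : Args Γ Δ) {r p : Fin m} {σ : Vec Value m} (ρ : Env n Γ) →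
              lookup σ r ≡ rangeOf n → lookup σ p ≡ encodeEnv Γ ρ →
              σ ⊢ compileArgs r p as nil ⇓ encodeEnv Δ (evalArgs as ρ) within ((costArgs as at n) + 1)
    runArgs []       ρ r≡ p≡ = w-nil
    runArgs (a ∷ as) ρ r≡ p≡ = within-≤ (ℕₚ.≤-reflexive (cong suc (sym (ℕₚ.+-assoc (cost a at n) _ 1))))
      (w-cons (run a ρ r≡ p≡) (runArgs as ρ r≡ p≡))

    runArgs++ : ∀ {m Γ Δ Γ₀ t S} (as : Args Γ Δ) {r p : Fin m} {σ : Vec Value m} (ρ : Env n Γ) (ρ₀ : Env n Γ₀) →
              lookup σ r ≡ rangeOf n → lookup σ p ≡ encodeEnv Γ ρ → σ ⊢ t ⇓ encodeEnv Γ₀ ρ₀ within S →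
              σ ⊢ compileArgs r p as t ⇓ encodeEnv (Δ ++ Γ₀) (evalArgs++ as ρ ρ₀) within ((costArgs as at n) + S)
    runArgs++ []       ρ ρ₀ r≡ p≡ t⇓ = t⇓
    runArgs++ {S = S} (a ∷ as) ρ ρ₀ r≡ p≡ t⇓ = within-≤ (ℕₚ.≤-reflexive (cong suc (sym (ℕₚ.+-assoc (cost a at n) _ S))))
      (w-cons (run a ρ r≡ p≡) (runArgs++ as ρ ρ₀ r≡ p≡ t⇓))

-- The programs

module _ {Γ : Ctx} where
  notE : Exp Γ bool → Exp Γ bool
  notE a = ite a fls tru

  andE orE : Exp Γ bool → Exp Γ bool → Exp Γ bool
  andE a b = ite a b fls
  orE a b = ite a tru b

  eqE : Exp Γ ix → Exp Γ ix → Exp Γ bool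
  eqE i j = andE (notE (less i j)) (notE (less j i))

  anyE allE : Exp (ix ∷ Γ) bool → Exp Γ bool
  anyE e = fold (ite (var v0) tru (under (bool ∷ []) [] e)) fls
  allE e = notE (anyE (ite e fls tru))

  -- The last index satisfying e, and d if there is none.
  findE : Exp Γ ix → Exp (ix ∷ Γ) bool → Exp Γ ix
  findE d e = fold (ite (under (ix ∷ []) [] e) (var v1) (var v0)) d

-- There is one component more than the number says: `tup 3` is the type of the keys (c , j , y ,
-- x), and `tup 4` that of the slots (s , key). The same shift applies to `tabs`.
tup : ℕ → Ty
tup zero    = ix
tup (suc k) = ix ⊗ tup k

tabs : ℕ → Ty → Ty
tabs zero    τ = arr τ
tabs (suc k) τ = arr (tabs k τ)

foldTupE : ∀ k {Γ τ} → Exp (τ ∷ tup k ∷ Γ) τ → Exp Γ τ → Exp Γ τ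
foldTupE zero            e a = fold e a
foldTupE (suc k) {τ = τ} e a =
  fold (foldTupE k (under (τ ∷ tup k ∷ τ ∷ ix ∷ []) (var v0 ∷ pair (var v3) (var v1) ∷ []) e) (var v0)) a

lookTE : ∀ k {Γ τ} → Exp Γ (tabs k τ) → Exp Γ (tup k) → Exp Γ τ
lookTE zero    a t = look a t
lookTE (suc k) a t = lookTE k (look a (fst t)) (snd t)

updTE : ∀ k {τ} → Exp (tabs k τ ∷ tup k ∷ τ ∷ []) (tabs k τ)
updTE zero    = tab (ite (eqE (var v0) (var v2)) (var v3) (look (var v1) (var v0)))
updTE (suc k) = tab (ite (eqE (var v0) (fst (var v2)))
  (call (updTE k) (look (var v1) (var v0) ∷ snd (var v2) ∷ var v3 ∷ [])) (look (var v1) (var v0)))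

constTE : ∀ k {τ} → Exp [] τ → Exp [] (tabs k τ)
constTE zero    e = tab (call e [])
constTE (suc k) e = tab (call (constTE k e) [])

-- A group is given by its multiplication table and the chain C 0, …, C n of its series.
GRP PERM TAB STATE : Ty
GRP   = arr (arr ix) ⊗ arr (arr bool)
PERM  = arr ix
TAB   = tabs 4 PERM
STATE = TAB ⊗ PERM ⊗ bool

module _ {Γ : Ctx} where
  mulE : Exp Γ GRP → Exp Γ ix → Exp Γ ix → Exp Γ ix
  mulE g x y = look (look (fst g) x) y

  inE : Exp Γ GRP → Exp Γ ix → Exp Γ ix → Exp Γ bool
  inE g i x = look (look (snd g) i) x

  isZeroE : Exp Γ ix → Exp Γ bool
  isZeroE c = notE (less zer c)

opaque
  ldivE : Exp (GRP ∷ ix ∷ ix ∷ []) ix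
  ldivE = findE (var v1) (eqE (mulE (var v1) (var v2) (var v0)) (var v3))

opaque
  lowE : Exp (GRP ∷ ix ∷ ix ∷ []) bool
  lowE = orE (inE (var v0) zer (var v2)) (anyE (andE (inE (var v1) (var v0) (var v3)) (notE (inE (var v1) (var v0) (var v2)))))

opaque
  -- Any rule that picks the same element from the whole coset would do; here it is the one of
  -- largest index.
  leadE : Exp (GRP ∷ ix ∷ []) ix
  leadE = findE (var v1) (call lowE (var v1 ∷ var v2 ∷ call ldivE (var v1 ∷ var v0 ∷ var v2 ∷ []) ∷ []))

opaque
  -- The first disjunct gives the bottom term the trivial group as predecessor.
  prevE : Exp (GRP ∷ ix ∷ ix ∷ []) bool
  prevE = orE (inE (var v0) zer (var v2)) (anyE (andE (less (var v0) (var v2)) (inE (var v1) (var v0) (var v3))))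

opaque
  newE : Exp (GRP ∷ ix ∷ ix ∷ []) bool
  newE = andE (inE (var v0) (var v1) (var v2)) (notE (call prevE (var v0 ∷ var v1 ∷ var v2 ∷ [])))

idE : Exp [] PERM
idE = tab (var v0)

compE : Exp (PERM ∷ PERM ∷ []) PERM
compE = tab (look (var v1) (look (var v2) (var v0)))

invE : Exp (PERM ∷ []) PERM
invE = tab (findE (var v0) (eqE (look (var v2) (var v0)) (var v1)))

-- Extends f : G → K from the previous term of the chain to the i-th one by
-- sending each leader t to θ t.
opaque
  extE : Exp (GRP ∷ GRP ∷ PERM ∷ ix ∷ PERM ∷ []) PERM
  extE = tab (ite (call newE (var v1 ∷ var v4 ∷ var v0 ∷ []))
    (call (mulE (var v0) (look (var v1) (var v4)) (look (var v2) (call ldivE (var v3 ∷ var v4 ∷ var v5 ∷ []))))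
      (var v2 ∷ var v3 ∷ var v5 ∷ var v1 ∷ call leadE (var v1 ∷ var v0 ∷ []) ∷ var v0 ∷ []))
    (look (var v5) (var v0)))

opaque
  -- For a leader z that is new at this term and v in `L z`, this moves z u to z v u for all u in
  -- `L z` and fixes everything else. Other pairs (z , v) yield the identity.
  transE : Exp (GRP ∷ ix ∷ ix ∷ ix ∷ []) PERM
  transE = tab (ite (andE (call newE (var v1 ∷ var v4 ∷ var v0 ∷ []))
                      (andE (call lowE (var v1 ∷ var v2 ∷ var v3 ∷ [])) (eqE (call leadE (var v1 ∷ var v0 ∷ [])) (var v2))))
    (mulE (var v1) (mulE (var v1) (var v2) (var v3)) (call ldivE (var v1 ∷ var v2 ∷ var v0 ∷ [])))
    (var v0))

-- The test (c , j , y , x): for c = 0 that f is multiplicative at (x , y),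
-- for c ≠ 0 that f fixes x.
opaque
  testE : Exp (GRP ∷ GRP ∷ ix ∷ tup 3 ∷ PERM ∷ []) bool
  testE = call (ite (isZeroE (var v3))
      (ite (andE (inE (var v0) (var v4) (var v6)) (andE (inE (var v0) (var v2) (var v6)) (inE (var v0) (var v2) (var v5))))
        (eqE (look (var v7) (mulE (var v0) (var v6) (var v5))) (mulE (var v1) (look (var v7) (var v6)) (look (var v7) (var v5))))
        tru)
      (eqE (look (var v7) (var v6)) (var v6)))
    (var v0 ∷ var v1 ∷ var v2 ∷ fst (var v3) ∷ fst (snd (var v3)) ∷ fst (snd (snd (var v3))) ∷ snd (snd (snd (var v3))) ∷ var v4 ∷ [])

opaque
  -- A label for cosets: if f and h satisfy all earlier tests and have the same label, then f h⁻¹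
  -- satisfies the test of this key as well.
  slotE : Exp (GRP ∷ tup 3 ∷ PERM ∷ []) ix
  slotE = call (ite (isZeroE (var v1))
      (look (call invE (var v4 ∷ [])) (mulE (var v0) (look (var v4) (var v3)) (look (var v4) (var v2))))
      (look (call invE (var v4 ∷ [])) (var v3)))
    (var v0 ∷ fst (var v1) ∷ fst (snd (snd (var v1))) ∷ snd (snd (snd (var v1))) ∷ var v2 ∷ [])

quotE : Exp (TAB ∷ ix ∷ tup 3 ∷ PERM ∷ []) PERM
quotE = call compE (var v3 ∷ call invE (lookTE 4 (var v0) (pair (var v1) (var v2)) ∷ []) ∷ [])

opaque
  -- All slots are tried, because the label of `slotE` is meaningless for a map into another group:
  -- its products are taken in the first group. That label serves only as the default when no slot
  -- passes.
  reduceE : Exp (TAB ∷ GRP ∷ GRP ∷ ix ∷ tup 3 ∷ PERM ∷ []) PERM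
  reduceE = call quotE (var v0 ∷ findE (call slotE (var v1 ∷ var v4 ∷ var v5 ∷ []))
      (call testE (var v2 ∷ var v3 ∷ var v4 ∷ var v5 ∷ call quotE (var v1 ∷ var v0 ∷ var v5 ∷ var v6 ∷ []) ∷ []))
    ∷ var v4 ∷ var v5 ∷ [])

opaque
  stepE : Exp (STATE ∷ tup 3 ∷ GRP ∷ GRP ∷ ix ∷ []) STATE
  stepE = ite (snd (snd (var v0))) (var v0)
    (call (ite (call testE (var v3 ∷ var v4 ∷ var v5 ∷ var v2 ∷ var v0 ∷ []))
            (pair (fst (var v1)) (pair (var v0) fls))
            (pair (call (updTE 4) (fst (var v1) ∷ pair (call slotE (var v3 ∷ var v2 ∷ fst (snd (var v1)) ∷ [])) (var v2) ∷ fst (snd (var v1)) ∷ []))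
              (pair (fst (snd (var v1))) tru)))
      (call reduceE (fst (var v0) ∷ var v2 ∷ var v3 ∷ var v4 ∷ var v1 ∷ fst (snd (var v0)) ∷ [])
        ∷ var v0 ∷ var v1 ∷ var v2 ∷ var v3 ∷ var v4 ∷ []))

opaque
  siftE : Exp (TAB ∷ PERM ∷ GRP ∷ ix ∷ []) STATE
  siftE = foldTupE 3 (call stepE (var v0 ∷ var v1 ∷ var v4 ∷ var v4 ∷ var v5 ∷ [])) (pair (var v0) (pair (var v1) fls))

opaque
  -- Only keys with c = 0 are visited: the map into H is to become multiplicative, not trivial.
  siftHE : Exp (TAB ∷ PERM ∷ GRP ∷ GRP ∷ ix ∷ []) STATE
  siftHE = foldTupE 2 (call stepE (var v0 ∷ pair zer (var v1) ∷ var v4 ∷ var v5 ∷ var v6 ∷ [])) (pair (var v0) (pair (var v1) fls))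

opaque
  insertE : Exp (TAB ∷ PERM ∷ GRP ∷ ix ∷ []) TAB
  insertE = fst (call siftE (var v0 ∷ var v1 ∷ var v2 ∷ var v3 ∷ []))

-- Inserts the product of the slots p and q, the extension of the old slot p
-- and a translation given by the first coordinates of p and q.
opaque
  itemsE : Exp (TAB ∷ tup 4 ∷ tup 4 ∷ TAB ∷ GRP ∷ ix ∷ []) TAB
  itemsE = call insertE (
      call insertE (
        call insertE (var v0 ∷ call compE (lookTE 4 (var v0) (var v1) ∷ lookTE 4 (var v0) (var v2) ∷ []) ∷ var v4 ∷ var v5 ∷ [])
        ∷ call extE (var v4 ∷ var v4 ∷ call idE [] ∷ var v5 ∷ ite (isZeroE (fst (snd (var v1)))) (call idE []) (lookTE 4 (var v3) (var v1)) ∷ [])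
        ∷ var v4 ∷ var v5 ∷ [])
      ∷ call transE (var v4 ∷ fst (var v1) ∷ fst (var v2) ∷ var v5 ∷ [])
      ∷ var v4 ∷ var v5 ∷ [])

opaque
  roundE : Exp (TAB ∷ TAB ∷ GRP ∷ ix ∷ []) TAB
  roundE = foldTupE 4 (foldTupE 4 (call itemsE (var v0 ∷ var v3 ∷ var v1 ∷ var v5 ∷ var v6 ∷ var v7 ∷ [])) (var v0)) (var v0)

opaque
  -- The loop variable merely counts. There are as many rounds as slots, and every round before the
  -- table is stable fills one.
  closeE : Exp (TAB ∷ GRP ∷ ix ∷ []) TAB
  closeE = foldTupE 4 (call roundE (var v0 ∷ var v2 ∷ var v3 ∷ var v4 ∷ [])) (call (constTE 4 idE) [])

opaque
  stageE : Exp (TAB ⊗ PERM ∷ ix ∷ GRP ∷ GRP ∷ PERM ∷ []) (TAB ⊗ PERM)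
  stageE = call (pair (var v0) (fst (snd (call siftHE (var v0 ∷ call extE (var v3 ∷ var v4 ∷ var v5 ∷ var v2 ∷ snd (var v1) ∷ []) ∷ var v3 ∷ var v4 ∷ var v2 ∷ [])))))
    (call closeE (fst (var v0) ∷ var v2 ∷ var v1 ∷ []) ∷ var v0 ∷ var v1 ∷ var v2 ∷ var v3 ∷ var v4 ∷ [])

opaque
  runE : Exp (GRP ∷ GRP ∷ PERM ∷ []) (TAB ⊗ PERM)
  runE = fold (call stageE (var v0 ∷ var v1 ∷ var v2 ∷ var v3 ∷ var v4 ∷ []))
    -- The multiplication table does not name the identity, so it is computed as x⁻¹ x. The first
    -- map is constant, which is right on the trivial subgroup.
    (pair (call (constTE 4 idE) []) (tab (call ldivE (var v2 ∷ var v0 ∷ var v0 ∷ []))))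

opaque
  -- All properties of an isomorphism of chains are checked by brute force, whatever the origin of
  -- the map.
  verifyE : Exp (GRP ∷ GRP ∷ PERM ∷ []) bool
  verifyE = andE (allE (allE (eqE (look (var v4) (mulE (var v2) (var v1) (var v0))) (mulE (var v3) (look (var v4) (var v1)) (look (var v4) (var v0))))))
    (andE (allE (allE (orE (notE (eqE (look (var v4) (var v1)) (look (var v4) (var v0)))) (eqE (var v1) (var v0)))))
    (andE (allE (anyE (eqE (look (var v4) (var v0)) (var v1))))
      (allE (allE (ite (inE (var v2) (var v1) (var v0)) (inE (var v3) (var v1) (look (var v4) (var v0)))
                       (notE (inE (var v3) (var v1) (look (var v4) (var v0)))))))))

-- A guess records for which leaders t the value θ t has been chosen.
GUESS : Ty
GUESS = arr (bool ⊗ ix)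

opaque
  checkE : Exp (GRP ∷ GRP ∷ GUESS ∷ []) bool
  checkE = call verifyE (var v0 ∷ var v1 ∷
    snd (call runE (var v0 ∷ var v1 ∷ tab (snd (look (var v3) (var v0))) ∷ [])) ∷ [])

opaque
  openE : Exp (GRP ∷ GUESS ∷ ix ∷ []) bool
  openE = andE (eqE (call leadE (var v0 ∷ var v2 ∷ [])) (var v2)) (notE (fst (look (var v1) (var v2))))

opaque
  completeE : Exp (GRP ∷ GUESS ∷ []) bool
  completeE = notE (anyE (call openE (var v1 ∷ var v2 ∷ var v0 ∷ [])))

opaque
  sameLevelE : Exp (GRP ∷ ix ∷ ix ∷ []) bool
  sameLevelE = allE (ite (inE (var v1) (var v0) (var v2)) (inE (var v1) (var v0) (var v3)) (notE (inE (var v1) (var v0) (var v3))))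

opaque
  -- As long as a level has open leaders, the result depends on `t` only through its level, so each
  -- pass treats exactly one leader per such level.
  chosenE : Exp (GRP ∷ GUESS ∷ ix ∷ []) ix
  chosenE = findE (var v2) (andE (call sameLevelE (var v1 ∷ var v0 ∷ var v3 ∷ [])) (call openE (var v1 ∷ var v2 ∷ var v0 ∷ [])))

opaque
  withinE : Exp (GRP ∷ GRP ∷ ix ∷ ix ∷ []) bool
  withinE = allE (orE (notE (inE (var v1) (var v0) (var v3))) (inE (var v2) (var v0) (var v4)))

-- Strips leaders off w until it lies in every term that corresponds to a
-- term containing t.
opaque
  digitE : Exp (GRP ∷ GRP ∷ ix ∷ ix ∷ []) ix
  digitE = call leadE (var v1 ∷ fold (ite (call withinE (var v2 ∷ var v3 ∷ var v4 ∷ var v0 ∷ [])) (var v0)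
    (call ldivE (var v3 ∷ call leadE (var v3 ∷ var v0 ∷ []) ∷ var v0 ∷ []))) (var v3) ∷ [])

opaque
  passE : Exp (GRP ∷ GRP ∷ GUESS ∷ ix ∷ []) GUESS
  passE = tab (ite (andE (call openE (var v1 ∷ var v3 ∷ var v0 ∷ []))
                     (eqE (call chosenE (var v1 ∷ var v3 ∷ var v0 ∷ [])) (var v0)))
    (pair tru (call digitE (var v1 ∷ var v2 ∷ var v0 ∷ var v4 ∷ [])))
    (look (var v3) (var v0)))

SERIES : Ty
SERIES = arr (arr ix) ⊗ lst (arr bool)

opaque
  -- A strictly increasing chain has at most as many terms as the group has elements. Padding it
  -- with the whole group lets the elements index the chain too.
  padE : Exp (lst (arr bool) ∷ []) (arr (arr bool))
  padE = tab (uncons (fold (ite (less (var v1) (var v2)) (uncons (var v0) (var v0) (var v1)) (var v0)) (var v1))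
    (tab tru) (var v0))

grpE : Exp (SERIES ∷ []) GRP
grpE = pair (fst (var v0)) (call padE (snd (var v0) ∷ []))

emptyE : Exp (GRP ∷ []) GUESS
emptyE = tab (pair fls (call ldivE (var v1 ∷ var v0 ∷ var v0 ∷ [])))

-- Booleans and searches over all indices

if-true : ∀ {b} {A : Set} {x y : A} → b ≡ true → (if b then x else y) ≡ x
if-true refl = refl

if-false : ∀ {b} {A : Set} {x y : A} → ¬ b ≡ true → (if b then x else y) ≡ y
if-false {false} _ = refl
if-false {true}  f = ⊥-elim (f refl)

and-elim : ∀ {a b} → (if a then b else false) ≡ true → a ≡ true × b ≡ true
and-elim {true} b≡ = refl , b≡

and-intro : ∀ {a b} → a ≡ true → b ≡ true → (if a then b else false) ≡ true
and-intro refl b≡ = b≡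

or-elim : ∀ {a b} → (if a then true else b) ≡ true → a ≡ true ⊎ b ≡ true
or-elim {true}  _  = inj₁ refl
or-elim {false} b≡ = inj₂ b≡

or-introˡ : ∀ {a b} → a ≡ true → (if a then true else b) ≡ true
or-introˡ refl = refl

or-introʳ : ∀ {a b} → b ≡ true → (if a then true else b) ≡ true
or-introʳ {true}  _  = refl
or-introʳ {false} b≡ = b≡

not-elim : ∀ {a} → (if a then false else true) ≡ true → ¬ a ≡ true
not-elim {false} _ ()

not-intro : ∀ {a} → ¬ a ≡ true → (if a then false else true) ≡ true
not-intro {false} _ = refl
not-intro {true}  f = ⊥-elim (f refl)

¬true⇒false : ∀ {b} → ¬ b ≡ true → b ≡ false
¬true⇒false {false} _ = refl
¬true⇒false {true}  f = ⊥-elim (f refl)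

true-or-not : ∀ b → b ≡ true ⊎ ¬ b ≡ true
true-or-not true  = inj₁ refl
true-or-not false = inj₂ λ ()

true⇔⇒≡ : ∀ {a b} → (a ≡ true → b ≡ true) → (b ≡ true → a ≡ true) → a ≡ b
true⇔⇒≡ {true}          f g = sym (f refl)
true⇔⇒≡ {false} {true}  f g = g refl
true⇔⇒≡ {false} {false} f g = refl

<ᵇ⇒< : ∀ {m n} (i : Fin m) (j : Fin n) → (i <ᵇ j) ≡ true → toℕ i < toℕ j
<ᵇ⇒< zero    (suc j) _  = z<s
<ᵇ⇒< (suc i) (suc j) lt = s≤s (<ᵇ⇒< i j lt)

<⇒<ᵇ : ∀ {m n} (i : Fin m) (j : Fin n) → toℕ i < toℕ j → (i <ᵇ j) ≡ true
<⇒<ᵇ zero    (suc j) _        = refl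
<⇒<ᵇ (suc i) (suc j) (s≤s lt) = <⇒<ᵇ i j lt

-- Shaped exactly as `eqE` evaluates, so that no evaluation lemma is required; likewise `anyB`,
-- `allB` and `findB` for their programs.
eqB : ∀ {n} (i j : Fin n) → Bool
eqB i j = if (if i <ᵇ j then false else true) then (if j <ᵇ i then false else true) else false

eqB-refl : ∀ {n} (i : Fin n) → eqB i i ≡ true
eqB-refl i = and-intro (not-intro (irrefl i)) (not-intro (irrefl i))
  where
  irrefl : ∀ {n} (i : Fin n) → ¬ (i <ᵇ i) ≡ true
  irrefl i lt = ℕₚ.<-irrefl refl (<ᵇ⇒< i i lt)

eqB-sound : ∀ {n} {i j : Fin n} → eqB i j ≡ true → i ≡ j
eqB-sound {i = i} {j} eq with and-elim eq
... | i≮j , j≮i = Finₚ.toℕ-injective (ℕₚ.≤-antisym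
  (ℕₚ.≮⇒≥ (not-elim j≮i ∘ <⇒<ᵇ j i)) (ℕₚ.≮⇒≥ (not-elim i≮j ∘ <⇒<ᵇ i j)))

eqB-complete : ∀ {n} {i j : Fin n} → i ≡ j → eqB i j ≡ true
eqB-complete {i = i} refl = eqB-refl i

module _ {n : ℕ} where
  ∈-indices : ∀ x → x ∈ₗ indices n
  ∈-indices x = subst (x ∈ₗ_) (sym (indices≡ n)) (∈ₚ.∈-allFin x)

  lookup-table : ∀ {A : Set} (f : Fin (suc n) → A) i → lookup (table f) i ≡ f i
  lookup-table f i = trans (cong (λ v → lookup v i) (table≡ f)) (Vecₚ.lookup∘tabulate f i)

  anyB allB : (Fin (suc n) → Bool) → Bool
  anyB f = foldl (λ b x → if b then true else f x) false (indices n)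
  allB f = if anyB (λ x → if f x then false else true) then false else true

  findB : Fin (suc n) → (Fin (suc n) → Bool) → Fin (suc n)
  findB d f = foldl (λ a x → if f x then x else a) d (indices n)

  anyB-intro : ∀ {f : Fin (suc n) → Bool} (x : Fin (suc n)) → f x ≡ true → anyB f ≡ true
  anyB-intro {f} x fx = go (indices n) false (inj₂ (x , ∈-indices x , fx))
    where
    go : ∀ xs b → b ≡ true ⊎ (∃ λ x → x ∈ₗ xs × f x ≡ true) → foldl (λ b x → if b then true else f x) b xs ≡ true
    go []       b     (inj₁ b≡) = b≡
    go (y ∷ xs) b     (inj₁ refl) = go xs true (inj₁ refl)
    go (y ∷ xs) b     (inj₂ (x , here refl , fx)) = go xs _ (inj₁ (or-introʳ {b} fx))
    go (y ∷ xs) b     (inj₂ (x , there x∈ , fx)) = go xs _ (inj₂ (x , x∈ , fx))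

  anyB-elim : ∀ {f : Fin (suc n) → Bool} → anyB f ≡ true → ∃ λ x → f x ≡ true
  anyB-elim {f} any with go (indices n) false any
    where
    go : ∀ xs b → foldl (λ b x → if b then true else f x) b xs ≡ true → b ≡ true ⊎ ∃ λ x → f x ≡ true
    go []       b b≡ = inj₁ b≡
    go (x ∷ xs) b eq with go xs _ eq
    ... | inj₂ w = inj₂ w
    ... | inj₁ b′ with or-elim {b} b′
    ...   | inj₁ b≡ = inj₁ b≡
    ...   | inj₂ fx = inj₂ (x , fx)
  ... | inj₂ w = w

  allB-intro : ∀ {f : Fin (suc n) → Bool} → (∀ x → f x ≡ true) → allB f ≡ true
  allB-intro all = not-intro λ any → let x , fx = anyB-elim any in not-elim fx (all x)

  allB-elim : ∀ {f : Fin (suc n) → Bool} → allB f ≡ true → ∀ x → f x ≡ true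
  allB-elim {f} all x with true-or-not (f x)
  ... | inj₁ fx = fx
  ... | inj₂ ¬fx = ⊥-elim (not-elim all (anyB-intro x (not-intro ¬fx)))

  findB-sat : ∀ {f : Fin (suc n) → Bool} d x → f x ≡ true → f (findB d f) ≡ true
  findB-sat {f} d x fx = go (indices n) d (inj₂ (x , ∈-indices x , fx))
    where
    go : ∀ (xs : List (Fin (suc n))) a → f a ≡ true ⊎ (∃ λ x → x ∈ₗ xs × f x ≡ true) → f (foldl (λ a x → if f x then x else a) a xs) ≡ true
    go []       a (inj₁ fa) = fa
    go (y ∷ xs) a s with true-or-not (f y)
    go (y ∷ xs) a s                        | inj₁ fy rewrite fy = go xs y (inj₁ fy)
    go (y ∷ xs) a (inj₁ fa)                | inj₂ ¬fy rewrite ¬true⇒false ¬fy = go xs a (inj₁ fa)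
    go (y ∷ xs) a (inj₂ (x , here refl , fx)) | inj₂ ¬fy = ⊥-elim (¬fy fx)
    go (y ∷ xs) a (inj₂ (x , there x∈ , fx)) | inj₂ ¬fy rewrite ¬true⇒false ¬fy = go xs a (inj₂ (x , x∈ , fx))

  -- From the first witness on, the default value has been forgotten.
  findB-cong : ∀ {f g : Fin (suc n) → Bool} d d′ x → (∀ y → f y ≡ g y) → f x ≡ true → findB d f ≡ findB d′ g
  findB-cong {f} {g} d d′ x f≗g fx = go (indices n) d d′ (inj₂ (∈-indices x))
    where
    go : ∀ (xs : List (Fin (suc n))) a b → a ≡ b ⊎ x ∈ₗ xs →
         foldl (λ a x → if f x then x else a) a xs ≡ foldl (λ a x → if g x then x else a) b xs
    go []       a b (inj₁ eq) = eq
    go (y ∷ xs) a b s with true-or-not (f y)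
    go (y ∷ xs) a b s                 | inj₁ fy rewrite sym (f≗g y) | fy = go xs y y (inj₁ refl)
    go (y ∷ xs) a b (inj₁ refl)       | inj₂ ¬fy rewrite sym (f≗g y) | ¬true⇒false ¬fy = go xs a a (inj₁ refl)
    go (y ∷ xs) a b (inj₂ (there x∈)) | inj₂ ¬fy rewrite sym (f≗g y) | ¬true⇒false ¬fy = go xs a b (inj₂ x∈)
    go (y ∷ xs) a b (inj₂ (here refl)) | inj₂ ¬fy = ⊥-elim (¬fy fx)

lookup-ext : ∀ {A : Set} {n} {u v : Vec A n} → (∀ i → lookup u i ≡ lookup v i) → u ≡ v
lookup-ext {u = u} {v} eq = trans (sym (Vecₚ.tabulate∘lookup u)) (trans (Vecₚ.tabulate-cong eq) (Vecₚ.tabulate∘lookup v))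

-- Tuples of indices in lexicographic order, and tables indexed by them

module _ {n : ℕ} where
  tuples : ∀ k → List (El n (tup k))
  tuples zero    = indices n
  tuples (suc k) = List.concatMap (λ x → List.map (x ,_) (tuples k)) (indices n)

  foldl-concatMap : ∀ {A B C : Set} (f : A → C → A) (g : B → List C) a xs →
                    foldl f a (List.concatMap g xs) ≡ foldl (λ a x → foldl f a (g x)) a xs
  foldl-concatMap f g a []       = refl
  foldl-concatMap f g a (x ∷ xs) = trans (Listₚ.foldl-++ f a (g x) (List.concatMap g xs)) (foldl-concatMap f g _ xs)

  eval-foldTup : ∀ k {Γ τ} (e : Exp (τ ∷ tup k ∷ Γ) τ) a (ρ : Env n Γ) →
                 eval (foldTupE k e a) ρ ≡ foldl (λ acc t → eval e (acc , t , ρ)) (eval a ρ) (tuples k)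
  eval-foldTup zero    e a ρ = refl
  eval-foldTup (suc k) {τ = τ} e a ρ =
    trans (Listₚ.foldl-cong (λ acc x → trans (eval-foldTup k _ (var v0) (acc , x , ρ))
                                         (sym (Listₚ.foldl-map f (x ,_) acc (tuples k)))) (eval a ρ) (indices n))
          (sym (foldl-concatMap f (λ x → List.map (x ,_) (tuples k)) (eval a ρ) (indices n)))
    where
    f : El n τ → El n (tup (suc k)) → El n τ
    f acc t = eval e (acc , t , ρ)

  ∈-tuples : ∀ k t → t ∈ₗ tuples k
  ∈-tuples zero    t       = ∈-indices t
  ∈-tuples (suc k) (x , t) = ∈ₚ.∈-concatMap⁺ _ (Any.map (λ { refl → ∈ₚ.∈-map⁺ (x ,_) (∈-tuples k t) }) (∈-indices x))

  _≺_ : ∀ {k} → El n (tup k) → El n (tup k) → Set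
  _≺_ {zero}  x       y       = toℕ x < toℕ y
  _≺_ {suc k} (x , s) (y , t) = toℕ x < toℕ y ⊎ (x ≡ y × s ≺ t)

  ≺-irrefl : ∀ k {t} → ¬ _≺_ {k} t t
  ≺-irrefl zero    lt               = ℕₚ.<-irrefl refl lt
  ≺-irrefl (suc k) (inj₁ lt)        = ℕₚ.<-irrefl refl lt
  ≺-irrefl (suc k) (inj₂ (_ , t≺t)) = ≺-irrefl k t≺t

  ≺-trans : ∀ k {s t u} → _≺_ {k} s t → t ≺ u → s ≺ u
  ≺-trans zero    = ℕₚ.<-trans
  ≺-trans (suc k) (inj₁ p)          (inj₁ q)          = inj₁ (ℕₚ.<-trans p q)
  ≺-trans (suc k) (inj₁ p)          (inj₂ (refl , _)) = inj₁ p
  ≺-trans (suc k) (inj₂ (refl , _)) (inj₁ q)          = inj₁ q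
  ≺-trans (suc k) (inj₂ (refl , p)) (inj₂ (refl , q)) = inj₂ (refl , ≺-trans k p q)

  indices-sorted : AllPairs (λ x y → toℕ x < toℕ y) (indices n)
  indices-sorted = subst (AllPairs _) (sym (indices≡ n)) (AllPairsₚ.tabulate⁺-< id)

  tuples-sorted : ∀ k → AllPairs _≺_ (tuples k)
  tuples-sorted zero    = indices-sorted
  tuples-sorted (suc k) = AllPairsₚ.concat⁺
    (Allₚ.map⁺ (All.universal (λ x → AllPairsₚ.map⁺ (AllPairs.map (λ s≺t → inj₂ (refl , s≺t)) (tuples-sorted k))) (indices n)))
    (AllPairsₚ.map⁺ (AllPairs.map (λ x<y → Allₚ.map⁺ (All.universal (λ _ → Allₚ.map⁺ (All.universal (λ _ → inj₁ x<y) (tuples k))) (tuples k)))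
      indices-sorted))

  _≟ₜ_ : ∀ {k} (s t : El n (tup k)) → Dec (s ≡ t)
  _≟ₜ_ {zero}  = Finₚ._≟_
  _≟ₜ_ {suc k} = ≡-dec Finₚ._≟_ (_≟ₜ_ {k})

  lookupT : ∀ k {τ} → El n (tabs k τ) → El n (tup k) → El n τ
  lookupT zero    a t       = lookup a t
  lookupT (suc k) a (x , t) = lookupT k (lookup a x) t

  eval-lookT : ∀ k {Γ τ} (a : Exp Γ (tabs k τ)) t (ρ : Env n Γ) →
               eval (lookTE k a t) ρ ≡ lookupT k (eval a ρ) (eval t ρ)
  eval-lookT zero    a t ρ = refl
  eval-lookT (suc k) a t ρ = eval-lookT k (look a (fst t)) (snd t) ρ

  table-cong : ∀ {A : Set} {f h : Fin (suc n) → A} → (∀ i → f i ≡ h i) → table f ≡ table h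
  table-cong {f = f} {h} f≗h = trans (table≡ f) (trans (Vecₚ.tabulate-cong f≗h) (sym (table≡ h)))

  eval-tab : ∀ {Γ τ} (e : Exp (ix ∷ Γ) τ) (ρ : Env n Γ) i → lookup (eval (tab e) ρ) i ≡ eval e (i , ρ)
  eval-tab e ρ = lookup-table λ i → eval e (i , ρ)

  updT : ∀ k {τ} → El n (tabs k τ) → El n (tup k) → El n τ → El n (tabs k τ)
  updT zero    a t       v = table λ y → if eqB y t then v else lookup a y
  updT (suc k) a (x , t) v = table λ y → if eqB y x then updT k (lookup a y) t v else lookup a y

  eval-updT : ∀ k {τ} (a : El n (tabs k τ)) t v → eval (updTE k) (a , t , v , tt) ≡ updT k {τ} a t v
  eval-updT zero    a t       v = refl
  eval-updT (suc k) {τ} a (x , t) v = table-cong λ y →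
    cong (λ u → if eqB y x then u else lookup a y) (eval-updT k {τ} (lookup a y) t v)

  lookup-updT : ∀ k {τ} (a : El n (tabs k τ)) t v → lookupT k {τ} (updT k {τ} a t v) t ≡ v
  lookup-updT zero    a t v = trans (lookup-table (λ y → if eqB y t then v else lookup a y) t) (if-true (eqB-refl t))
  lookup-updT (suc k) {τ} a (x , t) v =
    trans (cong (λ b → lookupT k {τ} b t) (trans (lookup-table (λ y → if eqB y x then updT k {τ} (lookup a y) t v else lookup a y) x)
            (if-true (eqB-refl x))))
          (lookup-updT k {τ} (lookup a x) t v)

  lookup-updT-≢ : ∀ k {τ} (a : El n (tabs k τ)) t v u → u ≢ t → lookupT k {τ} (updT k {τ} a t v) u ≡ lookupT k {τ} a u
  lookup-updT-≢ zero    a t v u u≢t = trans (lookup-table (λ y → if eqB y t then v else lookup a y) u) (if-false (u≢t ∘ eqB-sound))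
  lookup-updT-≢ (suc k) {τ} a (x , t) v (y , u) u≢t
    rewrite lookup-table (λ y → if eqB y x then updT k {τ} (lookup a y) t v else lookup a y) y
    with true-or-not (eqB y x)
  ... | inj₂ y≢x = cong (λ b → lookupT k {τ} b u) (if-false y≢x)
  ... | inj₁ y≡x with refl ← eqB-sound {i = y} {x} y≡x =
    trans (cong (λ b → lookupT k {τ} b u) (if-true y≡x)) (lookup-updT-≢ k {τ} (lookup a x) t v u (u≢t ∘ cong (x ,_)))

  lookup-constT : ∀ k {τ} (e : Exp [] τ) t → lookupT k {τ} (eval (constTE k e) tt) t ≡ eval e tt
  lookup-constT zero    e t       = lookup-table (λ _ → eval e tt) t
  lookup-constT (suc k) {τ} e (x , t) =
    trans (cong (λ b → lookupT k {τ} b t) (lookup-table (λ _ → eval (constTE k e) tt) x)) (lookup-constT k e t)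

-- Counting the elements of a list that satisfy a test

module _ {A : Set} where
  count : (A → Bool) → List A → ℕ
  count f []       = 0
  count f (x ∷ xs) = if f x then suc (count f xs) else count f xs

  count≤length : ∀ f xs → count f xs ≤ length xs
  count≤length f []       = z≤n
  count≤length f (x ∷ xs) with f x
  ... | true  = s≤s (count≤length f xs)
  ... | false = ℕₚ.m≤n⇒m≤1+n (count≤length f xs)

  count-mono : ∀ {f g} xs → (∀ x → f x ≡ true → g x ≡ true) → count f xs ≤ count g xs
  count-mono []       f⊆g = z≤n
  count-mono {f} {g} (x ∷ xs) f⊆g with f x in fx | g x in gx
  ... | true  | true  = s≤s (count-mono xs f⊆g)
  ... | false | true  = ℕₚ.m≤n⇒m≤1+n (count-mono xs f⊆g)
  ... | false | false = count-mono xs f⊆g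
  ... | true  | false with () ← trans (sym gx) (f⊆g x fx)

  count-strict : ∀ {f g x} xs → (∀ x → f x ≡ true → g x ≡ true) → x ∈ₗ xs → f x ≡ false → g x ≡ true →
                 count f xs < count g xs
  count-strict (_ ∷ xs) f⊆g (here refl) fx gx rewrite fx | gx = s≤s (count-mono xs f⊆g)
  count-strict {f} {g} (y ∷ xs) f⊆g (there x∈) fx gx with f y in fy | g y in gy
  ... | true  | true  = s≤s (count-strict xs f⊆g x∈ fx gx)
  ... | false | true  = ℕₚ.m≤n⇒m≤1+n (count-strict xs f⊆g x∈ fx gx)
  ... | false | false = count-strict xs f⊆g x∈ fx gx
  ... | true  | false with () ← trans (sym gy) (f⊆g y fy)

-- Sims' sifting.  D ks decreases along the tests from E to the trivial group,
-- and slot (s , k) of a table holds a coset representative of the next group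
-- in the group of the maps that satisfy all tests before k.  Empty slots hold ι.
module Sifting
  {A K S Table : Set}
  (_∙_ : A → A → A) (ι : A) (inv : A → A)
  (∙-assoc : ∀ f g h → (f ∙ g) ∙ h ≡ f ∙ (g ∙ h))
  (∙-idˡ : ∀ f → ι ∙ f ≡ f) (∙-idʳ : ∀ f → f ∙ ι ≡ f)
  (_≟_ : (f g : A) → Dec (f ≡ g))
  (E : A → Set) (E-ι : E ι) (E-∙ : ∀ {f g} → E f → E g → E (f ∙ g)) (E-inv : ∀ {f} → E f → E (inv f))
  (inverseˡ : ∀ {f} → E f → inv f ∙ f ≡ ι) (inverseʳ : ∀ {f} → E f → f ∙ inv f ≡ ι)
  (P : K → A → Set) (P-ι : ∀ k → P k ι)
  (P-∙ : ∀ k {f g} → E f → E g → P k f → P k g → P k (f ∙ g)) (P-inv : ∀ k {f} → E f → P k f → P k (inv f))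
  (_≺_ : K → K → Set) (≺-irrefl : ∀ {k} → ¬ k ≺ k) (≺-trans : ∀ {k l m} → k ≺ l → l ≺ m → k ≺ m)
  (ks : List K) (ks-sorted : AllPairs _≺_ ks) (ks-full : ∀ k → k ∈ₗ ks)
  (test : K → A → Bool) (slot : K → A → S)
  (test-complete : ∀ k {f} → E f → P k f → test k f ≡ true)
  (test-sound : ∀ k {f} → E f → (∀ {l} → l ≺ k → P l f) → test k f ≡ true → P k f)
  (slot-sound : ∀ k {f g} → E f → E g → (∀ {l} → l ≺ k → P l f) → (∀ {l} → l ≺ k → P l g) →
                slot k f ≡ slot k g → P k (f ∙ inv g))
  (end : ∀ {f} → E f → (∀ k → P k f) → f ≡ ι)
  (get : Table → S × K → A) (set : Table → S × K → A → Table)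
  (get-set : ∀ T p f → get (set T p f) p ≡ f)
  (get-set-≢ : ∀ T p f q → q ≢ p → get (set T p f) q ≡ get T q)
  (_≟ₚ_ : (p q : S × K) → Dec (p ≡ q))
  (slots : List (S × K)) (slots-full : ∀ p → p ∈ₗ slots)
  (reduce : Table → K → A → A)
  (reduce-form : ∀ T k f → ∃ λ s → reduce T k f ≡ f ∙ inv (get T (s , k)))
  (reduce-complete : ∀ T k f s → test k (f ∙ inv (get T (s , k))) ≡ true → test k (reduce T k f) ≡ true)
  where

  step : Table × A × Bool → K → Table × A × Bool
  step (T , f , done) k =
    if done then (T , f , done) else
    (if test k (reduce T k f) then (T , reduce T k f , false) else (set T (slot k f , k) f , f , true))

  insert : Table → A → Table
  insert T f = proj₁ (foldl step (T , f , false) ks)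

  occupied : Table → S × K → Bool
  occupied T p = not (does (get T p ≟ ι))

  μ : Table → ℕ
  μ T = count (occupied T) slots

  -- A nonempty entry satisfies all tests before its key and fails its own, so it represents a
  -- nontrivial coset. It sits in the slot of its own label, which is what `fill` exploits.
  Good : Table → Set
  Good T = ∀ s k → E (get T (s , k)) × (∀ {l} → l ≺ k → P l (get T (s , k))) ×
           (get T (s , k) ≡ ι ⊎ test k (get T (s , k)) ≡ false × slot k (get T (s , k)) ≡ s)

  Precedes : K → List K → Set
  Precedes k r = ∀ {l} → l ∈ₗ r → k ≺ l

  D : List K → A → Set
  D r f = E f × (∀ k → Precedes k r → P k f)

  -- Expresses through the order alone that r is a final segment of `ks`, so inductions on r need
  -- not carry the initial segment.
  Final : List K → Set
  Final r = AllPairs _≺_ r × (∀ k → k ∈ₗ r ⊎ Precedes k r)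

  final-ks : Final ks
  final-ks = ks-sorted , λ k → inj₁ (ks-full k)

  final-tail : ∀ {k r} → Final (k ∷ r) → Final r
  final-tail {k} {r} ((k≺ ∷ sorted) , cov) = sorted , tail
    where
    tail : ∀ l → l ∈ₗ r ⊎ Precedes l r
    tail l with cov l
    ... | inj₁ (here refl) = inj₂ (All.lookup k≺)
    ... | inj₁ (there l∈)  = inj₁ l∈
    ... | inj₂ l≺          = inj₂ (l≺ ∘ there)

  D-step : ∀ {k r f} → Final (k ∷ r) → D (k ∷ r) f → P k f → D r f
  D-step {k} {r} {f} (_ , cov) (Ef , Pf) Pk = Ef , λ l l≺ → go l l≺ (cov l)
    where
    go : ∀ l → Precedes l r → l ∈ₗ k ∷ r ⊎ Precedes l (k ∷ r) → P l f
    go l l≺ (inj₁ (here refl)) = Pk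
    go l l≺ (inj₁ (there l∈))  = ⊥-elim (≺-irrefl (l≺ l∈))
    go l l≺ (inj₂ l≺′)         = Pf l l≺′

  D-below : ∀ {k r f} → Final (k ∷ r) → D (k ∷ r) f → ∀ {l} → l ≺ k → P l f
  D-below {k} {r} {f} (k≺ ∷ _ , cov) (_ , Pf) {l} l≺k with cov l
  ... | inj₂ l≺          = Pf l l≺
  ... | inj₁ (here refl) = ⊥-elim (≺-irrefl l≺k)
  ... | inj₁ (there l∈)  = ⊥-elim (≺-irrefl (≺-trans (All.lookup k≺ l∈) l≺k))

  D-head : ∀ {k r f} → Final (k ∷ r) → D r f → P k f
  D-head ((k≺ ∷ _) , _) (_ , Pf) = Pf _ (All.lookup k≺)

  D-weaken : ∀ {k r f} → D r f → D (k ∷ r) f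
  D-weaken (Ef , Pf) = Ef , λ l l≺ → Pf l (l≺ ∘ there)

  D-ι : ∀ {r} → D r ι
  D-ι = E-ι , λ k _ → P-ι k

  D-∙ : ∀ {r f g} → D r f → D r g → D r (f ∙ g)
  D-∙ (Ef , Pf) (Eg , Pg) = E-∙ Ef Eg , λ k k≺ → P-∙ k Ef Eg (Pf k k≺) (Pg k k≺)

  D-inv : ∀ {r f} → D r f → D r (inv f)
  D-inv (Ef , Pf) = E-inv Ef , λ k k≺ → P-inv k Ef (Pf k k≺)

  D-slot : ∀ {T k r s} → Good T → D (k ∷ r) (get T (s , k))
  D-slot good = proj₁ (good _ _) , λ l l≺ → proj₁ (proj₂ (good _ _)) (l≺ (here refl))

  D-slot-∈ : ∀ {T k r s} → Good T → k ∈ₗ r → D r (get T (s , k))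
  D-slot-∈ good k∈ = proj₁ (good _ _) , λ l l≺ → proj₁ (proj₂ (good _ _)) (l≺ k∈)

  slot≡ι : ∀ {T k s} → Good T → P k (get T (s , k)) → get T (s , k) ≡ ι
  slot≡ι {T} {k} {s} good Pτ with good s k
  ... | Eτ , _ , inj₁ τ≡ι = τ≡ι
  ... | Eτ , _ , inj₂ (fails , _) with () ← trans (sym fails) (test-complete k Eτ Pτ)

  cancel : ∀ {g} f → E g → (f ∙ inv g) ∙ g ≡ f
  cancel {g} f Eg = trans (∙-assoc f (inv g) g) (trans (cong (f ∙_) (inverseˡ Eg)) (∙-idʳ f))

  cancel′ : ∀ {g} f → E g → (f ∙ g) ∙ inv g ≡ f
  cancel′ {g} f Eg = trans (∙-assoc f g (inv g)) (trans (cong (f ∙_) (inverseʳ Eg)) (∙-idʳ f))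

  inv-ι : inv ι ≡ ι
  inv-ι = trans (sym (∙-idʳ (inv ι))) (inverseˡ E-ι)

  -- Sims' normal form: one entry for each key, that of the first key rightmost, because sifting
  -- divides on the right.
  data Π (T : Table) : List K → A → Set where
    []  : Π T [] ι
    _∷_ : ∀ {k r p} s → Π T r p → Π T (k ∷ r) (p ∙ get T (s , k))

  Π-elim : ∀ {T r f} (Q : A → Set) → Q ι → (∀ {f g} → Q f → Q g → Q (f ∙ g)) →
           (∀ {k} → k ∈ₗ r → ∀ s → Q (get T (s , k))) → Π T r f → Q f
  Π-elim Q Qι Q∙ Qslot []      = Qι
  Π-elim Q Qι Q∙ Qslot (s ∷ π) = Q∙ (Π-elim Q Qι Q∙ (Qslot ∘ there) π) (Qslot (here refl) s)

  step-done : ∀ T f r → foldl step (T , f , true) r ≡ (T , f , true)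
  step-done T f []      = refl
  step-done T f (k ∷ r) = step-done T f r

  -- A newly filled slot may spoil Q, so Q is claimed only for a table left unchanged; slots can be
  -- filled only a bounded number of times.
  Progress : (Table → Set) → Table → Table → Set
  Progress Q T T′ = Good T′ × ((T′ ≡ T × Q T) ⊎ μ T < μ T′)

  -- If the slot labelled by f held an entry, `slot-sound` would put f divided by it into `P k`, and
  -- the reduced map would have passed. So the slot is empty, and division by `ι` shows that f
  -- itself is not in `P k`.
  fill : ∀ {T k r f} → Final (k ∷ r) → Good T → D (k ∷ r) f → test k (reduce T k f) ≡ false →
         Good (set T (slot k f , k) f) × μ T < μ (set T (slot k f , k) f)
  fill {T} {k} {r} {f} fin good Df fails = good′ , count-strict slots grows (slots-full p) empty full
    where
    p = (slot k f , k)
    Ef = proj₁ Df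
    not-P : ∀ {s} → ¬ P k (f ∙ inv (get T (s , k)))
    not-P {s} Pk with () ← trans (sym fails) (reduce-complete T k f s
      (test-complete k (E-∙ Ef (E-inv (proj₁ (good s k)))) Pk))
    T[p]≡ι : get T p ≡ ι
    T[p]≡ι with good (slot k f) k
    ... | Eτ , Pτ , inj₁ τ≡ι = τ≡ι
    ... | Eτ , Pτ , inj₂ (_ , same) = ⊥-elim (not-P (slot-sound k Ef Eτ (D-below fin Df) Pτ (sym same)))
    f∙inv≡f : f ∙ inv (get T p) ≡ f
    f∙inv≡f = trans (cong (λ g → f ∙ inv g) T[p]≡ι) (trans (cong (f ∙_) inv-ι) (∙-idʳ f))
    ¬Pf : ¬ P k f
    ¬Pf Pf = not-P (subst (P k) (sym f∙inv≡f) Pf)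
    f-fails : test k f ≡ false
    f-fails with test k f in eq
    ... | false = refl
    ... | true  = ⊥-elim (¬Pf (test-sound k Ef (D-below fin Df) eq))
    good′ : Good (set T p f)
    good′ s l with (s , l) ≟ₚ p
    ... | yes refl rewrite get-set T p f = Ef , D-below fin Df , inj₂ (f-fails , refl)
    ... | no  ≢p   rewrite get-set-≢ T p f (s , l) ≢p = good s l
    empty : occupied T p ≡ false
    empty with get T p ≟ ι
    ... | yes _ = refl
    ... | no ≢ι = ⊥-elim (≢ι T[p]≡ι)
    full : occupied (set T p f) p ≡ true
    full with get (set T p f) p ≟ ι
    ... | no _   = refl
    ... | yes ≡ι = ⊥-elim (¬Pf (subst (P k) (trans (sym ≡ι) (get-set T p f)) (P-ι k)))
    grows : ∀ q → occupied T q ≡ true → occupied (set T p f) q ≡ true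
    grows q with q ≟ₚ p
    ... | yes refl = λ _ → full
    ... | no q≢p rewrite get-set-≢ T p f q q≢p = λ e → e

  -- Either some test fails and a slot is filled, or f is divided down to an element that satisfies
  -- everything, which is `ι` by `end`; the divisors then make up the normal form.
  sift : ∀ {T f} r → Final r → Good T → D r f →
         Progress (λ T → Π T r f) T (proj₁ (foldl step (T , f , false) r))
  sift {T} {f} [] fin good (Ef , Pf) = good , inj₁ (refl , subst (Π T []) (sym (end Ef λ k → Pf k λ ())) [])
  sift {T} {f} (k ∷ r) fin good Df with test k (reduce T k f) in passes
  ... | false rewrite step-done (set T (slot k f , k) f) f r =
        let good′ , grows = fill fin good Df passes in good′ , inj₂ grows
  ... | true with reduce-form T k f
  ...   | s , form with sift r (final-tail fin) good (D-step fin Df′ (test-sound k (proj₁ Df′) (D-below fin Df′) passes))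
    where
    Df′ : D (k ∷ r) (reduce T k f)
    Df′ = subst (D (k ∷ r)) (sym form) (D-∙ Df (D-inv (D-slot {T} {k} {r} {s} good)))
  ...     | good′ , inj₂ grows = good′ , inj₂ grows
  ...     | good′ , inj₁ (T′≡T , fact) = good′ , inj₁ (T′≡T ,
            subst (Π T (k ∷ r)) (trans (cong (_∙ get T (s , k)) form) (cancel f (proj₁ (good s k)))) (s ∷ fact))

  insert-progress : ∀ {T f} → Good T → E f → Progress (λ T → Π T ks f) T (insert T f)
  insert-progress good Ef = sift ks final-ks good (Ef , λ k k≺ → ⊥-elim (≺-irrefl (k≺ (ks-full k))))

  progress-then : ∀ {Q R : Table → Set} {T T′ T″} → Progress Q T T′ → (Good T′ → Progress R T′ T″) →
                  Progress (λ T → Q T × R T) T T″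
  progress-then {R = R} (good′ , inj₁ (refl , q)) next with next good′
  ... | good″ , inj₁ (≡ , r)  = good″ , inj₁ (≡ , q , r)
  ... | good″ , inj₂ grows    = good″ , inj₂ grows
  progress-then (good′ , inj₂ grows) next with next good′
  ... | good″ , inj₁ (refl , _) = good″ , inj₂ grows
  ... | good″ , inj₂ grows′     = good″ , inj₂ (ℕₚ.<-trans grows grows′)

  progress-foldl : ∀ {I : Set} {Q : I → Table → Set} (F : Table → I → Table) →
                   (∀ {T} a → Good T → Progress (Q a) T (F T a)) →
                   ∀ {T} as → Good T → Progress (λ T → ∀ {a} → a ∈ₗ as → Q a T) T (foldl F T as)
  progress-foldl F prog []       good = good , inj₁ (refl , λ ())
  progress-foldl {Q = Q} F prog {T} (a ∷ as) good with progress-then {Q = Q a} {R = λ T → ∀ {a} → a ∈ₗ as → Q a T} (prog a good) (progress-foldl {Q = Q} F prog as)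
  ... | good′ , inj₂ grows         = good′ , inj₂ grows
  ... | good′ , inj₁ (eq , q , qs) = good′ , inj₁ (eq , λ { (here refl) → q ; (there a∈) → qs a∈ })

  -- Every round that changes the table fills a slot.
  saturate : ∀ {I : Set} {Q : Table → Set} (F : Table → Table) → (∀ {T} → Good T → Progress Q T (F T)) →
             ∀ {T} (is : List I) → Good T → length is ≡ length slots →
             Good (foldl (λ T _ → F T) T is) × Q (foldl (λ T _ → F T) T is)
  saturate {I} {Q} F prog {T₀} is good₀ len = go is 0 (inj₂ z≤n) good₀ (trans (ℕₚ.+-identityʳ _) len)
    where
    go : ∀ {T} (js : List I) i → (F T ≡ T × Q T) ⊎ i ≤ μ T → Good T → length js + i ≡ length slots →
         Good (foldl (λ T _ → F T) T js) × Q (foldl (λ T _ → F T) T js)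
    go [] i (inj₁ (_ , q)) good len = good , q
    go {T} [] i (inj₂ i≤) good len with prog good
    ... | _     , inj₁ (_ , q) = good , q
    ... | good′ , inj₂ grows   = ⊥-elim (ℕₚ.<-irrefl refl
          (ℕₚ.≤-trans (s≤s (ℕₚ.≤-trans (ℕₚ.≤-reflexive (sym len)) i≤)) (ℕₚ.≤-trans grows (count≤length _ slots))))
    go {T} (_ ∷ js) i st good len with prog good
    ... | good′ , inj₁ (≡T , q) = go js (suc i) (inj₁ (trans (cong F ≡T) refl , subst Q (sym ≡T) q)) good′ (trans (ℕₚ.+-suc (length js) i) len)
    ... | good′ , inj₂ grows with st
    ...   | inj₂ i≤ = go js (suc i) (inj₂ (ℕₚ.≤-trans (s≤s i≤) grows)) good′ (trans (ℕₚ.+-suc (length js) i) len)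
    ...   | inj₁ (≡T , q) = ⊥-elim (ℕₚ.<-irrefl (cong μ (sym ≡T)) grows)

  -- Sims' criterion: it suffices that products of two entries have normal forms. Then the normal
  -- forms are closed under multiplication, by induction over the final segments of the tests.
  module Closed {T : Table} (good : Good T)
                (pairs : ∀ p q → Π T ks (get T p ∙ get T q)) where

    Π⇒D : ∀ {r f} → Π T r f → D r f
    Π⇒D []                    = D-ι
    Π⇒D (_∷_ {k} {r} {p} s π) = D-∙ (D-weaken (Π⇒D π)) (D-slot {T} {k} {r} {s} good)

    -- Write f as p τ. Both f and p satisfy the test of k, hence so does τ, and an entry that
    -- satisfies its own test is empty.
    peel : ∀ {k r f} → Final (k ∷ r) → D r f → Π T (k ∷ r) f → Π T r f
    peel {k} {r} fin Df (_∷_ {p = p} s π) = subst (Π T r) (sym f≡p) π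
      where
      τ = get T (s , k)
      Dp = Π⇒D π
      Eτ = proj₁ (good s k)
      τ≡ : inv p ∙ (p ∙ τ) ≡ τ
      τ≡ = trans (sym (∙-assoc (inv p) p τ)) (trans (cong (_∙ τ) (inverseˡ (proj₁ Dp))) (∙-idˡ τ))
      Pτ : P k τ
      Pτ = subst (P k) τ≡ (P-∙ k (E-inv (proj₁ Dp)) (proj₁ Df) (P-inv k (proj₁ Dp) (D-head fin Dp)) (D-head fin Df))
      f≡p : p ∙ τ ≡ p
      f≡p = trans (cong (p ∙_) (slot≡ι good Pτ)) (∙-idʳ p)

    -- The slot with the label of `ι` must be empty: an entry there would agree with `ι` modulo
    -- `P k` and thus pass its own test.
    Π-ι : ∀ r → Π T r ι
    Π-ι []      = []
    Π-ι (k ∷ r) = subst (Π T (k ∷ r)) (trans (cong (ι ∙_) τ≡ι) (∙-idˡ ι)) (slot k ι ∷ Π-ι r)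
      where
      τ = get T (slot k ι , k)
      τ≡ι : τ ≡ ι
      τ≡ι with good (slot k ι) k
      ... | Eτ , Pτ , inj₁ ≡ι = ≡ι
      ... | Eτ , Pτ , inj₂ (fails , same) with () ← trans (sym fails) (test-complete k Eτ
            (subst (P k) (trans (cong (τ ∙_) inv-ι) (∙-idʳ τ)) (slot-sound k Eτ E-ι Pτ (λ _ → P-ι _) same)))

    Π-split : ∀ {k r f} → Π T (k ∷ r) f → ∃₂ λ p s → Π T r p × f ≡ p ∙ get T (s , k)
    Π-split (s ∷ π) = _ , s , π , refl

    module _ (k : K) (r : List K) (drop : ∀ {f} → D (k ∷ r) f → Π T ks f → Π T (k ∷ r) f)
             (closed : ∀ {f g} → Π T r f → Π T r g → Π T r (f ∙ g)) where

      -- An entry of key k moves right past a normal form of later keys, one factor at a time. At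
      -- each factor `pairs` rewrites the product of two entries, and `drop` removes the keys before
      -- k, whose factors are trivial.
      slot-∙ : ∀ {r′ q} s → (∀ {l} → l ∈ₗ r′ → l ∈ₗ r) → Π T r′ q → Π T (k ∷ r) (get T (s , k) ∙ q)
      slot-∙ s ⊆r [] = subst (Π T (k ∷ r)) (trans (∙-idˡ _) (sym (∙-idʳ _))) (s ∷ Π-ι r)
      slot-∙ s ⊆r (_∷_ {l} {p = q} s′ π) =
        let τ = get T (s , k)
            σ = get T (s′ , l)
            p , s₂ , π₂ , τq≡pτ₂ = Π-split (slot-∙ s (⊆r ∘ there) π)
            τ₂ = get T (s₂ , k)
            p′ , s₃ , π₃ , τ₂σ≡p′τ₃ = Π-split (drop (D-∙ (D-slot {T} {k} {r} {s₂} good)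
              (D-slot-∈ {T} {l} {k ∷ r} {s′} good (there (⊆r (here refl))))) (pairs (s₂ , k) (s′ , l)))
            τ₃ = get T (s₃ , k)
            eq : (p ∙ p′) ∙ τ₃ ≡ τ ∙ (q ∙ σ)
            eq = begin
              (p ∙ p′) ∙ τ₃ ≡⟨ ∙-assoc p p′ τ₃ ⟩
              p ∙ (p′ ∙ τ₃) ≡⟨ cong (p ∙_) τ₂σ≡p′τ₃ ⟨
              p ∙ (τ₂ ∙ σ)  ≡⟨ ∙-assoc p τ₂ σ ⟨
              (p ∙ τ₂) ∙ σ  ≡⟨ cong (_∙ σ) τq≡pτ₂ ⟨
              (τ ∙ q) ∙ σ   ≡⟨ ∙-assoc τ q σ ⟩
              τ ∙ (q ∙ σ)   ∎
        in subst (Π T (k ∷ r)) eq (s₃ ∷ closed π₂ π₃)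
        where open ≡-Reasoning

      -- In (p τ) (p′ τ′) the entry τ is moved past p′, and the two entries of key k that then meet
      -- are merged. What has gathered on the left consists of later keys and is multiplied by
      -- induction.
      closed-∷ : ∀ {f g} → Π T (k ∷ r) f → Π T (k ∷ r) g → Π T (k ∷ r) (f ∙ g)
      closed-∷ (_∷_ {p = p} s π) (_∷_ {p = p′} s′ π′) =
        let τ = get T (s , k)
            τ′ = get T (s′ , k)
            p₂ , s₂ , π₂ , τp′≡p₂τ₂ = Π-split (slot-∙ s id π′)
            τ₂ = get T (s₂ , k)
            p₃ , s₃ , π₃ , τ₂τ′≡p₃τ₃ = Π-split (drop (D-∙ (D-slot {T} {k} {r} {s₂} good) (D-slot {T} {k} {r} {s′} good))
              (pairs (s₂ , k) (s′ , k)))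
            τ₃ = get T (s₃ , k)
            eq : ((p ∙ p₂) ∙ p₃) ∙ τ₃ ≡ (p ∙ τ) ∙ (p′ ∙ τ′)
            eq = begin
              ((p ∙ p₂) ∙ p₃) ∙ τ₃ ≡⟨ ∙-assoc (p ∙ p₂) p₃ τ₃ ⟩
              (p ∙ p₂) ∙ (p₃ ∙ τ₃) ≡⟨ cong ((p ∙ p₂) ∙_) τ₂τ′≡p₃τ₃ ⟨
              (p ∙ p₂) ∙ (τ₂ ∙ τ′) ≡⟨ ∙-assoc (p ∙ p₂) τ₂ τ′ ⟨
              ((p ∙ p₂) ∙ τ₂) ∙ τ′ ≡⟨ cong (_∙ τ′) (∙-assoc p p₂ τ₂) ⟩
              (p ∙ (p₂ ∙ τ₂)) ∙ τ′ ≡⟨ cong (λ h → (p ∙ h) ∙ τ′) τp′≡p₂τ₂ ⟨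
              (p ∙ (τ ∙ p′)) ∙ τ′  ≡⟨ cong (_∙ τ′) (∙-assoc p τ p′) ⟨
              ((p ∙ τ) ∙ p′) ∙ τ′  ≡⟨ ∙-assoc (p ∙ τ) p′ τ′ ⟩
              (p ∙ τ) ∙ (p′ ∙ τ′)  ∎
        in subst (Π T (k ∷ r)) eq (s₃ ∷ closed (closed π π₂) π₃)
        where open ≡-Reasoning

    closed : ∀ r → Final r → (∀ {f} → D r f → Π T ks f → Π T r f) →
             ∀ {f g} → Π T r f → Π T r g → Π T r (f ∙ g)
    closed []      fin drop [] [] = subst (Π T []) (sym (∙-idˡ ι)) []
    closed (k ∷ r) fin drop = closed-∷ k r drop
      (closed r (final-tail fin) λ Df π → peel fin Df (drop (D-weaken Df) π))

    Π-∙ : ∀ {f g} → Π T ks f → Π T ks g → Π T ks (f ∙ g)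
    Π-∙ = closed ks final-ks (λ _ π → π)

    peel-++ : ∀ l {r f} → Final (l ++ r) → D r f → Π T (l ++ r) f → Π T r f
    peel-++ []      fin Df π = π
    peel-++ (k ∷ l) {r} fin Df π = peel-++ l (final-tail fin) Df (peel fin (weaken l Df) π)
      where
      weaken : ∀ l {r f} → D r f → D (l ++ r) f
      weaken []      Df = Df
      weaken (k ∷ l) Df = D-weaken (weaken l Df)

-- Maps from the index set to itself

module _ {n : ℕ} where
  Perm : Set
  Perm = El n PERM

  infixl 9 _!_
  _!_ : Perm → Fin (suc n) → Fin (suc n)
  _!_ = lookup

  ι : Perm
  ι = eval idE tt

  infixl 7 _⊙_
  _⊙_ : Perm → Perm → Perm
  f ⊙ g = eval compE (f , g , tt)

  inv : Perm → Perm
  inv f = eval invE (f , tt)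

  Injective : Perm → Set
  Injective f = ∀ {x y} → f ! x ≡ f ! y → x ≡ y

  ι-! : ∀ x → ι ! x ≡ x
  ι-! = lookup-table id

  ⊙-! : ∀ f g x → (f ⊙ g) ! x ≡ f ! (g ! x)
  ⊙-! f g = lookup-table λ x → f ! (g ! x)

  ⊙-assoc : ∀ f g h → (f ⊙ g) ⊙ h ≡ f ⊙ (g ⊙ h)
  ⊙-assoc f g h = table-cong λ x → trans (⊙-! f g (h ! x)) (cong (f !_) (sym (⊙-! g h x)))

  ⊙-idˡ : ∀ f → ι ⊙ f ≡ f
  ⊙-idˡ f = lookup-ext λ x → trans (⊙-! ι f x) (ι-! (f ! x))

  ⊙-idʳ : ∀ f → f ⊙ ι ≡ f
  ⊙-idʳ f = lookup-ext λ x → trans (⊙-! f ι x) (cong (f !_) (ι-! x))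

  -- A missed value could be punched out, which would inject `suc n` elements into n.
  injective⇒surjective : ∀ {f} → Injective f → ∀ y → ∃ λ x → f ! x ≡ y
  injective⇒surjective {f} inj y with Finₚ.any? (λ x → f ! x Finₚ.≟ y)
  ... | yes w  = w
  ... | no ¬w = ⊥-elim (ℕₚ.<-irrefl refl (Finₚ.injective⇒≤ {f = λ x → Fin.punchOut (miss x)}
                  λ eq → inj (Finₚ.punchOut-injective (miss _) (miss _) eq)))
    where
    miss : ∀ x → y ≢ f ! x
    miss x eq = ¬w (x , sym eq)

  !-inv : ∀ {f} → Injective f → ∀ y → f ! (inv f ! y) ≡ y
  !-inv {f} inj y with injective⇒surjective {f} inj y
  ... | x , fx≡y = trans (cong (f !_) (lookup-table (λ y → findB y (λ x → eqB (f ! x) y)) y))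
                     (eqB-sound (findB-sat {f = λ x → eqB (f ! x) y} y x (eqB-complete fx≡y)))

  inv-! : ∀ {f} → Injective f → ∀ x → inv f ! (f ! x) ≡ x
  inv-! {f} inj x = inj (!-inv {f} inj (f ! x))

  ⊙-injective : ∀ {f g} → Injective f → Injective g → Injective (f ⊙ g)
  ⊙-injective {f} {g} f-inj g-inj {x} {y} eq = g-inj (f-inj (trans (sym (⊙-! f g x)) (trans eq (⊙-! f g y))))

  inv-injective : ∀ {f} → Injective f → Injective (inv f)
  inv-injective {f} inj {x} {y} eq = trans (sym (!-inv {f} inj x)) (trans (cong (f !_) eq) (!-inv {f} inj y))

  ⊙-inverseˡ : ∀ {f} → Injective f → inv f ⊙ f ≡ ι
  ⊙-inverseˡ {f} inj = lookup-ext λ x → trans (⊙-! (inv f) f x) (trans (inv-! {f} inj x) (sym (ι-! x)))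

  ⊙-inverseʳ : ∀ {f} → Injective f → f ⊙ inv f ≡ ι
  ⊙-inverseʳ {f} inj = lookup-ext λ x → trans (⊙-! f (inv f) x) (trans (!-inv {f} inj x) (sym (ι-! x)))

  _≟ₚ_ : (f g : Perm) → Dec (f ≡ g)
  _≟ₚ_ = Vecₚ.≡-dec Finₚ._≟_

  module _ (C : El n (arr (arr bool))) where
    In : Fin (suc n) → Fin (suc n) → Set
    In i x = lookup (lookup C i) x ≡ true

-- Flags of subgroups

tableOf : ∀ {n} → FiniteGroup (suc n) → El n (arr (arr ix))
tableOf G = table λ x → table λ y → FiniteGroup._∙_ G x y

module _ {n : ℕ} (G : FiniteGroup (suc n)) (C : El n (arr (arr bool))) where
  open FiniteGroup G

  record IsFlag : Set where
    field
      bottom  : ∀ x → In C zero x → x ≡ ε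
      ε-in    : ∀ i → In C i ε
      ∙-in    : ∀ i {x y} → In C i x → In C i y → In C i (x ∙ y)
      ⁻¹-in   : ∀ i {x} → In C i x → In C i (x ⁻¹)
      nested  : ∀ {i j x} → toℕ i ≤ toℕ j → In C i x → In C j x
      -- Term i normalizes the union of the terms before it. The existential k replaces a
      -- predecessor of i and tolerates repeated terms.
      normal  : ∀ {i j x u} → toℕ j < toℕ i → In C i x → In C j u → ∃ λ k → toℕ k < toℕ i × In C k (x ∙ u ∙ x ⁻¹)
      top     : ∃ λ i → ∀ x → In C i x

module Flagged {n : ℕ} (G : FiniteGroup (suc n)) (C : El n (arr (arr bool))) (flag : IsFlag G C) where
  open FiniteGroup G public using (_∙_; ε; _⁻¹; group)
  open Group group public using (_\\_; assoc; identityˡ; identityʳ; inverseˡ; inverseʳ)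
  open GroupProperties group public using (\\-leftDividesˡ; \\-leftDividesʳ; ∙-cancelˡ; ⁻¹-involutive; ⁻¹-anti-homo-∙; ε⁻¹≈ε)
  open IsFlag flag public

  N : Set
  N = Fin (suc n)

  g : El n GRP
  g = tableOf G , C

  I : N → N → Set
  I = In C

  \\-∙ : ∀ x y z → x \\ (y ∙ z) ≡ (x \\ y) ∙ z
  \\-∙ x y z = sym (assoc (x ⁻¹) y z)

  \\-flip : ∀ x y → (x \\ y) ⁻¹ ≡ y \\ x
  \\-flip x y = trans (⁻¹-anti-homo-∙ (x ⁻¹) y) (cong (y ⁻¹ ∙_) (⁻¹-involutive x))

  -- The term just below the level of x.
  L : N → N → Set
  L x u = I zero u ⊎ ∃ λ i → I i u × ¬ I i x

  -- For i = 0 only the first disjunct is left and gives the trivial group; for later i it is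
  -- contained in the second, with j = 0.
  Prev : N → N → Set
  Prev i u = I zero u ⊎ ∃ λ j → toℕ j < toℕ i × I j u

  New : N → N → Set
  New i x = I i x × ¬ Prev i x

  zero-in : ∀ {i x} → I zero x → I i x
  zero-in {i} {x} x∈ with refl ← bottom x x∈ = ε-in i

  common : ∀ {i j x y} → I i x → I j y → (I i x × I i y) ⊎ (I j x × I j y)
  common {i} {j} x∈ y∈ with ℕₚ.≤-total (toℕ i) (toℕ j)
  ... | inj₁ i≤j = inj₂ (nested i≤j x∈ , y∈)
  ... | inj₂ j≤i = inj₁ (x∈ , nested j≤i y∈)

  L-∙ : ∀ {x u v} → L x u → L x v → L x (u ∙ v)
  L-∙ (inj₁ u∈) (inj₁ v∈) = inj₁ (∙-in zero u∈ v∈)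
  L-∙ (inj₁ u∈) (inj₂ (j , v∈ , x∉)) = inj₂ (j , ∙-in j (zero-in u∈) v∈ , x∉)
  L-∙ (inj₂ (i , u∈ , x∉)) (inj₁ v∈) = inj₂ (i , ∙-in i u∈ (zero-in v∈) , x∉)
  L-∙ (inj₂ (i , u∈ , x∉)) (inj₂ (j , v∈ , x∉′)) with common {i} {j} u∈ v∈
  ... | inj₁ (u∈ , v∈) = inj₂ (i , ∙-in i u∈ v∈ , x∉)
  ... | inj₂ (u∈ , v∈) = inj₂ (j , ∙-in j u∈ v∈ , x∉′)

  L-⁻¹ : ∀ {x u} → L x u → L x (u ⁻¹)
  L-⁻¹ (inj₁ u∈) = inj₁ (⁻¹-in zero u∈)
  L-⁻¹ (inj₂ (i , u∈ , x∉)) = inj₂ (i , ⁻¹-in i u∈ , x∉)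

  L-ε : ∀ x → L x ε
  L-ε x = inj₁ (ε-in zero)

  Prev-∙ : ∀ {i u v} → Prev i u → Prev i v → Prev i (u ∙ v)
  Prev-∙ (inj₁ u∈) (inj₁ v∈) = inj₁ (∙-in zero u∈ v∈)
  Prev-∙ (inj₁ u∈) (inj₂ (j , lt , v∈)) = inj₂ (j , lt , ∙-in j (zero-in u∈) v∈)
  Prev-∙ (inj₂ (i , lt , u∈)) (inj₁ v∈) = inj₂ (i , lt , ∙-in i u∈ (zero-in v∈))
  Prev-∙ (inj₂ (i , lt , u∈)) (inj₂ (j , lt′ , v∈)) with common {i} {j} u∈ v∈
  ... | inj₁ (u∈ , v∈) = inj₂ (i , lt , ∙-in i u∈ v∈)
  ... | inj₂ (u∈ , v∈) = inj₂ (j , lt′ , ∙-in j u∈ v∈)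

  -- By nestedness, a term that contains x contains every term that does not, hence all of `L x`.
  I-shift : ∀ {x u j} → L x u → I j x → I j (x ∙ u)
  I-shift {j = j} (inj₁ u∈) x∈ = ∙-in j x∈ (zero-in u∈)
  I-shift {j = j} (inj₂ (k , u∈ , x∉)) x∈ with ℕₚ.≤-total (toℕ k) (toℕ j)
  ... | inj₁ k≤j = ∙-in j x∈ (nested k≤j u∈)
  ... | inj₂ j≤k = ⊥-elim (x∉ (nested j≤k x∈))

  I-unshift : ∀ {x u j} → L x u → I j (x ∙ u) → I j x
  I-unshift {x} {u} {j} Lu xu∈ = go Lu
    where
    back : ∀ {k} → I k (x ∙ u) → I k u → I k x
    back {k} xu∈ u∈ = subst (I k) (trans (assoc x u (u ⁻¹)) (trans (cong (x ∙_) (inverseʳ u)) (identityʳ x))) (∙-in k xu∈ (⁻¹-in k u∈))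
    go : L x u → I j x
    go (inj₁ u∈) = back xu∈ (zero-in u∈)
    go (inj₂ (k , u∈ , x∉)) with ℕₚ.≤-total (toℕ k) (toℕ j)
    ... | inj₁ k≤j = back xu∈ (nested k≤j u∈)
    ... | inj₂ j≤k = ⊥-elim (x∉ (back (nested j≤k xu∈) u∈))

  infix 4 _~_
  -- Symmetric and transitive although the subgroup varies with x: all elements of a coset lie in
  -- the same terms and so have the same `L`.
  _~_ : N → N → Set
  x ~ y = L x (x \\ y)

  ~-refl : ∀ {x} → x ~ x
  ~-refl {x} = subst (L x) (sym (inverseˡ x)) (L-ε x)

  ~-I : ∀ {x y j} → x ~ y → I j x → I j y
  ~-I {x} {y} {j} x~y x∈ = subst (I j) (\\-leftDividesˡ x y) (I-shift x~y x∈)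

  ~-I′ : ∀ {x y j} → x ~ y → I j y → I j x
  ~-I′ {x} {y} {j} x~y y∈ = I-unshift x~y (subst (I j) (sym (\\-leftDividesˡ x y)) y∈)

  ~-L : ∀ {x y u} → x ~ y → L x u → L y u
  ~-L x~y (inj₁ u∈) = inj₁ u∈
  ~-L x~y (inj₂ (i , u∈ , x∉)) = inj₂ (i , u∈ , x∉ ∘ ~-I′ x~y)

  ~-L′ : ∀ {x y u} → x ~ y → L y u → L x u
  ~-L′ x~y (inj₁ u∈) = inj₁ u∈
  ~-L′ x~y (inj₂ (i , u∈ , y∉)) = inj₂ (i , u∈ , y∉ ∘ ~-I x~y)

  ~-sym : ∀ {x y} → x ~ y → y ~ x
  ~-sym {x} {y} x~y = ~-L x~y (subst (L x) (\\-flip x y) (L-⁻¹ x~y))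

  \\-chain : ∀ x y z → (x \\ y) ∙ (y \\ z) ≡ x \\ z
  \\-chain x y z = trans (assoc (x ⁻¹) y (y \\ z)) (cong (x ⁻¹ ∙_) (\\-leftDividesˡ y z))

  ~-trans : ∀ {x y z} → x ~ y → y ~ z → x ~ z
  ~-trans {x} {y} {z} x~y y~z = subst (L x) (\\-chain x y z) (L-∙ x~y (~-L′ x~y y~z))

  ~-∙ : ∀ {x u} → L x u → x ~ x ∙ u
  ~-∙ {x} {u} Lu = subst (L x) (sym (\\-leftDividesʳ x u)) Lu

  ~-Prev : ∀ {i x y} → x ~ y → Prev i x → Prev i y
  ~-Prev x~y (inj₁ x∈) = inj₁ (~-I x~y x∈)
  ~-Prev x~y (inj₂ (j , lt , x∈)) = inj₂ (j , lt , ~-I x~y x∈)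

  ~-New : ∀ {i x y} → x ~ y → New i x → New i y
  ~-New x~y (x∈ , x∉) = ~-I x~y x∈ , x∉ ∘ ~-Prev (~-sym x~y)

  L⇒Prev : ∀ {i x u} → I i x → L x u → Prev i u
  L⇒Prev x∈ (inj₁ u∈) = inj₁ u∈
  L⇒Prev {i} x∈ (inj₂ (j , u∈ , x∉)) = inj₂ (j , ℕₚ.≰⇒> (λ i≤j → x∉ (nested i≤j x∈)) , u∈)

  Prev⇒I : ∀ {i u} → Prev i u → I i u
  Prev⇒I (inj₁ u∈) = zero-in u∈
  Prev⇒I (inj₂ (j , lt , u∈)) = nested (ℕₚ.<⇒≤ lt) u∈

  Prev⇒L : ∀ {i x u} → New i x → Prev i u → L x u
  Prev⇒L _ (inj₁ u∈) = inj₁ u∈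
  Prev⇒L (_ , x∉) (inj₂ (j , lt , u∈)) = inj₂ (j , u∈ , λ x∈ → x∉ (inj₂ (j , lt , x∈)))

  Prev-normal : ∀ {i x u} → I i x → Prev i u → Prev i (x ∙ u ∙ x ⁻¹)
  Prev-normal {i} {x} {u} x∈ (inj₁ u∈) with refl ← bottom u u∈ =
    inj₁ (subst (I zero) (sym (trans (cong (_∙ x ⁻¹) (identityʳ x)) (inverseʳ x))) (ε-in zero))
  Prev-normal x∈ (inj₂ (j , lt , u∈)) = inj₂ (normal lt x∈ u∈)

  Prev-conj : ∀ {i y v} → I i y → Prev i v → Prev i (y \\ (v ∙ y))
  Prev-conj {i} {y} {v} y∈ v∈ = subst (Prev i) (trans (cong (y ⁻¹ ∙ v ∙_) (⁻¹-involutive y)) (assoc (y ⁻¹) v y))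
    (Prev-normal (⁻¹-in i y∈) v∈)

  -- No term omits `ε`, so its coset is a single point; maps that preserve the cosets therefore fix
  -- it.
  ~-ε : ∀ {y} → ε ~ y → y ≡ ε
  ~-ε {y} (inj₁ y∈) = trans (sym (trans (cong (_∙ y) ε⁻¹≈ε) (identityˡ y))) (bottom _ y∈)
  ~-ε (inj₂ (i , _ , ε∉)) = ⊥-elim (ε∉ (ε-in i))

  mul ldiv : N → N → N
  mul x y = lookup (lookup (tableOf G) x) y
  ldiv x y = eval ldivE (g , x , y , tt)

  lowB prevB newB : N → N → Bool
  lowB x u = eval lowE (g , x , u , tt)
  prevB i u = eval prevE (g , i , u , tt)
  newB i x = eval newE (g , i , x , tt)

  inB : N → N → Bool
  inB i x = lookup (lookup C i) x

  lead : N → N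
  lead x = eval leadE (g , x , tt)

  mul≡ : ∀ x y → mul x y ≡ x ∙ y
  mul≡ x y = trans (cong (λ r → lookup r y) (lookup-table (λ x → table (x ∙_)) x)) (lookup-table (x ∙_) y)

  opaque
    unfolding ldivE lowE prevE newE leadE

    ldiv≡ : ∀ x y → ldiv x y ≡ x \\ y
    ldiv≡ x y = trans (sym (\\-leftDividesʳ x _)) (cong (x \\_) (trans (sym (mul≡ x _))
      (eqB-sound (findB-sat {f = λ u → eqB (mul x u) y} x (x \\ y) (eqB-complete (trans (mul≡ x _) (\\-leftDividesˡ x y)))))))

    lowB⇒L : ∀ {x u} → lowB x u ≡ true → L x u
    lowB⇒L {x} {u} low with or-elim {inB zero u} low
    ... | inj₁ u∈ = inj₁ u∈
    ... | inj₂ any with anyB-elim {f = λ i → if inB i u then (if inB i x then false else true) else false} any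
    ...   | i , h = let u∈ , x∉ = and-elim {inB i u} h in inj₂ (i , u∈ , not-elim x∉)

    L⇒lowB : ∀ {x u} → L x u → lowB x u ≡ true
    L⇒lowB (inj₁ u∈) = or-introˡ u∈
    L⇒lowB {x} {u} (inj₂ (i , u∈ , x∉)) = or-introʳ {inB zero u}
      (anyB-intro {f = λ i → if inB i u then (if inB i x then false else true) else false} i (and-intro u∈ (not-intro x∉)))

    prevB⇒Prev : ∀ {i u} → prevB i u ≡ true → Prev i u
    prevB⇒Prev {i} {u} p with or-elim {inB zero u} p
    ... | inj₁ u∈ = inj₁ u∈
    ... | inj₂ any with anyB-elim {f = λ j → if j <ᵇ i then inB j u else false} any
    ...   | j , h = let lt , u∈ = and-elim {j <ᵇ i} h in inj₂ (j , <ᵇ⇒< j i lt , u∈)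

    Prev⇒prevB : ∀ {i u} → Prev i u → prevB i u ≡ true
    Prev⇒prevB (inj₁ u∈) = or-introˡ u∈
    Prev⇒prevB {i} {u} (inj₂ (j , lt , u∈)) = or-introʳ {inB zero u}
      (anyB-intro {f = λ j → if j <ᵇ i then inB j u else false} j (and-intro (<⇒<ᵇ j i lt) u∈))

    newB⇒New : ∀ {i x} → newB i x ≡ true → New i x
    newB⇒New {i} {x} p = let x∈ , x∉ = and-elim {inB i x} p in x∈ , not-elim x∉ ∘ Prev⇒prevB

    New⇒newB : ∀ {i x} → New i x → newB i x ≡ true
    New⇒newB (x∈ , x∉) = and-intro x∈ (not-intro (x∉ ∘ prevB⇒Prev))

    Prev? : ∀ i x → Prev i x ⊎ ¬ Prev i x
    Prev? i x with true-or-not (prevB i x)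
    ... | inj₁ p = inj₁ (prevB⇒Prev p)
    ... | inj₂ ¬p = inj₂ (¬p ∘ Prev⇒prevB)

    New? : ∀ i x → New i x ⊎ ¬ New i x
    New? i x with true-or-not (newB i x)
    ... | inj₁ p = inj₁ (newB⇒New p)
    ... | inj₂ ¬p = inj₂ (¬p ∘ New⇒newB)

    private
      leadB : N → N → Bool
      leadB x t = lowB x (ldiv t x)

      leadB⇒~ : ∀ {x t} → leadB x t ≡ true → t ~ x
      leadB⇒~ {x} {t} p = ~-sym (subst (L x) (trans (cong _⁻¹ (ldiv≡ t x)) (\\-flip t x)) (L-⁻¹ (lowB⇒L p)))

      ~⇒leadB : ∀ {x t} → t ~ x → leadB x t ≡ true
      ~⇒leadB {x} {t} t~x = L⇒lowB (subst (L x) (sym (ldiv≡ t x)) (~-L t~x t~x))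

    lead~ : ∀ x → lead x ~ x
    lead~ x = leadB⇒~ (findB-sat {f = leadB x} x x (~⇒leadB {x} {x} ~-refl))

    -- The two searches use predicates that agree everywhere, and both have a witness, so their
    -- different defaults do not show.
    lead-cong : ∀ {x y} → x ~ y → lead x ≡ lead y
    lead-cong {x} {y} x~y = findB-cong {f = leadB x} {leadB y} x y x
      (λ t → true⇔⇒≡ (λ p → ~⇒leadB {y} {t} (~-trans (leadB⇒~ {x} {t} p) x~y))
                      (λ p → ~⇒leadB {x} {t} (~-trans (leadB⇒~ {y} {t} p) (~-sym x~y))))
      (~⇒leadB {x} {x} ~-refl)

-- Automorphisms of the terms, and the tests that cut them out

module Automorphisms {n : ℕ} (G : FiniteGroup (suc n)) (C : El n (arr (arr bool))) (flag : IsFlag G C) where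
  open Flagged G C flag public

  -- Being the identity outside X makes an automorphism of a subgroup one definite map on all
  -- indices, so automorphisms of different terms can share a table and be compared by equality.
  record Aut (X : N → Set) (f : Perm) : Set where
    field
      injective : Injective f
      outside   : ∀ {x} → ¬ X x → f ! x ≡ x
      block     : ∀ x → x ~ f ! x
      mult      : ∀ {x u} → X x → X u → f ! (x ∙ u) ≡ f ! x ∙ f ! u

  Key : Set
  Key = El n (tup 3)

  Table : Set
  Table = El n TAB

  get : Table → N × Key → Perm
  get = lookupT 4 {PERM}

  set : Table → N × Key → Perm → Table
  set = updT 4 {PERM}

  emptyV : Table
  emptyV = eval {n} (constTE 4 idE) tt

  -- The later slots (c ≠ 0) of the table generate the automorphisms of X.
  record Generates (X : N → Set) (T : Table) : Set₁ where
    field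
      sound    : ∀ s c k → Aut X (get T (s , suc c , k))
      complete : ∀ (Q : Perm → Set) → Q ι → (∀ {f h} → Q f → Q h → Q (f ⊙ h)) →
                 (∀ s c k → Q (get T (s , suc c , k))) → ∀ {a} → Aut X a → Q a

module Stage {n : ℕ} (G : FiniteGroup (suc n)) (C : El n (arr (arr bool))) (flag : IsFlag G C) (i : Fin (suc n)) where
  open Automorphisms G C flag public

  -- The bijections that are supported on the i-th term, act on the cosets
  -- x · L x, and are multiplicative as far as the right factor lies below.
  record E (f : Perm) : Set where
    field
      injective : Injective f
      outside   : ∀ {x} → ¬ I i x → f ! x ≡ x
      block     : ∀ x → x ~ f ! x
      mult      : ∀ {x u} → I i x → Prev i u → f ! (x ∙ u) ≡ f ! x ∙ f ! u

    fixes-ε : f ! ε ≡ ε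
    fixes-ε = ~-ε (block ε)

  E-ι : E ι
  E-ι = record
    { injective = λ {x} {y} eq → trans (sym (ι-! x)) (trans eq (ι-! y))
    ; outside   = λ {x} _ → ι-! x
    ; block     = λ x → subst (x ~_) (sym (ι-! x)) ~-refl
    ; mult      = λ {x} {u} _ _ → trans (ι-! (x ∙ u)) (sym (cong₂ _∙_ (ι-! x) (ι-! u)))
    }

  E-∙ : ∀ {f h} → E f → E h → E (f ⊙ h)
  E-∙ {f} {h} Ef Eh = record
    { injective = ⊙-injective {f = f} {h} F.injective H.injective
    ; outside   = λ {x} x∉ → trans (⊙-! f h x) (trans (cong (f !_) (H.outside x∉)) (F.outside x∉))
    ; block     = λ x → subst (x ~_) (sym (⊙-! f h x)) (~-trans (H.block x) (F.block (h ! x)))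
    ; mult      = λ {x} {u} x∈ u∈ → begin
        (f ⊙ h) ! (x ∙ u)                ≡⟨ ⊙-! f h (x ∙ u) ⟩
        f ! (h ! (x ∙ u))                ≡⟨ cong (f !_) (H.mult x∈ u∈) ⟩
        f ! (h ! x ∙ h ! u)              ≡⟨ F.mult (~-I (H.block x) x∈) (~-Prev (H.block u) u∈) ⟩
        f ! (h ! x) ∙ f ! (h ! u)        ≡⟨ cong₂ _∙_ (⊙-! f h x) (⊙-! f h u) ⟨
        (f ⊙ h) ! x ∙ (f ⊙ h) ! u        ∎
    }
    where
    module F = E Ef
    module H = E Eh
    open ≡-Reasoning

  E-inv : ∀ {f} → E f → E (inv f)
  E-inv {f} Ef = record
    { injective = inv-injective {f = f} F.injective
    ; outside   = λ {x} x∉ → F.injective (trans (f!inv x) (sym (F.outside x∉)))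
    ; block     = inv-block
    ; mult      = λ {x} {u} x∈ u∈ → F.injective (trans (f!inv (x ∙ u)) (sym (trans
        (F.mult (~-I (inv-block x) x∈) (~-Prev (inv-block u) u∈)) (cong₂ _∙_ (f!inv x) (f!inv u)))))
    }
    where
    module F = E Ef
    f!inv = !-inv {f = f} F.injective
    inv-block : ∀ x → x ~ inv f ! x
    inv-block x = ~-sym (subst (inv f ! x ~_) (f!inv x) (F.block (inv f ! x)))

  MultAt : Perm → N → N → Set
  MultAt f x y = f ! (x ∙ y) ≡ f ! x ∙ f ! y

  -- For c = 0 the condition ranges over two whole cosets: elements of `E` move x and y inside their
  -- cosets, so a condition at one pair would not survive composition. The test is void unless x
  -- lies in term j, which makes x run up the series as j grows.
  P : El n (tup 3) → Perm → Set
  P (zero  , j , y , x) f = I j x → I i x → I i y → ∀ {x′ y′} → x ~ x′ → y ~ y′ → MultAt f x′ y′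
  P (suc _ , j , y , x) f = f ! x ≡ x

  P-ι : ∀ k → P k ι
  P-ι (zero  , j , y , x) _ _ _ {x′} {y′} _ _ = trans (ι-! (x′ ∙ y′)) (sym (cong₂ _∙_ (ι-! x′) (ι-! y′)))
  P-ι (suc _ , j , y , x) = ι-! x

  P-∙ : ∀ k {f h} → E f → E h → P k f → P k h → P k (f ⊙ h)
  P-∙ (suc _ , j , y , x) {f} {h} Ef Eh Pf Ph = trans (⊙-! f h x) (trans (cong (f !_) Ph) Pf)
  P-∙ (zero , j , y , x) {f} {h} Ef Eh Pf Ph x∈ x∈′ y∈ {x′} {y′} x~ y~ = begin
    (f ⊙ h) ! (x′ ∙ y′)         ≡⟨ ⊙-! f h (x′ ∙ y′) ⟩
    f ! (h ! (x′ ∙ y′))         ≡⟨ cong (f !_) (Ph x∈ x∈′ y∈ x~ y~) ⟩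
    f ! (h ! x′ ∙ h ! y′)       ≡⟨ Pf x∈ x∈′ y∈ (~-trans x~ (E.block Eh x′)) (~-trans y~ (E.block Eh y′)) ⟩
    f ! (h ! x′) ∙ f ! (h ! y′) ≡⟨ cong₂ _∙_ (⊙-! f h x′) (⊙-! f h y′) ⟨
    (f ⊙ h) ! x′ ∙ (f ⊙ h) ! y′ ∎
    where open ≡-Reasoning

  P-inv : ∀ k {f} → E f → P k f → P k (inv f)
  P-inv (suc _ , j , y , x) {f} Ef Pf = E.injective Ef (trans (!-inv {f = f} (E.injective Ef) x) (sym Pf))
  P-inv (zero , j , y , x) {f} Ef Pf x∈ x∈′ y∈ {x′} {y′} x~ y~ =
    E.injective Ef (trans (f!inv (x′ ∙ y′)) (sym (trans (Pf x∈ x∈′ y∈ (~-trans x~ (E.block Einv x′)) (~-trans y~ (E.block Einv y′)))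
      (cong₂ _∙_ (f!inv x′) (f!inv y′)))))
    where
    f!inv = !-inv {f = f} (E.injective Ef)
    Einv = E-inv Ef

  -- Multiplicativity at one pair spreads over a pair of cosets, once it is
  -- known for the left factors below.
  spread : ∀ {f x y} → E f → I i x → I i y → (∀ {v y′} → L x v → y ~ y′ → MultAt f v y′) →
           ∀ {x₁ y₁} → x ~ x₁ → y ~ y₁ → MultAt f x₁ y₁ → ∀ {x₂ y₂} → x ~ x₂ → y ~ y₂ → MultAt f x₂ y₂
  spread {f} {x} {y} Ef x∈ y∈ below {x₁} {y₁} x~x₁ y~y₁ m {x₂} {y₂} x~x₂ y~y₂ =
    subst₂ (MultAt f) (\\-leftDividesˡ x₁ x₂) (\\-leftDividesˡ y₁ y₂) (begin
      f ! ((x₁ ∙ v) ∙ (y₁ ∙ w))         ≡⟨ cong (f !_) (assoc (x₁ ∙ v) y₁ w) ⟨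
      f ! (((x₁ ∙ v) ∙ y₁) ∙ w)         ≡⟨ F.mult (∙-in i x₁v∈ y₁∈) w∈ ⟩
      f ! ((x₁ ∙ v) ∙ y₁) ∙ f ! w       ≡⟨ cong (λ z → f ! z ∙ f ! w) push ⟩
      f ! ((x₁ ∙ y₁) ∙ v′) ∙ f ! w      ≡⟨ cong (_∙ f ! w) (F.mult (∙-in i x₁∈ y₁∈) v′∈) ⟩
      (f ! (x₁ ∙ y₁) ∙ f ! v′) ∙ f ! w  ≡⟨ cong (λ z → (z ∙ f ! v′) ∙ f ! w) m ⟩
      ((f ! x₁ ∙ f ! y₁) ∙ f ! v′) ∙ f ! w ≡⟨ cong (_∙ f ! w) (assoc _ _ _) ⟩
      (f ! x₁ ∙ (f ! y₁ ∙ f ! v′)) ∙ f ! w ≡⟨ cong (λ z → (f ! x₁ ∙ z) ∙ f ! w) (F.mult y₁∈ v′∈) ⟨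
      (f ! x₁ ∙ f ! (y₁ ∙ v′)) ∙ f ! w  ≡⟨ cong (λ z → (f ! x₁ ∙ f ! z) ∙ f ! w) y₁v′ ⟩
      (f ! x₁ ∙ f ! (v ∙ y₁)) ∙ f ! w   ≡⟨ cong (λ z → (f ! x₁ ∙ z) ∙ f ! w) (below Lxv y~y₁) ⟩
      (f ! x₁ ∙ (f ! v ∙ f ! y₁)) ∙ f ! w ≡⟨ cong (_∙ f ! w) (assoc _ _ _) ⟨
      ((f ! x₁ ∙ f ! v) ∙ f ! y₁) ∙ f ! w ≡⟨ assoc _ _ _ ⟩
      (f ! x₁ ∙ f ! v) ∙ (f ! y₁ ∙ f ! w) ≡⟨ cong₂ _∙_ (F.mult x₁∈ v∈) (F.mult y₁∈ w∈) ⟨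
      f ! (x₁ ∙ v) ∙ f ! (y₁ ∙ w)       ∎)
    where
    open ≡-Reasoning
    module F = E Ef
    v = x₁ \\ x₂
    w = y₁ \\ y₂
    v′ = y₁ \\ (v ∙ y₁)
    x₁∈ = ~-I x~x₁ x∈
    y₁∈ = ~-I y~y₁ y∈
    Lxv : L x v
    Lxv = ~-L′ x~x₁ (~-trans (~-sym x~x₁) x~x₂)
    v∈ = L⇒Prev x∈ Lxv
    w∈ = L⇒Prev y₁∈ (~-trans (~-sym y~y₁) y~y₂)
    x₁v∈ = ∙-in i x₁∈ (Prev⇒I v∈)
    v′∈ = Prev-conj y₁∈ v∈
    y₁v′ : y₁ ∙ v′ ≡ v ∙ y₁
    y₁v′ = \\-leftDividesˡ y₁ (v ∙ y₁)
    push : (x₁ ∙ v) ∙ y₁ ≡ (x₁ ∙ y₁) ∙ v′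
    push = trans (assoc x₁ v y₁) (trans (cong (x₁ ∙_) (sym y₁v′)) (sym (assoc x₁ y₁ v′)))

  -- An element v of `L x` lies in a term j′ that misses x, so j′ < j, and the key with j′ and v in
  -- place of j and x comes earlier.
  below : ∀ {f j y x} → E f → I j x → I i x → I i y → (∀ {l} → l ≺ (zero , j , y , x) → P l f) →
          ∀ {v y′} → L x v → y ~ y′ → MultAt f v y′
  below {f} Ef x∈ x∈′ y∈ Pf {v} {y′} (inj₁ v∈) y~ with refl ← bottom v v∈ =
    trans (cong (f !_) (identityˡ y′)) (sym (trans (cong (_∙ f ! y′) (E.fixes-ε Ef)) (identityˡ _)))
  below {f} {j} {y} {x} Ef x∈ x∈′ y∈ Pf {v} {y′} (inj₂ (j′ , v∈ , x∉)) y~ =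
    Pf {zero , j′ , y , v} (inj₂ (refl , inj₁ (ℕₚ.≰⇒> λ j≤j′ → x∉ (nested j≤j′ x∈))))
      v∈ (Prev⇒I (L⇒Prev x∈′ (inj₂ (j′ , v∈ , x∉)))) y∈ ~-refl y~

  test : El n (tup 3) → Perm → Bool
  test k f = eval testE (g , g , i , k , f , tt)

  slot : El n (tup 3) → Perm → N
  slot k f = eval slotE (g , k , f , tt)

  condB : N → N → N → Bool
  condB j y x = if inB j x then (if inB i x then inB i y else false) else false

  opaque
    unfolding testE slotE

    test-complete : ∀ k {f} → E f → P k f → test k f ≡ true
    test-complete (suc _ , j , y , x) Ef Pf = eqB-complete Pf
    test-complete (zero , j , y , x) {f} Ef Pf = [ holds , if-false ]′ (true-or-not (condB j y x))
      where
      holds : condB j y x ≡ true → test (zero , j , y , x) f ≡ true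
      holds c =
        let x∈ , c′ = and-elim {inB j x} c
            x∈′ , y∈ = and-elim {inB i x} c′
        in trans (if-true c) (eqB-complete (trans (cong (f !_) (mul≡ x y))
             (trans (Pf x∈ x∈′ y∈ ~-refl ~-refl) (sym (mul≡ (f ! x) (f ! y))))))

    test⇒MultAt : ∀ {j y x f} → test (zero , j , y , x) f ≡ true → I j x → I i x → I i y → MultAt f x y
    test⇒MultAt {j} {y} {x} {f} t x∈ x∈′ y∈ = trans (cong (f !_) (sym (mul≡ x y))) (trans
      (eqB-sound (trans (sym (if-true (and-intro x∈ (and-intro x∈′ y∈)))) t)) (mul≡ (f ! x) (f ! y)))

    test-sound : ∀ k {f} → E f → (∀ {l} → l ≺ k → P l f) → test k f ≡ true → P k f
    test-sound (suc _ , j , y , x) Ef Pf t = eqB-sound t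
    test-sound (zero , j , y , x) {f} Ef Pf t x∈ x∈′ y∈ =
      spread Ef x∈′ y∈ (below Ef x∈ x∈′ y∈ Pf) ~-refl ~-refl (test⇒MultAt {j} {y} {x} {f} t x∈ x∈′ y∈)

    -- Equal labels say that f h⁻¹ is multiplicative at (h x , h y). As h preserves cosets, this
    -- pair lies in the cosets of x and y, and one pair is enough for `spread`.
    slot-sound : ∀ k {f h} → E f → E h → (∀ {l} → l ≺ k → P l f) → (∀ {l} → l ≺ k → P l h) →
                 slot k f ≡ slot k h → P k (f ⊙ inv h)
    slot-sound (suc _ , j , y , x) {f} {h} Ef Eh Pf Ph eq =
      trans (⊙-! f (inv h) x) (trans (cong (f !_) (sym eq)) (!-inv {f = f} (E.injective Ef) x))
    slot-sound (zero , j , y , x) {f} {h} Ef Eh Pf Ph eq x∈ x∈′ y∈ =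
      spread Efh x∈′ y∈ (below Efh x∈ x∈′ y∈ λ {l} l≺ → P-∙ l Ef (E-inv Eh) (Pf l≺) (P-inv l Eh (Ph l≺)))
        (E.block Eh x) (E.block Eh y) at
      where
      open ≡-Reasoning
      Efh : E (f ⊙ inv h)
      Efh = E-∙ Ef (E-inv Eh)
      at : MultAt (f ⊙ inv h) (h ! x) (h ! y)
      at = begin
        (f ⊙ inv h) ! (h ! x ∙ h ! y)       ≡⟨ ⊙-! f (inv h) (h ! x ∙ h ! y) ⟩
        f ! (inv h ! (h ! x ∙ h ! y))       ≡⟨ cong (λ z → f ! (inv h ! z)) (mul≡ (h ! x) (h ! y)) ⟨
        f ! (inv h ! mul (h ! x) (h ! y))   ≡⟨ cong (f !_) eq ⟨
        f ! (inv f ! mul (f ! x) (f ! y))   ≡⟨ !-inv {f = f} (E.injective Ef) (mul (f ! x) (f ! y)) ⟩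
        mul (f ! x) (f ! y)                 ≡⟨ mul≡ (f ! x) (f ! y) ⟩
        f ! x ∙ f ! y                       ≡⟨ cong₂ _∙_ (back x) (back y) ⟨
        (f ⊙ inv h) ! (h ! x) ∙ (f ⊙ inv h) ! (h ! y) ∎
        where
        back : ∀ z → (f ⊙ inv h) ! (h ! z) ≡ f ! z
        back z = trans (⊙-! f (inv h) (h ! z)) (cong (f !_) (inv-! {f = h} (E.injective Eh) z))

  end : ∀ {f} → E f → (∀ k → P k f) → f ≡ ι
  end {f} Ef Pf = lookup-ext λ x → trans (fixed x) (sym (ι-! x))
    where
    fixed : ∀ x → f ! x ≡ x
    fixed = go n refl
      where
      go : ∀ m → m ≡ n → ∀ x → f ! x ≡ x
      -- With a single index there is no c ≠ 0, but also no map other than the identity.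
      go zero    refl x = fin1 _ x
        where
        fin1 : (a b : Fin 1) → a ≡ b
        fin1 zero zero = refl
      go (suc m) refl x = Pf (suc zero , zero , zero , x)

  -- The element of E that agrees with a below and sends each leader t to t · w t.
  extend : (N → N) → Perm → Perm
  extend w a = table λ x → if newB i x then (lead x ∙ w (lead x)) ∙ a ! (lead x \\ x) else a ! x

  module _ (w : N → N) (a : Perm {n}) where
    extend-new : ∀ {x} → New i x → extend w a ! x ≡ (lead x ∙ w (lead x)) ∙ a ! (lead x \\ x)
    extend-new {x} new = trans (lookup-table (λ x → if newB i x then (lead x ∙ w (lead x)) ∙ a ! (lead x \\ x) else a ! x) x)
      (if-true (New⇒newB new))

    extend-old : ∀ {x} → ¬ New i x → extend w a ! x ≡ a ! x
    extend-old {x} old = trans (lookup-table (λ x → if newB i x then (lead x ∙ w (lead x)) ∙ a ! (lead x \\ x) else a ! x) x)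
      (if-false (old ∘ newB⇒New))

  extend-E : ∀ {w a} → (∀ t → L t (w t)) → Aut (Prev i) a → E (extend w a)
  extend-E {w} {a} Lw Aa = record { injective = inj ; outside = out ; block = blk ; mult = mul′ }
    where
    open ≡-Reasoning
    module A = Aut Aa
    F = extend w a
    part : ∀ {x} → New i x → Prev i (lead x \\ x)
    part {x} new = L⇒Prev (~-I′ (lead~ x) (proj₁ new)) (lead~ x)
    blk : ∀ x → x ~ F ! x
    blk x = [ (λ new → ~-trans (~-sym (lead~ x)) (subst (lead x ~_) (sym (trans (extend-new w a new) (assoc _ _ _)))
                (~-∙ (L-∙ (Lw (lead x)) (Prev⇒L (~-New (~-sym (lead~ x)) new) (~-Prev (A.block (lead x \\ x)) (part new)))))))
            , (λ old → subst (x ~_) (sym (extend-old w a old)) (A.block x)) ]′ (New? i x)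
    out : ∀ {x} → ¬ I i x → F ! x ≡ x
    out x∉ = trans (extend-old w a (x∉ ∘ proj₁)) (A.outside (x∉ ∘ Prev⇒I))
    mul′ : ∀ {x u} → I i x → Prev i u → F ! (x ∙ u) ≡ F ! x ∙ F ! u
    mul′ {x} {u} x∈ u∈ = [ new-case , old-case ]′ (New? i x)
      where
      Fu : F ! u ≡ a ! u
      Fu = extend-old w a λ new → proj₂ new u∈
      t = lead x
      -- For new x the previous term is contained in `L x`, so x and x u have the same leader.
      new-case : New i x → F ! (x ∙ u) ≡ F ! x ∙ F ! u
      new-case new = begin
        F ! (x ∙ u) ≡⟨ extend-new w a (~-New x~xu new) ⟩
        (lead (x ∙ u) ∙ w (lead (x ∙ u))) ∙ a ! (lead (x ∙ u) \\ (x ∙ u))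
          ≡⟨ cong (λ t → (t ∙ w t) ∙ a ! (t \\ (x ∙ u))) (lead-cong x~xu) ⟨
        (t ∙ w t) ∙ a ! (t \\ (x ∙ u))        ≡⟨ cong (λ z → (t ∙ w t) ∙ a ! z) (\\-∙ t x u) ⟩
        (t ∙ w t) ∙ a ! ((t \\ x) ∙ u)        ≡⟨ cong ((t ∙ w t) ∙_) (A.mult (part new) u∈) ⟩
        (t ∙ w t) ∙ (a ! (t \\ x) ∙ a ! u)    ≡⟨ assoc _ _ _ ⟨
        ((t ∙ w t) ∙ a ! (t \\ x)) ∙ a ! u    ≡⟨ cong₂ _∙_ (extend-new w a new) Fu ⟨
        F ! x ∙ F ! u ∎
        where
        x~xu = ~-∙ (Prev⇒L new u∈)
      old-case : ¬ New i x → F ! (x ∙ u) ≡ F ! x ∙ F ! u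
      old-case old = [ (λ x∈′ → trans (extend-old w a (λ new → proj₂ new (Prev-∙ x∈′ u∈)))
                           (trans (A.mult x∈′ u∈) (cong₂ _∙_ (sym (extend-old w a old)) (sym Fu))))
                     , (λ x∉ → ⊥-elim (old (x∈ , x∉))) ]′ (Prev? i x)
    -- F stays inside cosets, so equal values come from one coset and involve the same leader, whose
    -- image cancels.
    inj : Injective F
    inj {x} {y} eq = [ new-case , old-case ]′ (New? i x)
      where
      x~y : x ~ y
      x~y = ~-trans (blk x) (subst (_~ y) (sym eq) (~-sym (blk y)))
      t = lead x
      old-case : ¬ New i x → x ≡ y
      old-case old = A.injective (trans (sym (extend-old w a old)) (trans eq (extend-old w a (old ∘ ~-New (~-sym x~y)))))
      new-case : New i x → x ≡ y
      new-case new = trans (sym (\\-leftDividesˡ t x)) (trans (cong (t ∙_) (A.injective (∙-cancelˡ _ _ _ same))) (\\-leftDividesˡ t y))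
        where
        same : (t ∙ w t) ∙ a ! (t \\ x) ≡ (t ∙ w t) ∙ a ! (t \\ y)
        same = trans (sym (extend-new w a new)) (trans eq (trans (extend-new w a (~-New x~y new))
          (cong (λ t → (t ∙ w t) ∙ a ! (t \\ y)) (sym (lead-cong x~y)))))

-- Generators of the bijections of a stage

module Generation {n : ℕ} (G : FiniteGroup (suc n)) (C : El n (arr (arr bool))) (flag : IsFlag G C) (i : Fin (suc n)) where
  open Stage G C flag i public

  noShift : N → N
  noShift _ = ε

  ext : Perm → Perm
  ext = extend noShift

  -- Guarding the shift by v ∈ `L z` makes every pair (z , v) admissible, so the program can loop
  -- over all of them.
  shiftAt : N → N → N → N
  shiftAt z v t = if (if lowB z v then eqB t z else false) then v else ε

  transl : N → N → Perm
  transl z v = extend (shiftAt z v) ι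

  extend-new-lead : ∀ w a x → New i x → (∀ t → L t (w t)) → (∀ y → y ~ a ! y) →
                    New i (extend w a ! x) × lead (extend w a ! x) ≡ lead x
  extend-new-lead w a x new Lw blk = ~-New x~ new , sym (lead-cong x~)
    where
    t = lead x
    t-new = ~-New (~-sym (lead~ x)) new
    x~ : x ~ extend w a ! x
    x~ = ~-trans (~-sym (lead~ x)) (subst (t ~_) (sym (trans (extend-new w a new) (assoc t (w t) (a ! (t \\ x)))))
      (~-∙ (L-∙ (Lw t) (Prev⇒L t-new (~-Prev (blk (t \\ x)) (L⇒Prev (proj₁ t-new) (lead~ x)))))))

  -- The inner map keeps the leader t and sends t u to t (v t · b u), with the second factor again
  -- in the previous term; there the outer map acts through a.
  extend-⊙ : ∀ w v a b → (∀ t → L t (v t)) → (∀ y → y ~ b ! y) → ∀ x →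
             (New i x → (extend w a ⊙ extend v b) ! x ≡ (lead x ∙ w (lead x)) ∙ a ! (v (lead x) ∙ b ! (lead x \\ x))) ×
             (¬ New i x → (extend w a ⊙ extend v b) ! x ≡ a ! (b ! x))
  extend-⊙ w v a b Lv blk x = new-case , old-case
    where
    t = lead x
    y = extend v b ! x
    new-case : New i x → (extend w a ⊙ extend v b) ! x ≡ (t ∙ w t) ∙ a ! (v t ∙ b ! (t \\ x))
    new-case new = begin
      (extend w a ⊙ extend v b) ! x          ≡⟨ ⊙-! (extend w a) (extend v b) x ⟩
      extend w a ! y                         ≡⟨ extend-new w a (proj₁ y-new) ⟩
      (lead y ∙ w (lead y)) ∙ a ! (lead y \\ y) ≡⟨ cong (λ t → (t ∙ w t) ∙ a ! (t \\ y)) (proj₂ y-new) ⟩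
      (t ∙ w t) ∙ a ! (t \\ y)               ≡⟨ cong (λ z → (t ∙ w t) ∙ a ! (t \\ z)) (trans (extend-new v b new) (assoc t (v t) (b ! (t \\ x)))) ⟩
      (t ∙ w t) ∙ a ! (t \\ (t ∙ (v t ∙ b ! (t \\ x)))) ≡⟨ cong (λ z → (t ∙ w t) ∙ a ! z) (\\-leftDividesʳ t _) ⟩
      (t ∙ w t) ∙ a ! (v t ∙ b ! (t \\ x))   ∎
      where
      open ≡-Reasoning
      y-new = extend-new-lead v b x new Lv blk
    old-case : ¬ New i x → (extend w a ⊙ extend v b) ! x ≡ a ! (b ! x)
    old-case old = trans (⊙-! (extend w a) (extend v b) x) (trans (cong (extend w a !_) (extend-old v b old))
      (extend-old w a (old ∘ ~-New (~-sym (blk x)))))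

  extend-cong : ∀ {w a f} → (∀ x → New i x → f ! x ≡ (lead x ∙ w (lead x)) ∙ a ! (lead x \\ x)) → (∀ x → ¬ New i x → f ! x ≡ a ! x) →
                f ≡ extend w a
  extend-cong {w} {a} new old = lookup-ext λ x →
    [ (λ x-new → trans (new x x-new) (sym (extend-new w a x-new))) , (λ x-old → trans (old x x-old) (sym (extend-old w a x-old))) ]′ (New? i x)

  ι-block : ∀ x → x ~ ι ! x
  ι-block x = subst (x ~_) (sym (ι-! x)) ~-refl

  ext-⊙ : ∀ a b → (∀ y → y ~ b ! y) → ext a ⊙ ext b ≡ ext (a ⊙ b)
  ext-⊙ a b blk = extend-cong {w = noShift} {a ⊙ b}
    (λ x new → trans (proj₁ (at x) new) (cong ((lead x ∙ ε) ∙_) (trans (cong (a !_) (identityˡ _)) (sym (⊙-! a b (lead x \\ x))))))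
    (λ x old → trans (proj₂ (at x) old) (sym (⊙-! a b x)))
    where at = extend-⊙ noShift noShift a b L-ε blk

  ext-ι : ext ι ≡ ι
  ext-ι = sym (extend-cong {w = noShift} {ι}
    (λ x _ → trans (ι-! x) (sym (trans (cong₂ _∙_ (identityʳ (lead x)) (ι-! (lead x \\ x))) (\\-leftDividesˡ (lead x) x))))
    (λ x _ → refl))

  Aut-ι : ∀ X → Aut X ι
  Aut-ι X = record
    { injective = E.injective E-ι ; outside = λ {x} _ → ι-! x ; block = ι-block
    ; mult = λ {x} {u} _ _ → trans (ι-! (x ∙ u)) (sym (cong₂ _∙_ (ι-! x) (ι-! u))) }

  shiftAt-L : ∀ z v t → L t (shiftAt z v t)
  shiftAt-L z v t = [ yes-case , no-case ]′ (true-or-not cond)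
    where
    cond = if lowB z v then eqB t z else false
    yes-case : cond ≡ true → L t (shiftAt z v t)
    yes-case c = let low , t≡z = and-elim {lowB z v} c in
      subst (L t) (sym (if-true c)) (subst (λ t → L t v) (sym (eqB-sound {i = t} {z} t≡z)) (lowB⇒L low))
    no-case : ¬ cond ≡ true → L t (shiftAt z v t)
    no-case ¬c = subst (L t) (sym (if-false ¬c)) (L-ε t)

  transl-E : ∀ z v → E (transl z v)
  transl-E z v = extend-E (shiftAt-L z v) (Aut-ι (Prev i))

  extV : Perm → Perm
  extV a = eval extE (g , g , ι , i , a , tt)

  opaque
    unfolding extE

    extV≡ : ∀ a → extV a ≡ ext a
    extV≡ a = extend-cong {w = noShift} {a}
      (λ x new → trans (at x) (trans (if-true (New⇒newB new)) (trans (mul≡ _ _)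
        (cong₂ _∙_ (trans (ι-! (lead x)) (sym (identityʳ (lead x)))) (cong (a !_) (ldiv≡ (lead x) x))))))
      (λ x old → trans (at x) (if-false (old ∘ newB⇒New)))
      where
      body : N → N
      body x = if newB i x then mul (ι ! lead x) (a ! ldiv (lead x) x) else a ! x
      at : ∀ x → extV a ! x ≡ body x
      at = lookup-table body

  translV : N → N → Perm
  translV z v = eval transE (g , z , v , i , tt)

  opaque
    unfolding transE

    translV≡ : ∀ z v → translV z v ≡ transl z v
    translV≡ z v = extend-cong {w = shiftAt z v} {ι} new-case
      (λ x old → trans (at x) (trans (if-false (λ c → old (newB⇒New (proj₁ (and-elim {newB i x} c))))) (sym (ι-! x))))
      where
      cond : N → Bool
      cond t = if lowB z v then eqB t z else false
      body : N → N
      body x = if (if newB i x then cond (lead x) else false) then mul (mul z v) (ldiv z x) else x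
      at : ∀ x → translV z v ! x ≡ body x
      at = lookup-table body
      new-case : ∀ x → New i x → translV z v ! x ≡ (lead x ∙ shiftAt z v (lead x)) ∙ ι ! (lead x \\ x)
      new-case x new = [ yes-case , no-case ]′ (true-or-not (cond (lead x)))
        where
        yes-case : cond (lead x) ≡ true → translV z v ! x ≡ (lead x ∙ shiftAt z v (lead x)) ∙ ι ! (lead x \\ x)
        yes-case c = trans (at x) (trans (if-true (and-intro (New⇒newB new) c)) (trans (mul≡ (mul z v) _)
          (trans (cong₂ _∙_ (mul≡ z v) (ldiv≡ z x))
          (trans (cong (λ t → (t ∙ v) ∙ (t \\ x)) (sym (eqB-sound {i = lead x} {z} (proj₂ (and-elim {lowB z v} c)))))
            (cong₂ (λ s u → (lead x ∙ s) ∙ u) (sym (if-true c)) (sym (ι-! (lead x \\ x))))))))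
        no-case : ¬ cond (lead x) ≡ true → translV z v ! x ≡ (lead x ∙ shiftAt z v (lead x)) ∙ ι ! (lead x \\ x)
        no-case ¬c = trans (at x) (trans (if-false (¬c ∘ proj₂ ∘ and-elim {newB i x})) (sym (trans
          (cong₂ (λ s u → (lead x ∙ s) ∙ u) (if-false ¬c) (ι-! (lead x \\ x)))
          (trans (cong (_∙ (lead x \\ x)) (identityʳ (lead x))) (\\-leftDividesˡ (lead x) x)))))

  -- E is generated by the extensions of automorphisms and the translations:
  -- f agrees below with an automorphism a, and f ∘ (ext a)⁻¹ is a product of
  -- translations, one for each leader.
  module _ (Q : Perm {n} → Set) (Q-ι : Q ι) (Q-⊙ : ∀ {f h} → Q f → Q h → Q (f ⊙ h))
           (Q-ext : ∀ {a} → Aut (Prev i) a → Q (ext a)) (Q-transl : ∀ z v → Q (transl z v)) where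

    Q-shift : ∀ w → (∀ t → L t (w t)) → Q (extend w ι)
    Q-shift w Lw = subst Q (extend-cong {w = w} {ι}
        (λ x new → trans (extend-new (part (suc n)) ι new) (cong (λ s → (lead x ∙ s) ∙ ι ! (lead x \\ x)) (part-in (suc n) (lead x) (Finₚ.toℕ<n (lead x)))))
        (λ x old → extend-old (part (suc n)) ι old)) (go (suc n) ℕₚ.≤-refl)
      where
      when : ∀ {A : Set} → Dec A → N → N
      when (yes _) x = x
      when (no _)  x = ε

      -- The shift cut off at index k. Composing with the translation at k raises the cut by one.
      part : ℕ → N → N
      part k t = when (toℕ t ℕₚ.<? k) (w t)

      part-in : ∀ k t → toℕ t < k → part k t ≡ w t
      part-in k t lt with toℕ t ℕₚ.<? k
      ... | yes _ = refl
      ... | no ¬lt = ⊥-elim (¬lt lt)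

      part-out : ∀ k t → ¬ toℕ t < k → part k t ≡ ε
      part-out k t ¬lt with toℕ t ℕₚ.<? k
      ... | yes lt = ⊥-elim (¬lt lt)
      ... | no _ = refl

      part-L : ∀ k t → L t (part k t)
      part-L k t = [ (λ lt → subst (L t) (sym (part-in k t lt)) (Lw t))
                   , (λ ge → subst (L t) (sym (part-out k t (ℕₚ.≤⇒≯ ge))) (L-ε t)) ]′ (ℕₚ.<-≤-connex (toℕ t) k)

      part-suc : ∀ k z → toℕ z ≡ k → ∀ t → shiftAt z (w z) t ∙ part k t ≡ part (suc k) t
      part-suc k z refl t with t Finₚ.≟ z
      ... | yes refl = trans (cong₂ _∙_ (if-true (and-intro (L⇒lowB (Lw z)) (eqB-refl z))) (part-out k t (ℕₚ.<-irrefl refl)))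
                         (trans (identityʳ (w t)) (sym (part-in (suc k) t ℕₚ.≤-refl)))
      ... | no t≢z = trans (cong (_∙ part k t) (if-false (λ c → t≢z (eqB-sound {i = t} {z} (proj₂ (and-elim {lowB z (w z)} c))))))
                       (trans (identityˡ _) ([ below-case , above-case ]′ (ℕₚ.<-≤-connex (toℕ t) k)))
        where
        below-case : toℕ t < k → part k t ≡ part (suc k) t
        below-case lt = trans (part-in k t lt) (sym (part-in (suc k) t (ℕₚ.m≤n⇒m≤1+n lt)))
        above-case : k ≤ toℕ t → part k t ≡ part (suc k) t
        above-case ge = trans (part-out k t (ℕₚ.≤⇒≯ ge)) (sym (part-out (suc k) t λ { (s≤s le) → t≢z (Finₚ.toℕ-injective (ℕₚ.≤-antisym le ge)) }))

      go : ∀ k → k ≤ suc n → Q (extend (part k) ι)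
      go zero    _  = subst Q (trans (sym ext-ι) (extend-cong {w = part 0} {ι} (λ x new → extend-new noShift ι new) (λ x old → extend-old noShift ι old))) Q-ι
      go (suc k) lt = subst Q (extend-cong {w = part (suc k)} {ι}
          (λ x new → trans (proj₁ (at x) new) (shifted x))
          (λ x old → trans (proj₂ (at x) old) (ι-! (ι ! x))))
          (Q-⊙ (Q-transl z (w z)) (go k (ℕₚ.<⇒≤ lt)))
        where
        z = Fin.fromℕ< lt
        at = extend-⊙ (shiftAt z (w z)) (part k) ι ι (part-L k) ι-block
        shifted : ∀ x → (lead x ∙ shiftAt z (w z) (lead x)) ∙ ι ! (part k (lead x) ∙ ι ! (lead x \\ x)) ≡
                        (lead x ∙ part (suc k) (lead x)) ∙ ι ! (lead x \\ x)
        shifted x = begin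
          (t ∙ s) ∙ ι ! (part k t ∙ ι ! u)   ≡⟨ cong ((t ∙ s) ∙_) (ι-! (part k t ∙ ι ! u)) ⟩
          (t ∙ s) ∙ (part k t ∙ ι ! u)       ≡⟨ assoc (t ∙ s) (part k t) (ι ! u) ⟨
          ((t ∙ s) ∙ part k t) ∙ ι ! u       ≡⟨ cong (_∙ ι ! u) (assoc t s (part k t)) ⟩
          (t ∙ (s ∙ part k t)) ∙ ι ! u       ≡⟨ cong (λ r → (t ∙ r) ∙ ι ! u) (part-suc k z (Finₚ.toℕ-fromℕ< lt) t) ⟩
          (t ∙ part (suc k) t) ∙ ι ! u       ∎
          where
          open ≡-Reasoning
          t = lead x
          u = t \\ x
          s = shiftAt z (w z) t

    generates : ∀ {f} → E f → Q f
    generates {f} Ef = subst Q product (Q-⊙ (Q-shift w Lw) (Q-ext A))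
      where
      module F = E Ef
      w : N → N
      w t = t \\ (f ! t)
      Lw : ∀ t → L t (w t)
      Lw t = F.block t
      a : Perm
      a = table λ x → if prevB i x then f ! x else x
      a-in : ∀ {x} → Prev i x → a ! x ≡ f ! x
      a-in {x} p = trans (lookup-table (λ x → if prevB i x then f ! x else x) x) (if-true (Prev⇒prevB p))
      a-out : ∀ {x} → ¬ Prev i x → a ! x ≡ x
      a-out {x} ¬p = trans (lookup-table (λ x → if prevB i x then f ! x else x) x) (if-false (¬p ∘ prevB⇒Prev))
      a-block : ∀ x → x ~ a ! x
      a-block x = [ (λ p → subst (x ~_) (sym (a-in p)) (F.block x)) , (λ ¬p → subst (x ~_) (sym (a-out ¬p)) ~-refl) ]′ (Prev? i x)
      A : Aut (Prev i) a
      A = record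
        { injective = λ {x} {y} eq → [ (λ p → F.injective (trans (sym (a-in p)) (trans eq (a-in (~-Prev (x~y eq) p)))))
                                     , (λ ¬p → trans (sym (a-out ¬p)) (trans eq (a-out (¬p ∘ ~-Prev (~-sym (x~y eq)))))) ]′ (Prev? i x)
        ; outside = a-out
        ; block = a-block
        ; mult = λ p q → trans (a-in (Prev-∙ p q)) (trans (F.mult (Prev⇒I p) q) (sym (cong₂ _∙_ (a-in p) (a-in q))))
        }
        where
        x~y : ∀ {x y} → a ! x ≡ a ! y → x ~ y
        x~y {x} {y} eq = ~-trans (a-block x) (subst (_~ y) (sym eq) (~-sym (a-block y)))
      at = extend-⊙ w noShift ι a L-ε a-block
      product : extend w ι ⊙ ext a ≡ f
      product = lookup-ext λ x → [ new-case x , old-case x ]′ (New? i x)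
        where
        open ≡-Reasoning
        new-case : ∀ x → New i x → (extend w ι ⊙ ext a) ! x ≡ f ! x
        new-case x new = begin
          (extend w ι ⊙ ext a) ! x              ≡⟨ proj₁ (at x) new ⟩
          (t ∙ w t) ∙ ι ! (ε ∙ a ! u)           ≡⟨ cong ((t ∙ w t) ∙_) (trans (ι-! (ε ∙ a ! u)) (identityˡ (a ! u))) ⟩
          (t ∙ w t) ∙ a ! u                     ≡⟨ cong₂ _∙_ (\\-leftDividesˡ t (f ! t)) (a-in u∈) ⟩
          f ! t ∙ f ! u                         ≡⟨ F.mult t∈ u∈ ⟨
          f ! (t ∙ u)                           ≡⟨ cong (f !_) (\\-leftDividesˡ t x) ⟩
          f ! x ∎
          where
          t = lead x
          u = t \\ x
          t∈ : I i t
          t∈ = ~-I′ (lead~ x) (proj₁ new)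
          u∈ : Prev i u
          u∈ = L⇒Prev t∈ (lead~ x)
        old-case : ∀ x → ¬ New i x → (extend w ι ⊙ ext a) ! x ≡ f ! x
        old-case x old = trans (proj₂ (at x) old) (trans (ι-! (a ! x)) ([ a-in , out ]′ (Prev? i x)))
          where
          out : ¬ Prev i x → a ! x ≡ f ! x
          out ¬p = trans (a-out ¬p) (sym (F.outside λ x∈ → old (x∈ , ¬p)))

-- The table of coset representatives of a stage

module Tables {n : ℕ} (G : FiniteGroup (suc n)) (C : El n (arr (arr bool))) (flag : IsFlag G C) (i : Fin (suc n)) where
  open Generation G C flag i public

  reduce : Table → Key → Perm → Perm
  reduce T k f = eval reduceE (T , g , g , i , k , f , tt)

  opaque
    unfolding reduceE

    reduce-form : ∀ T k f → ∃ λ s → reduce T k f ≡ f ⊙ inv (get T (s , k))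
    reduce-form T k f = _ , refl

    reduce-complete : ∀ T k f s → test k (f ⊙ inv (get T (s , k))) ≡ true → test k (reduce T k f) ≡ true
    reduce-complete T k f s = findB-sat {f = λ s → test k (f ⊙ inv (get T (s , k)))} (slot k f) s

  keys : List Key
  keys = tuples 3

  module S = Sifting _⊙_ ι inv ⊙-assoc ⊙-idˡ ⊙-idʳ _≟ₚ_ E E-ι E-∙ E-inv
    (λ {f} Ef → ⊙-inverseˡ {f = f} (E.injective Ef)) (λ {f} Ef → ⊙-inverseʳ {f = f} (E.injective Ef))
    P P-ι P-∙ P-inv (_≺_ {k = 3}) (λ {k} → ≺-irrefl 3 {k}) (λ {k} {l} {m} → ≺-trans 3 {k} {l} {m})
    keys (tuples-sorted 3) (∈-tuples 3) test slot
    test-complete test-sound slot-sound end get set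
    (λ T p f → lookup-updT 4 {PERM} T p f) (λ T p f q → lookup-updT-≢ 4 {PERM} T p f q) (_≟ₜ_ {k = 4})
    (tuples 4) (∈-tuples 4) reduce reduce-form reduce-complete

  insertV : Table → Perm → Table
  insertV T f = eval insertE (T , f , g , i , tt)

  opaque
    unfolding insertE siftE stepE

    insertV≡ : ∀ T f → insertV T f ≡ S.insert T f
    insertV≡ T f = cong proj₁ (trans (eval-foldTup {n} 3 (call stepE (var v0 ∷ var v1 ∷ var v4 ∷ var v4 ∷ var v5 ∷ [])) (pair (var v0) (pair (var v1) fls)) (T , f , g , i , tt))
      (Listₚ.foldl-cong {f = λ st k → eval stepE (st , k , g , g , i , tt)} stepV≡ (T , f , false) keys))
      where
      stepV≡ : ∀ st k → eval stepE (st , k , g , g , i , tt) ≡ S.step st k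
      stepV≡ (T , f , d) k = cong (λ T′ → if d then (T , f , d) else
          (if test k (reduce T k f) then (T , reduce T k f , false) else (T′ , f , true)))
        (eval-updT 4 {PERM} T (slot k f , k) f)

  module _ (old : Table) where
    -- Only the old slots with c ≠ 0 are known to hold automorphisms of the previous term; at the
    -- others the identity is extended.
    oldExt : N × Key → Perm
    oldExt (s , k) = extV (if (if zero {n = n} <ᵇ proj₁ k then false else true) then ι else get old (s , k))

    items : Table → N × Key → N × Key → Table
    items T p q = eval itemsE (T , p , q , old , g , i , tt)

    opaque
      unfolding itemsE

      items≡ : ∀ T p q → items T p q ≡ S.insert (S.insert (S.insert T (get T p ⊙ get T q)) (oldExt p)) (translV (proj₁ p) (proj₁ q))
      items≡ T p q = trans (insertV≡ _ (translV (proj₁ p) (proj₁ q))) (cong (λ T → S.insert T (translV (proj₁ p) (proj₁ q)))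
       (trans (insertV≡ _ (oldExt p)) (cong (λ T → S.insert T (oldExt p)) (insertV≡ T (get T p ⊙ get T q)))))

    roundV : Table → Table
    roundV T = eval roundE (T , old , g , i , tt)

    opaque
      unfolding roundE

      roundV≡ : ∀ T → roundV T ≡ foldl (λ T p → foldl (λ T q → items T p q) T (tuples 4)) T (tuples 4)
      roundV≡ T = trans (eval-foldTup {n} 4 inner (var v0) (T , old , g , i , tt))
        (Listₚ.foldl-cong (λ T′ p → eval-foldTup {n} 4 body (var v0) (T′ , p , T , old , g , i , tt)) T (tuples 4))
        where
        body : Exp (TAB ∷ tup 4 ∷ TAB ∷ tup 4 ∷ TAB ∷ TAB ∷ GRP ∷ ix ∷ []) TAB
        body = call itemsE (var v0 ∷ var v3 ∷ var v1 ∷ var v5 ∷ var v6 ∷ var v7 ∷ [])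
        inner : Exp (TAB ∷ tup 4 ∷ TAB ∷ TAB ∷ GRP ∷ ix ∷ []) TAB
        inner = foldTupE 4 body (var v0)

    closeV : Table
    closeV = eval closeE (old , g , i , tt)

    opaque
      unfolding closeE

      closeV≡ : closeV ≡ foldl (λ T _ → roundV T) emptyV (tuples {n} 4)
      closeV≡ = eval-foldTup {n} 4 (call roundE (var v0 ∷ var v2 ∷ var v3 ∷ var v4 ∷ [])) (call (constTE 4 idE) []) (old , g , i , tt)

  Aut⇒E : ∀ {a} → Aut (I i) a → E a
  Aut⇒E Aa = record { injective = A.injective ; outside = A.outside ; block = A.block ; mult = λ x∈ u∈ → A.mult x∈ (Prev⇒I u∈) }
    where module A = Aut Aa

  Aut⇒P : ∀ {a} j y x → Aut (I i) a → P (zero , j , y , x) a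
  Aut⇒P j y x Aa _ x∈ y∈ x~ y~ = Aut.mult Aa (~-I x~ x∈) (~-I y~ y∈)

  E⇒Aut : ∀ {f} → E f → (∀ j y x → P (zero , j , y , x) f) → Aut (I i) f
  E⇒Aut Ef Pf = record { injective = F.injective ; outside = F.outside ; block = F.block
    ; mult = λ {x} {u} x∈ u∈ → Pf i u x x∈ x∈ u∈ ~-refl ~-refl }
    where module F = E Ef

  keysAt : N → List Key
  keysAt c = List.map (c ,_) (tuples {n} 2)

  -- The keys with c = 0 come first, so `S.D keys₁` consists of the bijections that are
  -- multiplicative on the whole term: its automorphisms.
  keys₀ keys₁ : List Key
  keys₀ = keysAt zero
  keys₁ = List.concatMap keysAt (List.tabulate {n = n} suc)

  keys-split : keys ≡ keys₀ ++ keys₁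
  keys-split = cong (List.concatMap keysAt) (indices≡ n)

  keys₁-suc : ∀ {c k} → (c , k) ∈ₗ keys₁ → ∃ λ c′ → c ≡ suc c′
  keys₁-suc k∈ with Anyₚ.tabulate⁻ {n = n} {f = suc} (∈ₚ.∈-concatMap⁻ keysAt {xs = List.tabulate suc} k∈)
  ... | c′ , k∈′ with ∈ₚ.∈-map⁻ (suc c′ ,_) k∈′
  ...   | _ , _ , refl = c′ , refl

  module _ {old : Table} (gen : Generates (Prev i) old) where

    oldExt-E : ∀ p → E (oldExt old p)
    oldExt-E (s , zero  , k) = subst E (sym (extV≡ ι)) (extend-E L-ε (Aut-ι (Prev i)))
    oldExt-E (s , suc c , k) = subst E (sym (extV≡ (get old (s , suc c , k)))) (extend-E L-ε (Generates.sound gen s c k))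

    translV-E : ∀ z v → E (translV z v)
    translV-E z v = subst E (sym (translV≡ z v)) (transl-E z v)

    Items : N × Key → N × Key → Table → Set
    Items p q T = (S.Π T keys (get T p ⊙ get T q) × S.Π T keys (oldExt old p)) × S.Π T keys (translV (proj₁ p) (proj₁ q))

    items-progress : ∀ p q {T} → S.Good T → S.Progress (Items p q) T (items old T p q)
    items-progress p q {T} good = subst (S.Progress (Items p q) T) (sym (items≡ old T p q)) thrice
      where
      T₁ T₂ T₃ : Table
      T₁ = S.insert T (get T p ⊙ get T q)
      T₂ = S.insert T₁ (oldExt old p)
      T₃ = S.insert T₂ (translV (proj₁ p) (proj₁ q))
      Q₁ Q₂ Q₃ : Table → Set
      Q₁ T = S.Π T keys (get T p ⊙ get T q)
      Q₂ T = S.Π T keys (oldExt old p)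
      Q₃ T = S.Π T keys (translV (proj₁ p) (proj₁ q))
      once : S.Progress Q₁ T T₁
      once = S.insert-progress {T} {get T p ⊙ get T q} good (E-∙ (proj₁ (good (proj₁ p) (proj₂ p))) (proj₁ (good (proj₁ q) (proj₂ q))))
      twice : S.Progress (λ T → Q₁ T × Q₂ T) T T₂
      twice = S.progress-then {Q₁} {Q₂} {T} {T₁} {T₂} once (λ good′ → S.insert-progress {T₁} {oldExt old p} good′ (oldExt-E p))
      thrice : S.Progress (λ T → (Q₁ T × Q₂ T) × Q₃ T) T T₃
      thrice = S.progress-then {λ T → Q₁ T × Q₂ T} {Q₃} {T} {T₂} {T₃} twice
        (λ good′ → S.insert-progress {T₂} {translV (proj₁ p) (proj₁ q)} good′ (translV-E (proj₁ p) (proj₁ q)))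

    AllItems : Table → Set
    AllItems T = ∀ {p} → p ∈ₗ tuples 4 → ∀ {q} → q ∈ₗ tuples 4 → Items p q T

    round-progress : ∀ {T} → S.Good T → S.Progress AllItems T (roundV old T)
    round-progress {T} good = subst (S.Progress AllItems T) (sym (roundV≡ old T))
      (S.progress-foldl {Q = λ p T → ∀ {q} → q ∈ₗ tuples 4 → Items p q T} (λ T p → foldl (λ T q → items old T p q) T (tuples 4))
        (λ p good → S.progress-foldl {Q = Items p} (λ T q → items old T p q) (λ q good → items-progress p q good) (tuples 4) good) (tuples 4) good)

    empty-good : S.Good (emptyV)
    empty-good s k rewrite lookup-constT {n} 4 {PERM} idE (s , k) = E-ι , (λ {l} _ → P-ι l) , inj₁ refl

    closed-table : S.Good (closeV old) × AllItems (closeV old)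
    closed-table = subst (λ T → S.Good T × AllItems T) (sym (closeV≡ old))
      (S.saturate {Q = AllItems} (roundV old) round-progress (tuples {n} 4) empty-good refl)

  module _ {old T : Table} (gen : Generates (Prev i) old) (good : S.Good T) (all : AllItems gen T) where

    private
      pairs : ∀ p q → S.Π T keys (get T p ⊙ get T q)
      pairs p q = proj₁ (proj₁ (all (∈-tuples 4 p) (∈-tuples 4 q)))

      module Cl = S.Closed good pairs

    -- Normal forms are closed under products, and a saturated table gives normal forms to the
    -- generators of `E`.
    E⇒Π : ∀ {f} → E f → S.Π T keys f
    E⇒Π = generates (S.Π T keys) (Cl.Π-ι keys) Cl.Π-∙ ext-Π
        -- Translations were inserted according to the first coordinates of the two slots, so zeros
        -- complete z and v to suitable slots.
        (λ z v → subst (S.Π T keys) (translV≡ z v) (proj₂ (all (∈-tuples 4 (z , zero , zero , zero , zero)) (∈-tuples 4 (v , zero , zero , zero , zero)))))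
      where
      ext-Π : ∀ {a} → Aut (Prev i) a → S.Π T keys (ext a)
      -- Preservation of cosets is carried through the induction because `ext-⊙` asks for it in the
      -- right factor.
      ext-Π Aa = proj₂ (Generates.complete gen (λ a → (∀ x → x ~ a ! x) × S.Π T keys (ext a))
        (ι-block , subst (S.Π T keys) (sym ext-ι) (Cl.Π-ι keys))
        (λ {f} {h} (f~ , πf) (h~ , πh) → (λ x → subst (x ~_) (sym (⊙-! f h x)) (~-trans (h~ x) (f~ (h ! x)))) ,
           subst (S.Π T keys) (ext-⊙ f h h~) (Cl.Π-∙ πf πh))
        (λ s c k → Aut.block (Generates.sound gen s c k) ,
           subst (S.Π T keys) (extV≡ (get old (s , suc c , k))) (proj₂ (proj₁ (all (∈-tuples 4 (s , suc c , k)) (∈-tuples 4 (s , suc c , k))))))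
        Aa)

    -- In the normal form of f the factors of keys before k are trivial. The entry of key k can thus
    -- be divided off on the right, which leaves a product of later entries. So some slot always
    -- reduces f.
    E⇒slot : ∀ {k} l r → keys ≡ l ++ k ∷ r → ∀ {f} → S.D (k ∷ r) f → ∃ λ s → S.D r (f ⊙ inv (get T (s , k)))
    E⇒slot {k} l r split {f} Df = s , subst (S.D r) (sym (trans (cong (_⊙ inv (get T (s , k))) f≡) (S.cancel′ p (proj₁ (good s k))))) (Cl.Π⇒D π)
      where
      factors : ∃₂ λ p s → S.Π T r p × f ≡ p ⊙ get T (s , k)
      factors = Cl.Π-split (Cl.peel-++ l (subst S.Final split S.final-ks) Df (subst (λ ks → S.Π T ks f) split (E⇒Π (proj₁ Df))))
      p = proj₁ factors
      s = proj₁ (proj₂ factors)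
      π = proj₁ (proj₂ (proj₂ factors))
      f≡ = proj₂ (proj₂ (proj₂ factors))

    -- The normal form of an automorphism has trivial factors at all keys with c = 0, so it is a
    -- product of entries with c ≠ 0.
    table-generates : Generates (I i) T
    table-generates = record
      { sound    = λ s c k → let Eτ , Pτ , _ = good s (suc c , k) in E⇒Aut Eτ (λ j y x → Pτ {zero , j , y , x} (inj₁ z<s))
      ; complete = λ Q Qι Q⊙ Qslot {a} Aa → S.Π-elim Q Qι Q⊙ (Q-slot Q Qslot)
                     (Cl.peel-++ keys₀ (subst S.Final keys-split S.final-ks) (Aut⇒E Aa , precedes Aa)
                       (subst (λ ks → S.Π T ks _) keys-split (E⇒Π (Aut⇒E Aa))))
      }
      where
      Q-slot : ∀ (Q : Perm → Set) → (∀ s c k → Q (get T (s , suc c , k))) → ∀ {k} → k ∈ₗ keys₁ → ∀ s → Q (get T (s , k))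
      Q-slot Q Qslot {c , k} k∈ s with keys₁-suc k∈
      ... | c′ , refl = Qslot s c′ k
      precedes : ∀ {a} → Aut (I i) a → ∀ k → S.Precedes k keys₁ → P k a
      precedes Aa (zero  , j , y , x) _ = Aut⇒P j y x Aa
      precedes Aa (suc c , k) k≺ = ⊥-elim (≺-irrefl 3 {suc c , k} (k≺ ∈keys₁))
        where
        ∈keys₁ : (suc c , k) ∈ₗ keys₁
        ∈keys₁ = ∈ₚ.∈-concatMap⁺ keysAt
          (Anyₚ.tabulate⁺ c (∈ₚ.∈-map⁺ (suc c ,_) (∈-tuples 2 k)))

-- Isomorphisms of flags, and sifting maps into another group

record FlagIso {n : ℕ} (G : FiniteGroup (suc n)) (C : El n (arr (arr bool))) (H : FiniteGroup (suc n)) (C′ : El n (arr (arr bool))) : Set where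
  private
    module G = FiniteGroup G
    module H = FiniteGroup H
  field
    φ          : Fin (suc n) → Fin (suc n)
    homo       : ∀ x y → φ (x G.∙ y) ≡ φ x H.∙ φ y
    injective  : ∀ {x y} → φ x ≡ φ y → x ≡ y
    surjective : ∀ y → ∃ λ x → φ x ≡ y
    to         : ∀ {i x} → In C i x → In C′ i (φ x)
    from       : ∀ {i x} → In C′ i (φ x) → In C i x

module _ {n : ℕ} {G : FiniteGroup (suc n)} {C : El n (arr (arr bool))} {H : FiniteGroup (suc n)} {C′ : El n (arr (arr bool))}
         (iso : FlagIso G C H C′) where
  open FlagIso iso
  private
    module G = Group (FiniteGroup.group G)
    module H = Group (FiniteGroup.group H)

  φ-ε : φ G.ε ≡ H.ε
  φ-ε = GroupProperties.∙-cancelˡ (FiniteGroup.group H) (φ G.ε) (φ G.ε) H.ε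
    (trans (sym (homo G.ε G.ε)) (trans (cong φ (G.identityˡ G.ε)) (sym (H.identityʳ (φ G.ε)))))

-- The maps ψ : G → H of the algorithm are compared with an isomorphism φ:
-- ψ = φ ∘ f on the part of G treated so far, for some automorphism f.
module Guided {n : ℕ} (G : FiniteGroup (suc n)) (C : El n (arr (arr bool))) (flag : IsFlag G C)
              (H : FiniteGroup (suc n)) (C′ : El n (arr (arr bool))) (flag′ : IsFlag H C′) (iso : FlagIso G C H C′)
              (θ : Perm {n}) (υ : Fin (suc n) → Fin (suc n))
              (θ≡ : ∀ x → lookup θ (Flagged.lead G C flag x) ≡ FlagIso.φ iso (υ (Flagged.lead G C flag x)))
              (~υ : ∀ x → Flagged._~_ G C flag (Flagged.lead G C flag x) (υ (Flagged.lead G C flag x))) where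

  module H′ = Flagged H C′ flag′
  open FlagIso iso

  module AtStage (i : Fin (suc n)) where
    open Tables G C flag i

    Rel : (N → Set) → Perm → Perm → Set
    Rel X ψ f = ∀ {x} → X x → ψ ! x ≡ φ (f ! x)

    extH : Perm → Perm
    extH ψ = eval extE (g , H′.g , θ , i , ψ , tt)

    -- The guess sends the leader t to φ (υ t); pulled back along φ, this moves t by t⁻¹ υ t inside
    -- its coset.
    shift : N → N
    shift x = lead x \\ υ (lead x)

    shift-L : ∀ x → L x (shift x)
    shift-L x = ~-L (lead~ x) (~υ x)

    opaque
      unfolding extE

      extH-! : ∀ ψ x → extH ψ ! x ≡ (if newB i x then H′.mul (θ ! lead x) (ψ ! ldiv (lead x) x) else ψ ! x)
      extH-! ψ = lookup-table λ x → if newB i x then H′.mul (θ ! lead x) (ψ ! ldiv (lead x) x) else ψ ! x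

    lead-idem : ∀ x → lead (lead x) ≡ lead x
    lead-idem x = lead-cong (lead~ x)

    extH-Rel : ∀ {ψ a} → Aut (Prev i) a → Rel (Prev i) ψ a → Rel (I i) (extH ψ) (extend shift a)
    extH-Rel {ψ} {a} Aa rel {x} x∈ = [ new-case , old-case ]′ (New? i x)
      where
      open ≡-Reasoning
      t = lead x
      new-case : New i x → extH ψ ! x ≡ φ (extend shift a ! x)
      new-case new = begin
        extH ψ ! x                                ≡⟨ trans (extH-! ψ x) (if-true (New⇒newB new)) ⟩
        H′.mul (θ ! t) (ψ ! ldiv t x)             ≡⟨ H′.mul≡ (θ ! t) (ψ ! ldiv t x) ⟩
        (θ ! t) H′.∙ (ψ ! ldiv t x)               ≡⟨ cong₂ H′._∙_ (θ≡ x) (trans (cong (ψ !_) (ldiv≡ t x)) (rel u∈)) ⟩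
        φ (υ t) H′.∙ φ (a ! (t \\ x))             ≡⟨ homo (υ t) (a ! (t \\ x)) ⟨
        φ (υ t ∙ a ! (t \\ x))                    ≡⟨ cong (λ s → φ (s ∙ a ! (t \\ x))) (\\-leftDividesˡ t (υ t)) ⟨
        φ ((t ∙ (t \\ υ t)) ∙ a ! (t \\ x))       ≡⟨ cong (λ r → φ ((t ∙ (r \\ υ r)) ∙ a ! (t \\ x))) (lead-idem x) ⟨
        φ ((t ∙ shift t) ∙ a ! (t \\ x))          ≡⟨ cong φ (extend-new shift a new) ⟨
        φ (extend shift a ! x)                    ∎
        where
        u∈ : Prev i (t \\ x)
        u∈ = L⇒Prev (~-I′ (lead~ x) x∈) (lead~ x)
      old-case : ¬ New i x → extH ψ ! x ≡ φ (extend shift a ! x)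
      old-case old = trans (extH-! ψ x) (trans (if-false (old ∘ newB⇒New)) (trans
        ([ rel , (λ x∉ → ⊥-elim (old (x∈ , x∉))) ]′ (Prev? i x)) (cong φ (sym (extend-old shift a old)))))

    testH : Key → Perm → Bool
    testH k ψ = eval testE (g , H′.g , i , k , ψ , tt)

    module _ {ψ f} (rel : Rel (I i) ψ f) where
      private
        product : ∀ {x y} → I i x → I i y → ψ ! mul x y ≡ φ (f ! (x ∙ y)) × H′.mul (ψ ! x) (ψ ! y) ≡ φ (f ! x ∙ f ! y)
        product {x} {y} x∈ y∈ = trans (cong (ψ !_) (mul≡ x y)) (rel (∙-in i x∈ y∈)) ,
          trans (H′.mul≡ (ψ ! x) (ψ ! y)) (trans (cong₂ H′._∙_ (rel x∈) (rel y∈)) (sym (homo (f ! x) (f ! y))))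

      opaque
        unfolding testE

        -- Since φ is an injective homomorphism, ψ = φ ∘ f is multiplicative at a pair exactly when
        -- f is; the unknown f is tested through ψ.
        MultAt⇒testH : ∀ {j y x} → (I j x → I i x → I i y → MultAt f x y) → testH (zero , j , y , x) ψ ≡ true
        MultAt⇒testH {j} {y} {x} m = [ holds , if-false ]′ (true-or-not (condB j y x))
          where
          holds : condB j y x ≡ true → testH (zero , j , y , x) ψ ≡ true
          holds c =
            let x∈ , c′ = and-elim {inB j x} c
                x∈′ , y∈ = and-elim {inB i x} c′
                l , r = product x∈′ y∈
            in trans (if-true c) (eqB-complete (trans l (trans (cong φ (m x∈ x∈′ y∈)) (sym r))))

        testH⇒MultAt : ∀ {j y x} → testH (zero , j , y , x) ψ ≡ true → I j x → I i x → I i y → MultAt f x y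
        testH⇒MultAt t x∈ x∈′ y∈ = let l , r = product x∈′ y∈ in
          injective (trans (sym l) (trans (eqB-sound (trans (sym (if-true (and-intro x∈ (and-intro x∈′ y∈)))) t)) r))

    MultAt⇒P : ∀ {j y x f} → E f → (∀ {l} → l ≺ (zero , j , y , x) → P l f) → (I j x → I i x → I i y → MultAt f x y) →
               P (zero , j , y , x) f
    MultAt⇒P Ef Pf m x∈ x∈′ y∈ = spread Ef x∈′ y∈ (below Ef x∈ x∈′ y∈ Pf) ~-refl ~-refl (m x∈ x∈′ y∈)

    stepH : Table × Perm × Bool → El n (tup 2) → Table × Perm × Bool
    stepH st k = eval stepE (st , (zero , k) , g , H′.g , i , tt)

    reduceH : Table → Key → Perm → Perm
    reduceH T k ψ = eval reduceE (T , g , H′.g , i , k , ψ , tt)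

    opaque
      unfolding stepE

      stepH-passes : ∀ T ψ k → testH (zero , k) (reduceH T (zero , k) ψ) ≡ true →
                     stepH (T , ψ , false) k ≡ (T , reduceH T (zero , k) ψ , false)
      stepH-passes T ψ k t = if-true t

    opaque
      unfolding reduceE

      reduceH-form : ∀ T k ψ → ∃ λ s → reduceH T k ψ ≡ ψ ⊙ inv (get T (s , k))
      reduceH-form T k ψ = _ , refl

      reduceH-complete : ∀ T k ψ s → testH k (ψ ⊙ inv (get T (s , k))) ≡ true → testH k (reduceH T k ψ) ≡ true
      reduceH-complete T k ψ s = findB-sat {f = λ s → testH k (ψ ⊙ inv (get T (s , k)))} (eval slotE (g , k , ψ , tt)) s

    Rel-⊙ : ∀ {ψ f τ} → E τ → Rel (I i) ψ f → Rel (I i) (ψ ⊙ inv τ) (f ⊙ inv τ)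
    Rel-⊙ {ψ} {f} {τ} Eτ rel {x} x∈ = trans (⊙-! ψ (inv τ) x) (trans (rel (~-I (E.block (E-inv Eτ) x) x∈)) (cong φ (sym (⊙-! f (inv τ) x))))

    module _ {old T : Table} (gen : Generates (Prev i) old) (good : S.Good T) (all : AllItems gen T) where

      -- `E⇒slot` supplies a slot whose quotient passes the test in H. The search may settle on a
      -- different slot, but passing is all that counts: it makes the new f′ multiplicative at the
      -- pair, hence on the pair of cosets.
      step-Rel : ∀ {k} l r → keys ≡ l ++ (zero , k) ∷ r → ∀ {ψ f} → S.D ((zero , k) ∷ r) f → Rel (I i) ψ f →
                 ∃₂ λ ψ′ f′ → stepH (T , ψ , false) k ≡ (T , ψ′ , false) × S.D r f′ × Rel (I i) ψ′ f′
      step-Rel {k} l r split {ψ} {f} Df rel = ψ′ , f′ , stepH-passes T ψ k passes , Df′ , rel′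
        where
        key = (zero , k)
        slot′ = E⇒slot gen good all l r split Df
        s = proj₁ slot′
        Eτ : ∀ s → E (get T (s , key))
        Eτ s = proj₁ (good s key)
        fin : S.Final (key ∷ r)
        fin = final l S.final-ks split
          where
          final : ∀ l {ks} → S.Final ks → ks ≡ l ++ key ∷ r → S.Final (key ∷ r)
          final []      fin refl = fin
          final (_ ∷ l) fin refl = final l (S.final-tail fin) refl
        ψ′ = reduceH T key ψ
        passes : testH key ψ′ ≡ true
        passes = reduceH-complete T key ψ s (MultAt⇒testH {ψ ⊙ inv (get T (s , key))} {f ⊙ inv (get T (s , key))} (Rel-⊙ {ψ} {f} (Eτ s) rel)
          (λ x∈ x∈′ y∈ → S.D-head fin (proj₂ slot′) x∈ x∈′ y∈ ~-refl ~-refl))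
        s′ = proj₁ (reduceH-form T key ψ)
        f′ = f ⊙ inv (get T (s′ , key))
        rel′ : Rel (I i) ψ′ f′
        rel′ {x} x∈ = trans (cong (_! x) (proj₂ (reduceH-form T key ψ))) (Rel-⊙ {ψ} {f} (Eτ s′) rel x∈)
        Df″ : S.D (key ∷ r) f′
        Df″ = S.D-∙ Df (S.D-inv (S.D-slot {T} {key} {r} {s′} good))
        Df′ : S.D r f′
        Df′ = S.D-step fin Df″ (MultAt⇒P (proj₁ Df″) (S.D-below fin Df″) (testH⇒MultAt {ψ′} {f′} rel′ passes))

      sift-Rel : ∀ ts l → keys ≡ l ++ (List.map (zero ,_) ts ++ keys₁) → ∀ {ψ f} → S.D (List.map (zero ,_) ts ++ keys₁) f → Rel (I i) ψ f →
                 ∃ λ f′ → S.D keys₁ f′ × Rel (I i) (proj₁ (proj₂ (foldl stepH (T , ψ , false) ts))) f′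
      sift-Rel []       l split {ψ} {f} Df rel = f , Df , rel
      sift-Rel (k ∷ ts) l split {ψ} {f} Df rel =
        let ψ′ , f′ , step≡ , Df′ , rel′ = step-Rel l (List.map (zero ,_) ts ++ keys₁) split Df rel
            f″ , Df″ , rel″ = sift-Rel ts (l ++ (zero , k) ∷ []) (trans split (sym (Listₚ.++-assoc l ((zero , k) ∷ []) _))) Df′ rel′
        in f″ , Df″ , (λ {x} x∈ → trans (cong (λ st → proj₁ (proj₂ (foldl stepH st ts)) ! x) step≡) (rel″ x∈))

      siftHV : Perm → Perm
      siftHV ψ = proj₁ (proj₂ (eval siftHE (T , ψ , g , H′.g , i , tt)))

      opaque
        unfolding siftHE

        siftHV≡ : ∀ ψ → siftHV ψ ≡ proj₁ (proj₂ (foldl stepH (T , ψ , false) (tuples 2)))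
        siftHV≡ ψ = cong (λ st → proj₁ (proj₂ st)) (eval-foldTup {n} 2 (call stepE (var v0 ∷ pair zer (var v1) ∷ var v4 ∷ var v5 ∷ var v6 ∷ []))
          (pair (var v0) (pair (var v1) fls)) (T , ψ , g , H′.g , i , tt))

      stage-Rel : ∀ {ψ a} → Aut (Prev i) a → Rel (Prev i) ψ a → ∃ λ f → Aut (I i) f × Rel (I i) (siftHV (extH ψ)) f
      stage-Rel {ψ} {a} Aa rel =
        let Ef = extend-E shift-L Aa
            f , Df , rel′ = sift-Rel (tuples 2) [] keys-split (subst (λ ks → S.D ks (extend shift a)) keys-split
              (Ef , λ k k≺ → ⊥-elim (≺-irrefl 3 {k} (k≺ (∈-tuples 3 k))))) (extH-Rel {ψ} {a} Aa rel)
        in f , E⇒Aut (proj₁ Df) (λ j y x → proj₂ Df (zero , j , y , x) precedes)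
             , (λ {x} x∈ → trans (cong (_! x) (siftHV≡ (extH ψ))) (rel′ x∈))
        where
        precedes : ∀ {k} → S.Precedes (zero , k) keys₁
        precedes {k} {c , l} l∈ with keys₁-suc l∈
        ... | _ , refl = inj₁ z<s

foldl-indices : ∀ {ℓ} {n} {A : Set} (Inv : ℕ → A → Set ℓ) (step : A → Fin (suc n) → A) →
                (∀ i {s} → Inv (toℕ i) s → Inv (suc (toℕ i)) (step s i)) →
                ∀ {s} → Inv 0 s → Inv (suc n) (foldl step s (indices n))
foldl-indices {n = n} Inv step ind {s} inv₀ =
  subst (λ l → Inv (suc n) (foldl step s l)) (sym (indices≡ n)) (go (suc n) id 0 (λ j → sym (ℕₚ.+-identityʳ (toℕ j))) inv₀ (ℕₚ.+-identityʳ (suc n)))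
  where
  go : ∀ k (f : Fin k → Fin (suc n)) m → (∀ j → toℕ (f j) ≡ toℕ j + m) → ∀ {s} → Inv m s → k + m ≡ suc n →
       Inv (suc n) (foldl step s (List.tabulate f))
  go zero    f m f≡ inv refl = inv
  go (suc k) f m f≡ {s} inv len = go k (f ∘ suc) (suc m) (λ j → trans (f≡ (suc j)) (sym (ℕₚ.+-suc (toℕ j) m)))
    (subst (λ m → Inv (suc m) (step s (f zero))) (f≡ zero) (ind (f zero) (subst (λ m → Inv m s) (sym (f≡ zero)) inv)))
    (trans (ℕₚ.+-suc k m) len)

-- Verification, and the run through all terms

module Verify {n : ℕ} (G : FiniteGroup (suc n)) (C : El n (arr (arr bool))) (flag : IsFlag G C)
              (H : FiniteGroup (suc n)) (C′ : El n (arr (arr bool))) (flag′ : IsFlag H C′) where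
  open Flagged G C flag
  private module H′ = Flagged H C′ flag′

  verifyV : Perm → Bool
  verifyV ψ = eval verifyE (g , H′.g , ψ , tt)

  module _ (ψ : Perm {n}) where
    homoB injB surB preservesB : Bool
    homoB = allB λ x → allB λ y → eqB (ψ ! mul x y) (H′.mul (ψ ! x) (ψ ! y))
    injB = allB λ x → allB λ y → if (if eqB (ψ ! x) (ψ ! y) then false else true) then true else eqB x y
    surB = allB λ y → anyB λ x → eqB (ψ ! x) y
    preservesB = allB λ i → allB λ x → if inB i x then H′.inB i (ψ ! x) else (if H′.inB i (ψ ! x) then false else true)

    opaque
      unfolding verifyE

      verifyV≡ : verifyV ψ ≡ (if homoB then (if injB then (if surB then preservesB else false) else false) else false)
      verifyV≡ = refl

    verify-sound : verifyV ψ ≡ true → FlagIso G C H C′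
    verify-sound ok = record
      { φ = ψ !_
      ; homo = λ x y → trans (cong (ψ !_) (sym (mul≡ x y))) (trans (eqB-sound (allB-elim (allB-elim h x) y)) (H′.mul≡ (ψ ! x) (ψ ! y)))
      ; injective = λ {x} {y} eq → [ (λ ¬eq → ⊥-elim (not-elim ¬eq (eqB-complete eq))) , eqB-sound ]′
          (or-elim {if eqB (ψ ! x) (ψ ! y) then false else true} (allB-elim (allB-elim i x) y))
      ; surjective = λ y → let x , eq = anyB-elim {f = λ x → eqB (ψ ! x) y} (allB-elim s y) in x , eqB-sound eq
      ; to = λ {i} {x} x∈ → trans (sym (if-true x∈)) (allB-elim (allB-elim p i) x)
      ; from = λ {i} {x} y∈ → [ id , (λ x∉ → ⊥-elim (not-elim (trans (sym (if-false x∉)) (allB-elim (allB-elim p i) x)) y∈)) ]′ (true-or-not (inB i x))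
      }
      where
      split₁ = and-elim {homoB} (trans (sym verifyV≡) ok)
      split₂ = and-elim {injB} (proj₂ split₁)
      split₃ = and-elim {surB} (proj₂ split₂)
      h = proj₁ split₁
      i = proj₁ split₂
      s = proj₁ split₃
      p = proj₂ split₃

    module _ (iso : FlagIso G C H C′) where
      open FlagIso iso

      verify-complete : (∀ x → ψ ! x ≡ φ x) → verifyV ψ ≡ true
      verify-complete ψ≡ = trans verifyV≡ (and-intro h (and-intro i (and-intro s p)))
        where
        h : homoB ≡ true
        h = allB-intro λ x → allB-intro λ y → eqB-complete (trans (cong (ψ !_) (mul≡ x y)) (trans (ψ≡ (x ∙ y)) (trans (homo x y)
              (trans (sym (cong₂ H′._∙_ (ψ≡ x) (ψ≡ y))) (sym (H′.mul≡ (ψ ! x) (ψ ! y)))))))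
        i : injB ≡ true
        i = allB-intro λ x → allB-intro λ y → [ (λ eq → or-introʳ {if eqB (ψ ! x) (ψ ! y) then false else true}
                (eqB-complete (injective (trans (sym (ψ≡ x)) (trans (eqB-sound eq) (ψ≡ y))))))
              , (λ ¬eq → or-introˡ (not-intro ¬eq)) ]′ (true-or-not (eqB (ψ ! x) (ψ ! y)))
        s : surB ≡ true
        s = allB-intro λ y → let x , eq = surjective y in anyB-intro {f = λ x → eqB (ψ ! x) y} x (eqB-complete (trans (ψ≡ x) eq))
        p : preservesB ≡ true
        p = allB-intro λ i → allB-intro λ x → [ (λ x∈ → trans (if-true x∈) (trans (cong (H′.inB i) (ψ≡ x)) (to x∈)))
              , (λ x∉ → trans (if-false x∉) (not-intro (λ y∈ → x∉ (from (trans (cong (H′.inB i) (sym (ψ≡ x))) y∈))))) ]′ (true-or-not (inB i x))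

module Run {n : ℕ} (G : FiniteGroup (suc n)) (C : El n (arr (arr bool))) (flag : IsFlag G C)
           (H : FiniteGroup (suc n)) (C′ : El n (arr (arr bool))) (flag′ : IsFlag H C′) (iso : FlagIso G C H C′)
           (θ : Perm {n}) (υ : Fin (suc n) → Fin (suc n))
           (θ≡ : ∀ x → lookup θ (Flagged.lead G C flag x) ≡ FlagIso.φ iso (υ (Flagged.lead G C flag x)))
           (~υ : ∀ x → Flagged._~_ G C flag (Flagged.lead G C flag x) (υ (Flagged.lead G C flag x))) where
  open Automorphisms G C flag
  open FlagIso iso
  private
    module H′ = Flagged H C′ flag′
    module Gd = Guided G C flag H C′ flag′ iso θ υ θ≡ ~υ

  -- A natural number as bound gives one family for both ends of a stage: at `toℕ i` it is `Prev i`
  -- by definition, and one further it is term i.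
  Below : ℕ → N → Set
  Below m u = I zero u ⊎ ∃ λ j → toℕ j < m × I j u

  Aut-⇔ : ∀ {X Y : N → Set} {a} → (∀ {x} → X x → Y x) → (∀ {x} → Y x → X x) → Aut X a → Aut Y a
  Aut-⇔ X⊆Y Y⊆X Aa = record { injective = A.injective ; outside = λ y∉ → A.outside (y∉ ∘ X⊆Y) ; block = A.block
                              ; mult = λ x∈ u∈ → A.mult (Y⊆X x∈) (Y⊆X u∈) }
    where module A = Aut Aa

  Generates-⇔ : ∀ {X Y : N → Set} {T} → (∀ {x} → X x → Y x) → (∀ {x} → Y x → X x) → Generates X T → Generates Y T
  Generates-⇔ X⊆Y Y⊆X gen = record
    { sound = λ s c k → Aut-⇔ X⊆Y Y⊆X (Generates.sound gen s c k)
    ; complete = λ Q Qι Q⊙ Qslot Aa → Generates.complete gen Q Qι Q⊙ Qslot (Aut-⇔ Y⊆X X⊆Y Aa) }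

  I⇒Below : ∀ i {x} → I i x → Below (suc (toℕ i)) x
  I⇒Below i x∈ = inj₂ (i , ℕₚ.≤-refl , x∈)

  Below⇒I : ∀ i {x} → Below (suc (toℕ i)) x → I i x
  Below⇒I i (inj₁ x∈) = zero-in x∈
  Below⇒I i (inj₂ (j , s≤s j≤i , x∈)) = nested j≤i x∈

  Invariant : ℕ → Table × Perm → Set₁
  Invariant m (T , ψ) = Generates (Below m) T × ∃ λ a → Aut (Below m) a × (∀ {x} → Below m x → ψ ! x ≡ φ (a ! x))

  stageV : Table × Perm → N → Table × Perm
  stageV S i = eval stageE (S , i , g , H′.g , θ , tt)

  module _ (i : N) where
    private module T = Tables G C flag i
    open Gd.AtStage i

    opaque
      unfolding stageE

      stageV≡ : ∀ old ψ → stageV (old , ψ) i ≡ (T.closeV old , proj₁ (proj₂ (eval siftHE (T.closeV old , extH ψ , g , H′.g , i , tt))))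
      stageV≡ old ψ = refl

    ι-Aut : ∀ X → Aut X ι
    ι-Aut = T.Aut-ι

    stage-invariant : ∀ {S} → Invariant (toℕ i) S → Invariant (suc (toℕ i)) (stageV S i)
    stage-invariant {old , ψ} (gen , a , Aa , rel) =
      let good , all = T.closed-table gen
          f , Af , rel′ = stage-Rel gen good all {ψ} {a} Aa rel
      in subst (Invariant (suc (toℕ i))) (sym (stageV≡ old ψ))
           (Generates-⇔ (I⇒Below i) (Below⇒I i) (T.table-generates gen good all) , f ,
            Aut-⇔ (I⇒Below i) (Below⇒I i) Af , λ x∈ → rel′ (Below⇒I i x∈))

  initψ : Perm
  initψ = table λ x → H′.ldiv x x

  Below-zero : ∀ {x} → Below 0 x → x ≡ ε
  Below-zero {x} (inj₁ x∈) = bottom x x∈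

  initial : Invariant 0 (emptyV , initψ)
  initial = record { sound = λ s c k → subst (Aut (Below 0)) (sym (empty (s , suc c , k))) (ι-Aut zero (Below 0))
                   ; complete = λ Q Qι _ _ Aa → subst Q (sym (only-ι Aa)) Qι }
          , ι , ι-Aut zero (Below 0) , λ {x} x∈ → trans (lookup-table (λ x → H′.ldiv x x) x) (trans (H′.ldiv≡ x x) (trans (H′.inverseˡ x)
              (trans (sym (φ-ε iso)) (cong φ (trans (sym (Below-zero x∈)) (sym (ι-! x)))))))
    where
    empty : ∀ p → get emptyV p ≡ ι
    empty = lookup-constT 4 {PERM} idE
    only-ι : ∀ {a} → Aut (Below 0) a → a ≡ ι
    only-ι {a} Aa = lookup-ext λ x → [ (λ x∈ → trans (cong (a !_) (bottom x x∈)) (trans (~-ε (Aut.block Aa ε)) (trans (sym (bottom x x∈)) (sym (ι-! x)))))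
                                     , (λ x∉ → trans (Aut.outside Aa (λ { (inj₁ x∈) → x∉ x∈ })) (sym (ι-! x))) ]′ (true-or-not (inB zero x))

  opaque
    unfolding runE

    runV≡ : eval runE (g , H′.g , θ , tt) ≡ foldl stageV (emptyV , initψ) (indices n)
    runV≡ = refl

  run-Rel : ∃ λ a → Aut (Below (suc n)) a × (∀ x → proj₂ (eval runE (g , H′.g , θ , tt)) ! x ≡ φ (a ! x))
  run-Rel =
    let _ , a , Aa , rel = subst (Invariant (suc n)) (sym runV≡) (foldl-indices Invariant stageV (λ i {S} → stage-invariant i {S}) initial)
    in a , Aa , λ x → rel (inj₂ (proj₁ top , Finₚ.toℕ<n (proj₁ top) , proj₂ top x))

  -- The run returns φ ∘ a for some automorphism a, not necessarily φ. As a preserves the cosets, it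
  -- preserves every term, so the composite is again an isomorphism of flags.
  run-verifies : Verify.verifyV G C flag H C′ flag′ (proj₂ (eval runE (g , H′.g , θ , tt))) ≡ true
  run-verifies =
    let a , Aa , rel = run-Rel
        module A = Aut Aa
        all : ∀ x → Below (suc n) x
        all x = inj₂ (proj₁ top , Finₚ.toℕ<n (proj₁ top) , proj₂ top x)
    in Verify.verify-complete G C flag H C′ flag′ (proj₂ (eval runE (g , H′.g , θ , tt))) (record
         { φ = λ x → φ (a ! x)
         ; homo = λ x y → trans (cong φ (A.mult (all x) (all y))) (homo (a ! x) (a ! y))
         ; injective = λ eq → A.injective (injective eq)
         ; surjective = λ y → let x , eq = surjective y
                                  x′ , eq′ = injective⇒surjective {f = a} A.injective x
                              in x′ , trans (cong φ eq′) eq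
         ; to = λ {i} {x} x∈ → to (~-I (A.block x) x∈)
         ; from = λ {i} {x} y∈ → ~-I′ (A.block x) (from y∈)
         }) rel

-- Guesses

module Guessing {n : ℕ} (G : FiniteGroup (suc n)) (C : El n (arr (arr bool))) (flag : IsFlag G C)
                (H : FiniteGroup (suc n)) (C′ : El n (arr (arr bool))) (flag′ : IsFlag H C′) where
  open Flagged G C flag
  private module H′ = Flagged H C′ flag′

  Guess : Set
  Guess = El n GUESS

  assigned : Guess → N → Bool
  assigned st t = proj₁ (lookup st t)

  value : Guess → N → N
  value st t = proj₂ (lookup st t)

  openB : Guess → N → Bool
  openB st t = eval openE (g , st , t , tt)

  completeB checkB : Guess → Bool
  completeB st = eval completeE (g , st , tt)
  checkB st = eval checkE (g , H′.g , st , tt)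

  pass : Guess → N → Guess
  pass st w = eval passE (g , H′.g , st , w , tt)

  levelB : N → N → Bool
  levelB s t = eval sameLevelE (g , s , t , tt)

  chosen : Guess → N → N
  chosen st t = eval chosenE (g , st , t , tt)

  withinB : N → N → Bool
  withinB t w = eval withinE (g , H′.g , t , w , tt)

  strip : N → N → N
  strip t w = if withinB t w then w else H′.ldiv (H′.lead w) w

  digit : N → N → N
  digit t w = eval digitE (g , H′.g , t , w , tt)

  SameLevel : N → N → Set
  SameLevel s t = ∀ i → (I i s → I i t) × (I i t → I i s)

  Open : Guess → N → Set
  Open st t = lead t ≡ t × ¬ assigned st t ≡ true

  opaque
    unfolding openE completeE sameLevelE chosenE withinE digitE passE checkE

    openB⇒Open : ∀ {st t} → openB st t ≡ true → Open st t
    openB⇒Open {st} {t} o = let l , a = and-elim {eqB (lead t) t} o in eqB-sound l , not-elim a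

    Open⇒openB : ∀ {st t} → Open st t → openB st t ≡ true
    Open⇒openB (l , a) = and-intro (eqB-complete l) (not-intro a)

    completeB⇒ : ∀ {st} → completeB st ≡ true → ∀ t → ¬ openB st t ≡ true
    completeB⇒ {st} c t o = not-elim c (anyB-intro {f = openB st} t o)

    ⇒completeB : ∀ {st} → (∀ t → ¬ openB st t ≡ true) → completeB st ≡ true
    ⇒completeB {st} none = not-intro λ any → let t , o = anyB-elim {f = openB st} any in none t o

    levelB⇒ : ∀ {s t} → levelB s t ≡ true → SameLevel s t
    levelB⇒ {s} {t} l i = (λ s∈ → trans (sym (if-true s∈)) (allB-elim l i))
      , (λ t∈ → [ id , (λ s∉ → ⊥-elim (not-elim (trans (sym (if-false s∉)) (allB-elim l i)) t∈)) ]′ (true-or-not (inB i s)))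

    ⇒levelB : ∀ {s t} → SameLevel s t → levelB s t ≡ true
    ⇒levelB {s} {t} l = allB-intro λ i → [ (λ s∈ → trans (if-true s∈) (proj₁ (l i) s∈))
      , (λ s∉ → trans (if-false s∉) (not-intro (s∉ ∘ proj₂ (l i)))) ]′ (true-or-not (inB i s))

    chosen≡ : ∀ st t → chosen st t ≡ findB t (λ s → if levelB s t then openB st s else false)
    chosen≡ st t = refl

    withinB⇒ : ∀ {t w} → withinB t w ≡ true → ∀ {j} → I j t → H′.I j w
    withinB⇒ {t} {w} ok {j} t∈ = [ (λ t∉ → ⊥-elim (not-elim t∉ t∈)) , id ]′ (or-elim {if inB j t then false else true} (allB-elim ok j))

    ⇒withinB : ∀ {t w} → (∀ {j} → I j t → H′.I j w) → withinB t w ≡ true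
    ⇒withinB {t} {w} f = allB-intro λ j → [ (λ t∈ → or-introʳ {if inB j t then false else true} (f t∈)) , (λ t∉ → or-introˡ (not-intro t∉)) ]′ (true-or-not (inB j t))

    digit≡ : ∀ t w → digit t w ≡ H′.lead (foldl (λ w _ → strip t w) w (indices n))
    digit≡ t w = refl

    pass-! : ∀ st w t → lookup (pass st w) t ≡ (if (if openB st t then eqB (chosen st t) t else false) then (true , digit t w) else lookup st t)
    pass-! st w = lookup-table λ t → if (if openB st t then eqB (chosen st t) t else false) then (true , digit t w) else lookup st t

    checkB≡ : ∀ st → checkB st ≡ eval verifyE (g , H′.g , proj₂ (eval runE (g , H′.g , table (λ t → value st t) , tt)) , tt)
    checkB≡ st = refl

  candidate : Guess → N → N → Bool
  candidate st t s = if levelB s t then openB st s else false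

  openIn : Guess → N → ℕ
  openIn st t = count (candidate st t) (indices n)

  Selected : Guess → N → Set
  Selected st t = openB st t ≡ true × chosen st t ≡ t

  selB : Guess → N → Bool
  selB st t = if openB st t then eqB (chosen st t) t else false

  selB⇒ : ∀ {st t} → selB st t ≡ true → Selected st t
  selB⇒ {st} {t} s = let o , c = and-elim {openB st t} s in o , eqB-sound c

  SameLevel-refl : ∀ {t} → SameLevel t t
  SameLevel-refl i = id , id

  SameLevel-sym : ∀ {s t} → SameLevel s t → SameLevel t s
  SameLevel-sym l i = proj₂ (l i) , proj₁ (l i)

  SameLevel-trans : ∀ {s t u} → SameLevel s t → SameLevel t u → SameLevel s u
  SameLevel-trans l m i = proj₁ (m i) ∘ proj₁ (l i) , proj₂ (l i) ∘ proj₂ (m i)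

  chosen-cong : ∀ {st s t} → SameLevel s t → openB st s ≡ true → chosen st s ≡ chosen st t
  chosen-cong {st} {s} {t} l o = trans (chosen≡ st s) (trans (findB-cong {f = candidate st s} {candidate st t} s t s
      (λ u → cong (λ b → if b then openB st u else false)
        (true⇔⇒≡ (λ us → ⇒levelB (SameLevel-trans {u} {s} {t} (levelB⇒ us) l)) (λ ut → ⇒levelB (SameLevel-trans {u} {t} {s} (levelB⇒ ut) (SameLevel-sym {s} {t} l)))))
      (and-intro (⇒levelB {s} {s} (SameLevel-refl {s})) o)) (sym (chosen≡ st t)))

  pass-open : ∀ {st w t} → openB (pass st w) t ≡ true → openB st t ≡ true
  pass-open {st} {w} {t} o = [ (λ s → proj₁ (selB⇒ s)) , (λ ¬s → Open⇒openB (proj₁ o′ , λ a → proj₂ o′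
      (trans (cong proj₁ (trans (pass-! st w t) (if-false ¬s))) a))) ]′ (true-or-not (selB st t))
    where o′ = openB⇒Open o

  pass-selected : ∀ {st w t} → Selected st t → openB (pass st w) t ≡ false
  pass-selected {st} {w} {t} (o , c) = ¬true⇒false λ o′ → proj₂ (openB⇒Open o′)
    (cong proj₁ (trans (pass-! st w t) (if-true (and-intro o (eqB-complete c)))))

  -- On a level that still has open leaders the chosen one is closed by the pass, and no leader is
  -- ever reopened.
  pass-openIn : ∀ {st b} → (∀ t → openIn st t ≤ suc b) → ∀ w t → openIn (pass st w) t ≤ b
  pass-openIn {st} {b} bound w t = [ some , none ]′ (true-or-not (anyB (candidate st t)))
    where
    shrinks : ∀ s → candidate (pass st w) t s ≡ true → candidate st t s ≡ true
    shrinks s c = let l , o = and-elim {levelB s t} c in and-intro l (pass-open o)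
    some : anyB (candidate st t) ≡ true → openIn (pass st w) t ≤ b
    some any = ℕₚ.≤-pred (ℕₚ.≤-trans (count-strict (indices n) shrinks (∈-indices c) gone sat) (bound t))
      where
      wit = anyB-elim {f = candidate st t} any
      c = chosen st t
      sat : candidate st t c ≡ true
      sat = subst (λ c → candidate st t c ≡ true) (sym (chosen≡ st t)) (findB-sat {f = candidate st t} t (proj₁ wit) (proj₂ wit))
      lo = and-elim {levelB c t} sat
      selected : Selected st c
      selected = proj₂ lo , chosen-cong (levelB⇒ (proj₁ lo)) (proj₂ lo)
      gone : candidate (pass st w) t c ≡ false
      gone = ¬true⇒false λ x → case-false (trans (sym (pass-selected {st} {w} selected)) (proj₂ (and-elim {levelB c t} x)))
        where
        case-false : ¬ false ≡ true
        case-false ()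
    none : ¬ anyB (candidate st t) ≡ true → openIn (pass st w) t ≤ b
    none ¬any = ℕₚ.≤-trans (ℕₚ.≤-reflexive (empty (indices n))) z≤n
      where
      empty : ∀ xs → count (candidate (pass st w) t) xs ≡ 0
      empty []       = refl
      empty (x ∷ xs) = trans (if-false (λ c → ¬any (anyB-intro {f = candidate st t} x (shrinks x c)))) (empty xs)

  openIn-zero : ∀ {st} → (∀ t → openIn st t ≤ 0) → completeB st ≡ true
  openIn-zero {st} bound = ⇒completeB λ t o → ℕₚ.<⇒≱ (positive t o) (bound t)
    where
    positive : ∀ t → openB st t ≡ true → 0 < openIn st t
    positive t o = ℕₚ.≤-trans (s≤s z≤n) (count-strict {f = λ _ → false} {candidate st t} (indices n) (λ _ ()) (∈-indices t) refl
      (and-intro (⇒levelB {t} {t} (SameLevel-refl {t})) o))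

  check-sound : ∀ {st} → checkB st ≡ true → FlagIso G C H C′
  check-sound {st} ok = Verify.verify-sound G C flag H C′ flag′ _ (trans (sym (checkB≡ st)) ok)

  module Consistency (iso : FlagIso G C H C′) where
    open FlagIso iso

    -- Digits are leaders of H, whereas φ need not map leaders to leaders. So a value is the image
    -- of some u in the coset of t rather than of t.
    Consistent : Guess → Set
    Consistent st = ∀ t → lead t ≡ t → assigned st t ≡ true → ∃ λ u → t ~ u × value st t ≡ φ u

    check-complete : ∀ {st} → completeB st ≡ true → Consistent st → checkB st ≡ true
    check-complete {st} complete consistent = trans (checkB≡ st) (Run.run-verifies G C flag H C′ flag′ iso θ υ θ≡ ~υ)
      where
      θ : Perm
      θ = table (value st)
      all : ∀ t → lead t ≡ t → assigned st t ≡ true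
      all t l = [ id , (λ ¬a → ⊥-elim (completeB⇒ complete t (Open⇒openB (l , ¬a)))) ]′ (true-or-not (assigned st t))
      -- The guess says something about leaders only, but υ has to be total; elsewhere it is the
      -- identity.
      pick : ∀ t → Dec (lead t ≡ t) → N
      pick t (yes l) = proj₁ (consistent t l (all t l))
      pick t (no _)  = t
      υ : N → N
      υ t = pick t (lead t Finₚ.≟ t)
      picked : ∀ t (d : Dec (lead t ≡ t)) → lead t ≡ t → t ~ pick t d × value st t ≡ φ (pick t d)
      picked t (yes l) _ = proj₂ (consistent t l (all t l))
      picked t (no ¬l) l = ⊥-elim (¬l l)
      at : ∀ x → lead x ~ υ (lead x) × value st (lead x) ≡ φ (υ (lead x))
      at x = picked (lead x) (lead (lead x) Finₚ.≟ lead x) (lead-cong (lead~ x))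
      θ≡ : ∀ x → lookup θ (lead x) ≡ φ (υ (lead x))
      θ≡ x = trans (lookup-table (value st) (lead x)) (proj₂ (at x))
      ~υ : ∀ x → lead x ~ υ (lead x)
      ~υ x = proj₁ (at x)

    φ-\\ : ∀ x y → φ (x \\ y) ≡ φ x H′.\\ φ y
    φ-\\ x y = trans (sym (H′.\\-leftDividesʳ (φ x) _)) (cong (φ x H′.\\_) (trans (sym (homo x (x \\ y))) (cong φ (\\-leftDividesˡ x y))))

    ~-from : ∀ {x y} → φ x H′.~ φ y → x ~ y
    ~-from {x} {y} (inj₁ d) = inj₁ (from (subst (H′.I zero) (sym (φ-\\ x y)) d))
    ~-from {x} {y} (inj₂ (i , d , x∉)) = inj₂ (i , from (subst (H′.I i) (sym (φ-\\ x y)) d) , x∉ ∘ to)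

    φ-New : ∀ {i x} → New i x → H′.New i (φ x)
    φ-New {i} {x} (x∈ , x∉) = to x∈ , λ { (inj₁ z) → x∉ (inj₁ (from z)) ; (inj₂ (j , lt , z)) → x∉ (inj₂ (j , lt , from z)) }

    Below Below′ : ℕ → N → Set
    Below m u = I zero u ⊎ ∃ λ j → toℕ j < m × I j u
    Below′ m u = H′.I zero u ⊎ ∃ λ j → toℕ j < m × H′.I j u

    New-SameLevel : ∀ {i s t} → New i s → New i t → SameLevel s t
    New-SameLevel {i} (s∈ , s∉) (t∈ , t∉) j with ℕₚ.<-≤-connex (toℕ j) (toℕ i)
    ... | inj₁ j<i = (λ x → ⊥-elim (s∉ (inj₂ (j , j<i , x)))) , (λ x → ⊥-elim (t∉ (inj₂ (j , j<i , x))))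
    ... | inj₂ i≤j = (λ _ → nested i≤j t∈) , (λ _ → nested i≤j s∈)

    strips : N → N → List N → N
    strips t w js = foldl (λ w _ → strip t w) w js

    strips-within : ∀ t w js → withinB t w ≡ true → strips t w js ≡ w
    strips-within t w []       ok = refl
    strips-within t w (j ∷ js) ok = trans (cong (λ w → strips t w js) (if-true ok)) (strips-within t w js ok)

    module _ (st : Guess) where

      -- The list only counts iterations. Stripping stops by itself once w has come down to the
      -- level of t, so any number of iterations from m on gives the same digit.
      Encodes : ℕ → N → Set
      Encodes m w = ∀ t → Selected st t → Below m t → ∀ js → m ≤ length js → φ t H′.~ H′.lead (strips t w js)

      -- The mixed-radix representation: w is the product, from the top level
      -- down, of the leaders of the images of the selected elements.
      encodes : ∀ m → m ≤ suc n → ∃ λ w → Below′ m w × Encodes m w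
      encodes zero    _  = H′.ε , inj₁ (H′.ε-in zero) , λ { t sel (inj₁ t∈) js _ → base t (bottom t t∈) js }
        where
        base : ∀ t → t ≡ ε → ∀ js → φ t H′.~ H′.lead (strips t H′.ε js)
        base t t≡ε js = subst₂ H′._~_ (sym (trans (cong φ t≡ε) (φ-ε iso)))
          (cong H′.lead (sym (strips-within t H′.ε js (⇒withinB {t} {H′.ε} λ {j} _ → H′.ε-in j)))) (H′.~-sym (H′.lead~ H′.ε))
      encodes (suc m) lt = extend-code (encodes m (ℕₚ.<⇒≤ lt)) (Finₚ.toℕ-fromℕ< lt)
        where
        i = Fin.fromℕ< lt
        selNewB : N → Bool
        selNewB t = if selB st t then newB i t else false
        extend-code : ∀ {m} → (∃ λ w → Below′ m w × Encodes m w) → toℕ i ≡ m → ∃ λ w → Below′ (suc m) w × Encodes (suc m) w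
        extend-code (w , w∈ , enc) refl = [ some , none ]′ (true-or-not (anyB selNewB))
          where
          step-up : ∀ {u} → Below′ (toℕ i) u → Below′ (suc (toℕ i)) u
          step-up (inj₁ u∈) = inj₁ u∈
          step-up (inj₂ (j , lt , u∈)) = inj₂ (j , ℕₚ.m≤n⇒m≤1+n lt , u∈)
          cases : ∀ {t} → Below (suc (toℕ i)) t → Prev i t ⊎ New i t
          cases {t} b = [ inj₁ , (λ t∉ → inj₂ (in-i b , t∉)) ]′ (Prev? i t)
            where
            in-i : Below (suc (toℕ i)) t → I i t
            in-i (inj₁ t∈) = zero-in t∈
            in-i (inj₂ (j , s≤s j≤i , t∈)) = nested j≤i t∈
          none : ¬ anyB selNewB ≡ true → ∃ λ w → Below′ (suc (toℕ i)) w × Encodes (suc (toℕ i)) w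
          none ¬any = w , step-up w∈ , λ t sel b js len →
            [ (λ p → enc t sel p js (ℕₚ.≤-trans (ℕₚ.n≤1+n _) len))
            , (λ new → ⊥-elim (¬any (anyB-intro {f = selNewB} t (and-intro (and-intro (proj₁ sel) (eqB-complete (proj₂ sel))) (New⇒newB new))))) ]′ (cases b)
          some : anyB selNewB ≡ true → ∃ λ w → Below′ (suc (toℕ i)) w × Encodes (suc (toℕ i)) w
          some any = w′ , inj₂ (i , ℕₚ.≤-refl , w′∈) , λ t sel b js len → [ (λ p → lower t sel p js len) , (λ new → here′ t sel new js) ]′ (cases b)
            where
            wit = anyB-elim {f = selNewB} any
            c = proj₁ wit
            c-sel : Selected st c
            c-sel = selB⇒ (proj₁ (and-elim {selB st c} (proj₂ wit)))
            c-new : New i c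
            c-new = newB⇒New (proj₂ (and-elim {selB st c} (proj₂ wit)))
            l = H′.lead (φ c)
            w′ = l H′.∙ w
            l-new : H′.New i l
            l-new = H′.~-New (H′.~-sym (H′.lead~ (φ c))) (φ-New c-new)
            l~w′ : l H′.~ w′
            l~w′ = H′.~-∙ (H′.Prev⇒L l-new w∈)
            w′∈ : H′.I i w′
            w′∈ = H′.~-I l~w′ (proj₁ l-new)
            lead-w′ : H′.lead w′ ≡ l
            lead-w′ = trans (sym (H′.lead-cong l~w′)) (H′.lead-cong (H′.lead~ (φ c)))
            -- Only one element is selected per level, so t is c; w′ already lies at this level,
            -- nothing is stripped, and its leader is the new digit.
            here′ : ∀ t → Selected st t → New i t → ∀ js → φ t H′.~ H′.lead (strips t w′ js)
            here′ t (o , ch) new js = subst₂ H′._~_ (cong φ (sym t≡c)) (trans (sym lead-w′) (cong H′.lead (sym (strips-within t w′ js ok)))) (H′.~-sym (H′.lead~ (φ c)))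
              where
              t≡c : t ≡ c
              t≡c = trans (sym ch) (trans (chosen-cong {st} (New-SameLevel new c-new) o) (proj₂ c-sel))
              ok : withinB t w′ ≡ true
              ok = ⇒withinB {t} {w′} λ {j} t∈ → H′.nested (ℕₚ.≮⇒≥ (λ j<i → proj₂ new (inj₂ (j , j<i , t∈)))) w′∈
            -- Here w′ is still above the level of t, so the first iteration removes exactly l and
            -- leaves the old code w, with one iteration less to spend.
            lower : ∀ t → Selected st t → Prev i t → ∀ js → suc (toℕ i) ≤ length js → φ t H′.~ H′.lead (strips t w′ js)
            lower t sel p (j ∷ js) (s≤s len) = subst (λ u → φ t H′.~ H′.lead (strips t u js)) (sym stripped) (enc t sel p js len)
              where
              outside : Prev i t → ¬ withinB t w′ ≡ true
              outside (inj₁ t∈) ok = proj₂ l-new (inj₁ (H′.~-I′ l~w′ (withinB⇒ {t} {w′} ok t∈)))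
              outside (inj₂ (k , k<i , t∈)) ok = proj₂ l-new (inj₂ (k , k<i , H′.~-I′ l~w′ (withinB⇒ {t} {w′} ok t∈)))
              stripped : strip t w′ ≡ w
              stripped = trans (if-false (outside p)) (trans (H′.ldiv≡ (H′.lead w′) w′) (trans (cong (H′._\\ w′) lead-w′) (H′.\\-leftDividesʳ l w)))

      pass-consistent : Consistent st → ∃ λ w → Consistent (pass st w)
      pass-consistent consistent = w , λ t l a → [ selected t , unselected t l a ]′ (true-or-not (selB st t))
        where
        code = encodes (suc n) ℕₚ.≤-refl
        w = proj₁ code
        all-below : ∀ t → Below (suc n) t
        all-below t = inj₂ (proj₁ top , Finₚ.toℕ<n (proj₁ top) , proj₂ top t)
        selected : ∀ t → selB st t ≡ true → ∃ λ u → t ~ u × value (pass st w) t ≡ φ u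
        selected t s = let u , φu≡ = surjective (digit t w) in
          u , ~-from (subst (φ t H′.~_) (trans (sym (digit≡ t w)) (sym φu≡))
                (proj₂ (proj₂ code) t (selB⇒ s) (all-below t) (indices n) (ℕₚ.≤-reflexive (sym length-indices))))
            , trans (cong proj₂ (trans (pass-! st w t) (if-true s))) (sym φu≡)
          where
          length-indices : length (indices n) ≡ suc n
          length-indices = trans (cong length (indices≡ n)) (Listₚ.length-tabulate {n = suc n} id)
        unselected : ∀ t → lead t ≡ t → assigned (pass st w) t ≡ true → ¬ selB st t ≡ true → ∃ λ u → t ~ u × value (pass st w) t ≡ φ u
        unselected t l a ¬s = let same = trans (pass-! st w t) (if-false ¬s)
                                  u , t~u , v≡ = consistent t l (trans (cong proj₁ (sym same)) a)
                              in u , t~u , trans (cong proj₂ same) v≡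

-- Backtracking search and its running time

anyL : ∀ {A : Set} → (A → Bool) → List A → Bool
anyL f []       = false
anyL f (x ∷ xs) = if f x then true else anyL f xs

anyL-intro : ∀ {A : Set} (f : A → Bool) {x} xs → x ∈ₗ xs → f x ≡ true → anyL f xs ≡ true
anyL-intro f (_ ∷ xs) (here refl) fx = or-introˡ fx
anyL-intro f (y ∷ xs) (there x∈)  fx = or-introʳ {f y} (anyL-intro f xs x∈ fx)

anyL-elim : ∀ {A : Set} (f : A → Bool) xs → anyL f xs ≡ true → ∃ λ x → f x ≡ true
anyL-elim f (x ∷ xs) any = [ (x ,_) , anyL-elim f xs ]′ (or-elim {f x} any)

module Search {Δ : Ctx} {τ : Ty} (completeX checkX : Exp (τ ∷ Δ) bool) (nextX : Exp (ix ∷ τ ∷ Δ) τ) where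

  loopT : ∀ {m} → Term (10 + m) → Term (6 + m)
  loopT next = case (var v0) nil (case (app (var v7) (letT (cons (var v0) (var v4)) next)) (app (var v3) (var v1)) (cons nil nil))

  searchT : ∀ {m} (r p : Fin m) → Term (2 + m)
  searchT r p = letT (cons (var v0) (var (2 ↑ʳ p)))
    (case (compile (4 ↑ʳ r) v0 completeX)
      (app (fun (loopT (compile (10 ↑ʳ r) v0 nextX))) (var (4 ↑ʳ r)))
      (compile (6 ↑ʳ r) v2 checkX))

  -- All but the last `size` pays for the work at one node outside its recursive calls, and that
  -- `size` for their number. Multiplying the time at depth b by `base` then gives a bound at depth
  -- `suc b`.
  base : Poly
  base = con 13 ⊕ cost completeX ⊕ cost checkX ⊕ size ⊛ (con 14 ⊕ cost nextX) ⊕ size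

  1≤base : ∀ n → 1 ≤ base at n
  1≤base n = ℕₚ.≤-trans (s≤s z≤n) (ℕₚ.m≤n+m (suc n) (13 + (cost completeX at n) + (cost checkX at n) + suc n * (14 + (cost nextX at n))))

  module _ {n : ℕ} (δ : Env n Δ) where
    -- The depth b exists only in this description. The program carries no counter and ends because
    -- a state of bound 0 is complete.
    search further : ℕ → El n τ → Bool
    search b st = if eval completeX (st , δ) then eval checkX (st , δ) else further b st
    further zero    st = false
    further (suc b) st = anyL (λ w → search b (eval nextX (w , st , δ))) (allFin (suc n))

    module _ (Bounded : ℕ → El n τ → Set)
             (bounded-zero : ∀ {st} → Bounded 0 st → eval completeX (st , δ) ≡ true)
             (bounded-suc : ∀ {b st} → Bounded (suc b) st → ∀ w → Bounded b (eval nextX (w , st , δ)))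
             {m : ℕ} {r p : Fin m} {σ : Vec Value m}
             (r≡ : lookup σ r ≡ rangeOf n) (p≡ : lookup σ p ≡ encodeEnv Δ δ) where
      private
        c₁ = cost completeX at n
        c₂ = cost checkX at n
        c₃ = cost nextX at n
        A = 13 + c₁ + c₂ + suc n * (14 + c₃)
        X = base at n

      steps : ℕ → ℕ
      steps b = X * X ^ b

      1≤steps : ∀ b → 1 ≤ steps b
      1≤steps b = ℕₚ.*-mono-≤ {1} {X} {1} (ℕₚ.≤-trans (s≤s z≤n) (ℕₚ.m≤m+n A (suc n))) (ℕₚ.m^n>0 X {{_}} b)

      run-search : ∀ b st → Bounded b st →
                   (encode τ st ∷ closure (searchT r p) σ ∷ σ) ⊢ searchT r p ⇓ encodeBool (search b st) within steps b
      run-search b st bd with eval completeX (st , δ) in complete | run completeX {4 ↑ʳ r} {v0} {cons (encode τ st) (encodeEnv Δ δ) ∷ nil ∷ encode τ st ∷ closure (searchT r p) σ ∷ σ} (st , δ) r≡ refl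
      ... | true | c⇓ = within-≤ bound (w-let (w-cons (w-var refl) (w-var p≡)) (w-case-cons c⇓ (run checkX (st , δ) r≡ refl)))
        where
        bound : 6 + suc (c₁ + c₂) ≤ steps b
        bound = ℕₚ.≤-trans (ℕₚ.≤-trans (ℕₚ.+-monoˡ-≤ (c₁ + c₂) (ℕₚ.m≤m+n 7 6))
                  (ℕₚ.≤-trans (ℕₚ.m≤m+n (13 + c₁ + c₂) _) (ℕₚ.m≤m+n A (suc n)))) (ℕₚ.≤-trans (ℕₚ.≤-reflexive (sym (ℕₚ.*-identityʳ X)))
                  (ℕₚ.*-monoʳ-≤ X (ℕₚ.m^n>0 X {{_}} b)))
      run-search zero st bd | false | c⇓ with () ← trans (sym complete) (bounded-zero bd)
      run-search (suc b) st bd | false | c⇓ = within-≤ bound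
        (w-let (w-cons (w-var refl) (w-var p≡)) (w-case-nil c⇓ (w-app w-fun (w-var r≡) (loop (allFin (suc n)) (ℕₚ.≤-reflexive (Listₚ.length-tabulate {n = suc n} id))))))
        where
        env = cons (encode τ st) (encodeEnv Δ δ) ∷ nil ∷ encode τ st ∷ closure (searchT r p) σ ∷ σ
        body : Term (6 + m)
        body = loopT (compile (10 ↑ʳ r) v0 nextX)
        loop : ∀ ws → length ws ≤ suc n → (encodeList encodeFin ws ∷ closure body env ∷ env) ⊢ body ⇓
               encodeBool (anyL (λ w → search b (eval nextX (w , st , δ))) ws) within (length ws * (14 + c₃ + steps b) + 3)
        loop [] _ = w-case-nil (w-var refl) w-nil
        loop (w ∷ ws) len with search b (eval nextX (w , st , δ)) | run-search b (eval nextX (w , st , δ)) (bounded-suc bd w)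
        ... | true | s⇓ = within-≤ (bound′ (length ws * (14 + c₃ + steps b)) c₃ (steps b)) (w-case-cons (w-var refl) (w-case-cons
              (w-app (w-var refl) (w-let (w-cons (w-var refl) (w-var refl)) (run nextX (w , st , δ) r≡ refl)) s⇓) (w-cons w-nil w-nil)))
          where
          bound′ : ∀ l c s → suc (1 + suc (suc (1 + (6 + c) + s) + 3)) ≤ (14 + c + s + l) + 3
          bound′ l c s = ℕₚ.≤-trans (ℕₚ.≤-reflexive (eq c s)) (ℕₚ.≤-trans (ℕₚ.m≤m+n (14 + c + s) l) (ℕₚ.m≤m+n _ 3))
            where
            eq : ∀ c s → suc (1 + suc (suc (1 + (6 + c) + s) + 3)) ≡ 14 + c + s
            eq = solve 2 (λ c s → con 3 :+ (con 1 :+ (con 1 :+ (con 6 :+ c) :+ s) :+ con 3) := con 14 :+ c :+ s) refl where open +-*-Solver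
        ... | false | s⇓ = within-≤ (ℕₚ.≤-reflexive (eq (length ws * (14 + c₃ + steps b)) c₃ (steps b))) (w-case-cons (w-var refl) (w-case-nil
              (w-app (w-var refl) (w-let (w-cons (w-var refl) (w-var refl)) (run nextX (w , st , δ) r≡ refl)) s⇓)
              (w-app (w-var refl) (w-var refl) (loop ws (ℕₚ.≤-trans (ℕₚ.n≤1+n _) len)))))
          where
          eq : ∀ l c s → suc (1 + suc (suc (1 + (6 + c) + s) + suc (1 + 1 + (l + 3)))) ≡ (14 + c + s + l) + 3
          eq = solve 3 (λ l c s → con 3 :+ (con 1 :+ (con 1 :+ (con 6 :+ c) :+ s) :+ (con 3 :+ (l :+ con 3))) := con 14 :+ c :+ s :+ l :+ con 3) refl
            where open +-*-Solver
        bound : 6 + suc (c₁ + suc (2 + (length (allFin (suc n)) * (14 + c₃ + steps b) + 3))) ≤ steps (suc b)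
        bound = begin
          6 + suc (c₁ + suc (2 + (length (allFin (suc n)) * (14 + c₃ + steps b) + 3)))
            ≡⟨ cong (λ k → 6 + suc (c₁ + suc (2 + (k * (14 + c₃ + steps b) + 3)))) (Listₚ.length-tabulate {n = suc n} id) ⟩
          6 + suc (c₁ + suc (2 + (suc n * (14 + c₃ + steps b) + 3)))
            ≡⟨ eq c₁ (suc n) c₃ (steps b) ⟩
          (13 + c₁ + suc n * (14 + c₃)) + suc n * steps b
            ≤⟨ ℕₚ.+-monoˡ-≤ _ (ℕₚ.+-monoˡ-≤ _ (ℕₚ.m≤m+n (13 + c₁) c₂)) ⟩
          A + suc n * steps b
            ≤⟨ ℕₚ.+-monoˡ-≤ _ (ℕₚ.≤-trans (ℕₚ.≤-reflexive (sym (ℕₚ.*-identityʳ A))) (ℕₚ.*-monoʳ-≤ A (1≤steps b))) ⟩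
          A * steps b + suc n * steps b
            ≡⟨ ℕₚ.*-distribʳ-+ (steps b) A (suc n) ⟨
          X * steps b ∎
          where
          open ℕₚ.≤-Reasoning
          eq : ∀ c k d s → 6 + suc (c + suc (2 + (k * (14 + d + s) + 3))) ≡ (13 + c + k * (14 + d)) + k * s
          eq = solve 4 (λ c k d s → con 7 :+ (c :+ (con 3 :+ (k :* (con 14 :+ d :+ s) :+ con 3))) := con 13 :+ c :+ k :* (con 14 :+ d) :+ k :* s) refl
            where open +-*-Solver

-- Composition series as flags

module _ {n : ℕ} where
  full : Vec Bool (suc n)
  full = table λ _ → true

  -- Beyond its end, a list of subsets continues with the whole group.
  nth : List (Vec Bool (suc n)) → ℕ → Vec Bool (suc n)
  nth []      k       = full
  nth (p ∷ l) zero    = p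
  nth (p ∷ l) (suc k) = nth l k

  nth-tabulate : ∀ {m} (f : Fin m → Vec Bool (suc n)) j → nth (List.tabulate f) (toℕ j) ≡ f j
  nth-tabulate f zero    = refl
  nth-tabulate f (suc j) = nth-tabulate (f ∘ suc) j

  nth-beyond : ∀ l {k} → length l ≤ k → nth l k ≡ full
  nth-beyond []      _        = refl
  nth-beyond (p ∷ l) (s≤s le) = nth-beyond l le

  padV : List (Vec Bool (suc n)) → El n (arr (arr bool))
  padV l = eval padE (l , tt)

  tl : List (Vec Bool (suc n)) → List (Vec Bool (suc n))
  tl []      = []
  tl (_ ∷ l) = l

  hd : List (Vec Bool (suc n)) → Vec Bool (suc n)
  hd []      = full
  hd (p ∷ l) = p

  opaque
    unfolding padE

    pad-! : ∀ l i → lookup (padV l) i ≡ nth l (toℕ i)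
    pad-! l i = trans (lookup-table body i) (trans (hd≡ (foldl step l (indices n)) i) (trans (cong hd drops) (hd-drop (toℕ i) l)))
      where
      uncons-step : Fin (suc n) → List (Vec Bool (suc n)) → Fin (suc n) → List (Vec Bool (suc n))
      uncons-step i acc j = if j <ᵇ i then evalUncons (var v1) acc acc (acc , j , i , l , tt) else acc
      step : List (Vec Bool (suc n)) → Fin (suc n) → List (Vec Bool (suc n))
      step = uncons-step i
      body : Fin (suc n) → Vec Bool (suc n)
      body i = evalUncons (var v0) (foldl (uncons-step i) l (indices n)) full (i , l , tt)
      hd≡ : ∀ r (i : Fin (suc n)) → evalUncons {n} {ix ∷ lst (arr bool) ∷ []} {arr bool} {arr bool} (var v0) r full (i , l , tt) ≡ hd r
      hd≡ []      i = refl
      hd≡ (p ∷ r) i = refl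
      tl≡ : ∀ acc (j : Fin (suc n)) → evalUncons {n} {lst (arr bool) ∷ ix ∷ ix ∷ lst (arr bool) ∷ []} {lst (arr bool)} {arr bool} (var v1) acc acc (acc , j , i , l , tt) ≡ tl acc
      tl≡ []      j = refl
      tl≡ (p ∷ r) j = refl
      hd-drop : ∀ k l → hd (List.drop k l) ≡ nth l k
      hd-drop zero    []      = refl
      hd-drop zero    (p ∷ l) = refl
      hd-drop (suc k) []      = refl
      hd-drop (suc k) (p ∷ l) = hd-drop k l
      tl-drop : ∀ k l → tl (List.drop k l) ≡ List.drop (suc k) l
      tl-drop zero    []      = refl
      tl-drop zero    (p ∷ l) = refl
      tl-drop (suc k) []      = refl
      tl-drop (suc k) (p ∷ l) = tl-drop k l
      Inv : ℕ → List (Vec Bool (suc n)) → Set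
      Inv k r = r ≡ List.drop (k ⊓ toℕ i) l
      advance : ∀ j {r} → Inv (toℕ j) r → Inv (suc (toℕ j)) (step r j)
      advance j {r} inv = [ before , after ]′ (ℕₚ.<-≤-connex (toℕ j) (toℕ i))
        where
        before : toℕ j < toℕ i → Inv (suc (toℕ j)) (step r j)
        before lt = trans (if-true (<⇒<ᵇ j i lt)) (trans (tl≡ r j) (trans (cong tl (trans inv (cong (λ k → List.drop k l) (ℕₚ.m≤n⇒m⊓n≡m (ℕₚ.<⇒≤ lt)))))
          (trans (tl-drop (toℕ j) l) (cong (λ k → List.drop k l) (sym (ℕₚ.m≤n⇒m⊓n≡m lt))))))
        after : toℕ i ≤ toℕ j → Inv (suc (toℕ j)) (step r j)
        after ge = trans (if-false (ℕₚ.≤⇒≯ ge ∘ <ᵇ⇒< j i)) (trans inv (cong (λ k → List.drop k l)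
          (trans (ℕₚ.m≥n⇒m⊓n≡n ge) (sym (ℕₚ.m≥n⇒m⊓n≡n (ℕₚ.m≤n⇒m≤1+n ge))))))
      drops : foldl step l (indices n) ≡ List.drop (toℕ i) l
      drops = trans (foldl-indices Inv step advance refl) (cong (λ k → List.drop k l) (ℕₚ.m≥n⇒m⊓n≡n (ℕₚ.<⇒≤ (Finₚ.toℕ<n i))))

module SeriesFlag {n : ℕ} {G : FiniteGroup (suc n)} (S : CompositionSeries G) where
  open CompositionSeries S renaming (length to m)
  open FiniteGroup G using (_∙_; ε; _⁻¹)

  terms : List (Vec Bool (suc n))
  terms = List.tabulate term

  level : ℕ → Vec Bool (suc n)
  level = nth terms

  C : El n (arr (arr bool))
  C = padV terms

  Mem : ℕ → Fin (suc n) → Set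
  Mem k x = lookup (level k) x ≡ true

  C⇒Mem : ∀ {i x} → In C i x → Mem (toℕ i) x
  C⇒Mem {i} {x} = trans (cong (λ p → lookup p x) (sym (pad-! terms i)))

  Mem⇒C : ∀ {i x} → Mem (toℕ i) x → In C i x
  Mem⇒C {i} {x} = trans (cong (λ p → lookup p x) (pad-! terms i))

  Mem-term : ∀ j {x} → x Subset.∈ term j → Mem (toℕ j) x
  Mem-term j {x} x∈ = trans (cong (λ p → lookup p x) (nth-tabulate term j)) (Vecₚ.[]=⇒lookup x∈)

  term-Mem : ∀ j {x} → Mem (toℕ j) x → x Subset.∈ term j
  term-Mem j {x} x∈ = Vecₚ.lookup⇒[]= x (term j) (trans (cong (λ p → lookup p x) (sym (nth-tabulate term j))) x∈)

  Mem-beyond : ∀ {k x} → m < k → Mem k x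
  Mem-beyond {k} {x} lt = trans (cong (λ p → lookup p x) (nth-beyond terms (ℕₚ.≤-trans (ℕₚ.≤-reflexive (Listₚ.length-tabulate term)) lt)))
    (lookup-table (λ _ → true) x)

  Mem-top : ∀ {x} → Mem m x
  Mem-top {x} = subst (λ k → Mem k x) (Finₚ.toℕ-fromℕ m) (Mem-term (Fin.fromℕ m) (subst (x Subset.∈_) (sym top) Subsetₚ.∈⊤))

  Mem-full : ∀ {k x} → m ≤ k → Mem k x
  Mem-full {k} {x} le = [ Mem-beyond , (λ { refl → Mem-top }) ]′ (ℕₚ.m≤n⇒m<n∨m≡n le)

  inner : ∀ {k} → k < m → Fin m
  inner lt = Fin.fromℕ< lt

  lower⇒ : ∀ {k x} (lt : k < m) → Mem k x → x Subset.∈ term (Fin.inject₁ (inner lt))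
  lower⇒ {k} {x} lt x∈ = term-Mem (Fin.inject₁ (inner lt)) (subst (λ k → Mem k x) (sym (trans (Finₚ.toℕ-inject₁ (inner lt)) (Finₚ.toℕ-fromℕ< lt))) x∈)

  ⇒lower : ∀ {k x} (lt : k < m) → x Subset.∈ term (Fin.inject₁ (inner lt)) → Mem k x
  ⇒lower {k} {x} lt x∈ = subst (λ k → Mem k x) (trans (Finₚ.toℕ-inject₁ (inner lt)) (Finₚ.toℕ-fromℕ< lt)) (Mem-term (Fin.inject₁ (inner lt)) x∈)

  upper⇒ : ∀ {k x} (lt : k < m) → Mem (suc k) x → x Subset.∈ term (suc (inner lt))
  upper⇒ {k} {x} lt x∈ = term-Mem (suc (inner lt)) (subst (λ k → Mem (suc k) x) (sym (Finₚ.toℕ-fromℕ< lt)) x∈)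

  ⇒upper : ∀ {k x} (lt : k < m) → x Subset.∈ term (suc (inner lt)) → Mem (suc k) x
  ⇒upper {k} {x} lt x∈ = subst (λ k → Mem (suc k) x) (Finₚ.toℕ-fromℕ< lt) (Mem-term (suc (inner lt)) x∈)

  Mem-suc : ∀ {k x} → Mem k x → Mem (suc k) x
  Mem-suc {k} {x} x∈ = [ (λ lt → ⇒upper lt (proj₁ (strict (inner lt)) (lower⇒ lt x∈)))
                       , (λ ge → Mem-full (ℕₚ.m≤n⇒m≤1+n ge)) ]′ (ℕₚ.<-≤-connex k m)

  Mem-≤ : ∀ {k l x} → k ≤ l → Mem k x → Mem l x
  Mem-≤ {l = zero}  z≤n x∈ = x∈
  Mem-≤ {k} {suc l} {x} le x∈ = [ (λ { (s≤s k≤l) → Mem-suc {l} (Mem-≤ k≤l x∈) }) , (λ { refl → x∈ }) ]′ (ℕₚ.m≤n⇒m<n∨m≡n le)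

  Mem-zero : ∀ {x} → Mem 0 x → x ≡ ε
  Mem-zero {x} x∈ = Subsetₚ.x∈⁅y⁆⇒x≡y ε (subst (x Subset.∈_) bottom (term-Mem zero x∈))

  Mem-closed : ∀ k → (k ≤ m × ∃ λ j → (∀ {x} → Mem k x → x Subset.∈ term j) × (∀ {x} → x Subset.∈ term j → Mem k x)) ⊎ (∀ x → Mem k x)
  Mem-closed k with ℕₚ.<-≤-connex m k
  ... | inj₁ lt = inj₂ λ x → Mem-beyond lt
  ... | inj₂ le = inj₁ (le , j , (λ {x} x∈ → term-Mem j (subst (λ k → Mem k x) (sym (Finₚ.toℕ-fromℕ< (s≤s le))) x∈))
                              , (λ {x} x∈ → subst (λ k → Mem k x) (Finₚ.toℕ-fromℕ< (s≤s le)) (Mem-term j x∈)))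
    where j = Fin.fromℕ< (s≤s le)

  size-level : ∀ k → k ≤ m → suc k ≤ Subset.∣ level k ∣
  size-level zero    _  = ℕₚ.≤-reflexive (sym (trans (cong Subset.∣_∣ (trans (nth-tabulate term zero) bottom)) (Subsetₚ.∣⁅x⁆∣≡1 ε)))
  size-level (suc k) lt = ℕₚ.≤-trans (s≤s (size-level k (ℕₚ.<⇒≤ lt)))
    (subst₂ (λ p q → Subset.∣ p ∣ < Subset.∣ q ∣) lower≡ upper≡ (Subsetₚ.p⊂q⇒∣p∣<∣q∣ (strict (inner lt))))
    where
    lower≡ : term (Fin.inject₁ (inner lt)) ≡ level k
    lower≡ = trans (sym (nth-tabulate term (Fin.inject₁ (inner lt)))) (cong level (trans (Finₚ.toℕ-inject₁ (inner lt)) (Finₚ.toℕ-fromℕ< lt)))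
    upper≡ : term (suc (inner lt)) ≡ level (suc k)
    upper≡ = trans (sym (nth-tabulate term (suc (inner lt)))) (cong (level ∘ suc) (Finₚ.toℕ-fromℕ< lt))

  -- Each strict inclusion adds an element to the one of the bottom term, so every term of the
  -- series appears at some index of the flag.
  m≤n : m ≤ n
  m≤n = ℕₚ.≤-pred (ℕₚ.≤-trans (size-level m ℕₚ.≤-refl) (Subsetₚ.∣p∣≤n (level m)))

  index : ∀ {k} → k ≤ m → Fin (suc n)
  index le = Fin.fromℕ< (s≤s (ℕₚ.≤-trans le m≤n))

  toℕ-index : ∀ {k} (le : k ≤ m) → toℕ (index le) ≡ k
  toℕ-index le = Finₚ.toℕ-fromℕ< (s≤s (ℕₚ.≤-trans le m≤n))

  flag : IsFlag G C
  flag = record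
    { bottom = λ x x∈ → Mem-zero (C⇒Mem x∈)
    ; ε-in   = λ i → Mem⇒C ([ (λ { (_ , j , _ , ⇒) → ⇒ (IsSubgroup.ε∈ (subgroup j)) }) , (λ all → all _) ]′ (Mem-closed (toℕ i)))
    ; ∙-in   = λ i x∈ y∈ → Mem⇒C ([ (λ { (_ , j , ⇐ , ⇒) → ⇒ (IsSubgroup.∙∈ (subgroup j) (⇐ (C⇒Mem x∈)) (⇐ (C⇒Mem y∈))) }) , (λ all → all _) ]′ (Mem-closed (toℕ i)))
    ; ⁻¹-in  = λ i x∈ → Mem⇒C ([ (λ { (_ , j , ⇐ , ⇒) → ⇒ (IsSubgroup.⁻¹∈ (subgroup j) (⇐ (C⇒Mem x∈))) }) , (λ all → all _) ]′ (Mem-closed (toℕ i)))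
    ; nested = λ i≤j x∈ → Mem⇒C (Mem-≤ i≤j (C⇒Mem x∈))
    ; normal = normal′
    ; top    = index ℕₚ.≤-refl , λ x → Mem⇒C (Mem-full (ℕₚ.≤-reflexive (sym (toℕ-index ℕₚ.≤-refl))))
    }
    where
    normal′ : ∀ {i j x u} → toℕ j < toℕ i → In C i x → In C j u → ∃ λ k → toℕ k < toℕ i × In C k (x ∙ u ∙ x ⁻¹)
    normal′ {suc i} {j} {x} {u} (s≤s j≤i) x∈ u∈ = Fin.inject₁ i , ℕₚ.≤-reflexive (cong suc (Finₚ.toℕ-inject₁ i)) ,
      Mem⇒C (subst (λ k → Mem k (x ∙ u ∙ x ⁻¹)) (sym (Finₚ.toℕ-inject₁ i))
        ([ (λ lt → ⇒lower lt (normal (inner lt) (upper⇒ lt (C⇒Mem {suc i} x∈)) (lower⇒ lt (Mem-≤ j≤i (C⇒Mem u∈)))))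
         , Mem-full ]′ (ℕₚ.<-≤-connex (toℕ i) m)))

  open Flagged G C flag using (N; I; L; lead; lead~; lead-cong; _\\_)

  -- For s outside term k, this term lies in `L s`. Leaders in the same coset of it are therefore
  -- equivalent, and equivalent leaders coincide.
  leaders-distinct : ∀ {k} (lt : k < m) {s t} → lead s ≡ s → lead t ≡ t → ¬ Mem k s →
                     s \\ t Subset.∈ term (Fin.inject₁ (inner lt)) → s ≡ t
  leaders-distinct {k} lt {s} {t} ls lt′ s∉ d = trans (sym ls) (trans (lead-cong (inj₂ (i , Mem⇒C (at (⇒lower lt d)) , s∉ ∘ back ∘ C⇒Mem))) lt′)
    where
    i = index (ℕₚ.<⇒≤ lt)
    at : ∀ {x} → Mem k x → Mem (toℕ i) x
    at {x} = subst (λ k → Mem k x) (sym (toℕ-index (ℕₚ.<⇒≤ lt)))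
    back : ∀ {x} → Mem (toℕ i) x → Mem k x
    back {x} = subst (λ k → Mem k x) (toℕ-index (ℕₚ.<⇒≤ lt))

  entry : ∀ t → t ≡ ε ⊎ ∃ λ k → k < m × ¬ Mem k t × Mem (suc k) t
  entry t = search m ℕₚ.≤-refl Mem-top
    where
    search : ∀ k → k ≤ m → Mem k t → t ≡ ε ⊎ ∃ λ k → k < m × ¬ Mem k t × Mem (suc k) t
    search zero    _  t∈ = inj₁ (Mem-zero t∈)
    search (suc k) lt t∈ = [ search k (ℕₚ.<⇒≤ lt) , (λ t∉ → inj₂ (k , lt , t∉ , t∈)) ]′ (true-or-not (lookup (level k) t))

module SeriesIso {n : ℕ} {G H : FiniteGroup (suc n)} (S : CompositionSeries G) (S′ : CompositionSeries H) where
  private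
    module S = SeriesFlag S
    module S′ = SeriesFlag S′
    module Se = CompositionSeries S
    module Se′ = CompositionSeries S′
    module F = Flagged G S.C S.flag
    module F′ = Flagged H S′.C S′.flag

  -- At the index where S has reached the whole group, the isomorphism makes S′ whole too, although
  -- a longer S′ has a strict inclusion still to come.
  length-≮ : FlagIso G S.C H S′.C → ¬ Se.length < Se′.length
  length-≮ iso lt =
    let _ , y , _ , y∉ = Se′.strict (S′.inner lt)
        x , φx≡y = surjective y
        at : Mem′-at y
        at = subst Mem′-at φx≡y (subst (λ k → S′.Mem k (φ x)) (S.toℕ-index ℕₚ.≤-refl)
          (S′.C⇒Mem (to (S.Mem⇒C {S.index ℕₚ.≤-refl} {x} (S.Mem-full (ℕₚ.≤-reflexive (sym (S.toℕ-index ℕₚ.≤-refl))))))))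
    in y∉ (S′.lower⇒ lt at)
    where
    open FlagIso iso
    Mem′-at : Fin (suc n) → Set
    Mem′-at = S′.Mem Se.length

  length-≯ : FlagIso G S.C H S′.C → ¬ Se′.length < Se.length
  length-≯ iso lt =
    let _ , x , _ , x∉ = Se.strict (S.inner lt)
    in x∉ (S.lower⇒ lt (subst (λ k → S.Mem k x) (S′.toℕ-index ℕₚ.≤-refl)
         (S.C⇒Mem (from (S′.Mem⇒C {S′.index ℕₚ.≤-refl} {φ x} (S′.Mem-full (ℕₚ.≤-reflexive (sym (S′.toℕ-index ℕₚ.≤-refl)))))))))
    where open FlagIso iso

  FlagIso⇒≅ : FlagIso G S.C H S′.C → S ≅ S′
  FlagIso⇒≅ iso = record
    { φ = φ
    ; isIso = record
      { isGroupMonomorphism = record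
        { isGroupHomomorphism = record
          { isMonoidHomomorphism = record
            { isMagmaHomomorphism = record { isRelHomomorphism = record { cong = cong φ } ; homo = homo }
            ; ε-homo = φ-ε iso }
          ; ⁻¹-homo = λ x → F′.∙-cancelˡ (φ x) _ _ (trans (sym (homo x (x F.⁻¹))) (trans (cong φ (F.inverseʳ x)) (trans (φ-ε iso) (sym (F′.inverseʳ (φ x)))))) }
        ; injective = injective }
      ; surjective = λ y → let x , eq = surjective y in x , λ { refl → eq } }
    ; length≡ = length≡
    ; image = λ i {y} → mk⇔ (forth i y) (back i y) }
    where
    open FlagIso iso
    length≡ : Se.length ≡ Se′.length
    length≡ = ℕₚ.≤-antisym (ℕₚ.≮⇒≥ (length-≯ iso)) (ℕₚ.≮⇒≥ (length-≮ iso))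
    module _ (i : Fin (suc Se.length)) where
      j = Fin.cast (cong suc length≡) i
      k = S.index (Finₚ.toℕ≤pred[n] i)
      k≡i : toℕ k ≡ toℕ i
      k≡i = S.toℕ-index (Finₚ.toℕ≤pred[n] i)
      j≡k : toℕ j ≡ toℕ k
      j≡k = trans (Finₚ.toℕ-cast (cong suc length≡) i) (sym k≡i)
      forth : ∀ y → y Subset.∈ Se′.term j → ∃ λ x → x Subset.∈ Se.term i × φ x ≡ y
      forth y y∈ with surjective y
      ... | x , refl = x , S.term-Mem i (subst (λ k → S.Mem k x) k≡i (S.C⇒Mem {k} (from (S′.Mem⇒C {k} (subst (λ k → S′.Mem k (φ x)) j≡k (S′.Mem-term j y∈)))))) , refl
      back : ∀ y → (∃ λ x → x Subset.∈ Se.term i × φ x ≡ y) → y Subset.∈ Se′.term j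
      back y (x , x∈ , refl) = S′.term-Mem j (subst (λ k → S′.Mem k (φ x)) (sym j≡k)
        (S′.C⇒Mem {k} (to (S.Mem⇒C {k} (subst (λ k → S.Mem k x) (sym k≡i) (S.Mem-term i x∈))))))

  ≅⇒FlagIso : S ≅ S′ → FlagIso G S.C H S′.C
  ≅⇒FlagIso iso = record
    { φ = φ
    ; homo = I.∙-homo
    ; injective = I.injective
    ; surjective = λ y → let x , eq = I.surjective y in x , eq refl
    ; to = λ {i} {x} x∈ → S′.Mem⇒C {i} (to′ (toℕ i) x (S.C⇒Mem {i} x∈))
    ; from = λ {i} {x} x∈ → S.Mem⇒C {i} (from′ (toℕ i) x (S′.C⇒Mem {i} x∈)) }
    where
    open _≅_ iso
    open GroupMorphisms (Group.rawGroup (FiniteGroup.group G)) (Group.rawGroup (FiniteGroup.group H)) using (module IsGroupIsomorphism)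
    module I = IsGroupIsomorphism isIso
    cast-at : ∀ {k} (le : k ≤ Se.length) → toℕ (Fin.cast (cong suc length≡) (Fin.fromℕ< (s≤s le))) ≡ k
    cast-at le = trans (Finₚ.toℕ-cast (cong suc length≡) (Fin.fromℕ< (s≤s le))) (Finₚ.toℕ-fromℕ< (s≤s le))
    to′ : ∀ k x → S.Mem k x → S′.Mem k (φ x)
    to′ k x x∈ = [ inside-case , (λ lt → S′.Mem-full (ℕₚ.≤-trans (ℕₚ.≤-reflexive (sym length≡)) (ℕₚ.<⇒≤ lt))) ]′ (ℕₚ.≤-<-connex k Se.length)
      where
      inside-case : k ≤ Se.length → S′.Mem k (φ x)
      inside-case le = subst (λ k → S′.Mem k (φ x)) (cast-at le) (S′.Mem-term (Fin.cast (cong suc length≡) (Fin.fromℕ< (s≤s le)))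
        (Equivalence.from (image (Fin.fromℕ< (s≤s le))) (x , S.term-Mem (Fin.fromℕ< (s≤s le)) (subst (λ k → S.Mem k x) (sym (Finₚ.toℕ-fromℕ< (s≤s le))) x∈) , refl)))
    from′ : ∀ k x → S′.Mem k (φ x) → S.Mem k x
    from′ k x x∈ = [ inside-case , (λ lt → S.Mem-full (ℕₚ.<⇒≤ lt)) ]′ (ℕₚ.≤-<-connex k Se.length)
      where
      inside-case : k ≤ Se.length → S.Mem k x
      inside-case le =
        let i = Fin.fromℕ< (s≤s le)
            x′ , x′∈ , φx′≡ = Equivalence.to (image i) (S′.term-Mem (Fin.cast (cong suc length≡) i) (subst (λ k → S′.Mem k (φ x)) (sym (cast-at le)) x∈))
        in subst (λ k → S.Mem k x) (Finₚ.toℕ-fromℕ< (s≤s le)) (S.Mem-term i (subst (Subset._∈ Se.term i) (I.injective φx′≡) x′∈))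

-- The number of leaders on a level

module _ {A : Set} (f : A → Bool) where
  counted : ∀ xs → Fin (count f xs) → A
  counted (x ∷ xs) i with f x
  counted (x ∷ xs) i       | false = counted xs i
  counted (x ∷ xs) zero    | true  = x
  counted (x ∷ xs) (suc i) | true  = counted xs i

  counted-∈ : ∀ xs i → counted xs i ∈ₗ xs
  counted-∈ (x ∷ xs) i with f x
  counted-∈ (x ∷ xs) i       | false = there (counted-∈ xs i)
  counted-∈ (x ∷ xs) zero    | true  = here refl
  counted-∈ (x ∷ xs) (suc i) | true  = there (counted-∈ xs i)

  counted-sat : ∀ xs i → f (counted xs i) ≡ true
  counted-sat (x ∷ xs) i with f x in fx
  counted-sat (x ∷ xs) i       | false = counted-sat xs i
  counted-sat (x ∷ xs) zero    | true  = fx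
  counted-sat (x ∷ xs) (suc i) | true  = counted-sat xs i

  counted-injective : ∀ {xs} → AllPairs _≢_ xs → ∀ i j → counted xs i ≡ counted xs j → i ≡ j
  counted-injective {x ∷ xs} (x∉ ∷ xs!) i j eq with f x
  counted-injective {x ∷ xs} (x∉ ∷ xs!) i j eq | false = counted-injective xs! i j eq
  counted-injective {x ∷ xs} (x∉ ∷ xs!) zero    zero    eq | true = refl
  counted-injective {x ∷ xs} (x∉ ∷ xs!) zero    (suc j) eq | true = ⊥-elim (All.lookup x∉ (counted-∈ xs j) eq)
  counted-injective {x ∷ xs} (x∉ ∷ xs!) (suc i) zero    eq | true = ⊥-elim (All.lookup x∉ (counted-∈ xs i) (sym eq))
  counted-injective {x ∷ xs} (x∉ ∷ xs!) (suc i) (suc j) eq | true = cong suc (counted-injective xs! i j eq)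

  count-injection : ∀ {k xs} → AllPairs _≢_ xs → (h : ∀ x → f x ≡ true → Fin k) →
                    (∀ {x y} fx fy → h x fx ≡ h y fy → x ≡ y) → count f xs ≤ k
  count-injection {xs = xs} xs! h h-inj = Finₚ.injective⇒≤ {f = λ i → h (counted xs i) (counted-sat xs i)}
    λ {i} {j} eq → counted-injective xs! i j (h-inj _ _ eq)

module LeaderCount {n : ℕ} {G H : FiniteGroup (suc n)} (S : CompositionSeries G) (S′ : CompositionSeries H) where
  private
    module S = SeriesFlag S
    module Se = CompositionSeries S
  open Guessing G S.C S.flag H (SeriesFlag.C S′) (SeriesFlag.flag S′)

  indices-unique : AllPairs _≢_ (indices n)
  indices-unique = AllPairs.map (λ lt eq → ℕₚ.<-irrefl (cong toℕ eq) lt) indices-sorted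

  openIn≤length : ∀ st t → openIn st t ≤ suc n
  openIn≤length st t = ℕₚ.≤-trans (count≤length (candidate st t) (indices n))
    (ℕₚ.≤-reflexive (trans (cong length (indices≡ n)) (Listₚ.length-tabulate {n = suc n} id)))

  Mem-level : ∀ {s t} k → k ≤ Se.length → SameLevel s t → (S.Mem k s → S.Mem k t) × (S.Mem k t → S.Mem k s)
  Mem-level {s} {t} k le l = let i = S.index le ; eq = S.toℕ-index le in
    (λ s∈ → subst (λ k → S.Mem k t) eq (S.C⇒Mem {i} (proj₁ (l i) (S.Mem⇒C {i} (subst (λ k → S.Mem k s) (sym eq) s∈))))) ,
    (λ t∈ → subst (λ k → S.Mem k s) eq (S.C⇒Mem {i} (proj₂ (l i) (S.Mem⇒C {i} (subst (λ k → S.Mem k t) (sym eq) t∈)))))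

  -- Leaders on a level above `ε` lie in distinct cosets of one factor, so there are at most α. The
  -- level of `ε` belongs to no factor and has `ε` as its only leader; `suc α` allows for it without
  -- assuming α positive.
  openIn≤ : ∀ {α} → FactorOrders≤ S α → ∀ st t → openIn st t ≤ suc α
  openIn≤ {α} orders st t = [ at-ε , above ]′ (S.entry t)
    where
    split : ∀ {s} → candidate st t s ≡ true → SameLevel s t × Flagged.lead G S.C S.flag s ≡ s
    split {s} c = let l , o = and-elim {levelB s t} c in levelB⇒ l , proj₁ (openB⇒Open {st} o)
    at-ε : t ≡ FiniteGroup.ε G → openIn st t ≤ suc α
    at-ε refl = ℕₚ.≤-trans (count-injection (candidate st t) indices-unique (λ _ _ → zero {n = 0}) (λ cs ct _ → trans (is-ε cs) (sym (is-ε ct)))) (s≤s z≤n)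
      where
      is-ε : ∀ {s} → candidate st t s ≡ true → s ≡ FiniteGroup.ε G
      is-ε {s} c = IsFlag.bottom S.flag s (proj₂ (proj₁ (split c) zero) (IsFlag.ε-in S.flag zero))
    above : (∃ λ k → k < Se.length × ¬ S.Mem k t × S.Mem (suc k) t) → openIn st t ≤ suc α
    above (k , lt , t∉ , t∈) = ℕₚ.≤-trans (count-injection (candidate st t) indices-unique coset coset-inj) (ℕₚ.m≤n⇒m≤1+n (proj₂ (proj₂ order)))
      where
      i = S.inner lt
      order = orders i
      module Q = Group (Se.factor i)
      module B = Bijection (proj₁ (proj₂ order))
      elem : ∀ s → candidate st t s ≡ true → Q.Carrier
      elem s c = s , S.upper⇒ lt (proj₂ (Mem-level (suc k) lt (proj₁ (split c))) t∈)
      coset : ∀ s → candidate st t s ≡ true → Fin (proj₁ order)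
      coset s c = proj₁ (B.surjective (elem s c))
      coset-inj : ∀ {x y} (cx : candidate st t x ≡ true) (cy : candidate st t y ≡ true) → coset x cx ≡ coset y cy → x ≡ y
      coset-inj {x} {y} cx cy eq = S.leaders-distinct lt (proj₂ (split cx)) (proj₂ (split cy))
        (λ x∈ → t∉ (proj₁ (Mem-level k (ℕₚ.<⇒≤ lt) (proj₁ (split cx))) x∈))
        (Q.trans {elem x cx} {B.to (coset x cx)} {elem y cy}
          (Q.sym {B.to (coset x cx)} {elem x cx} (proj₂ (B.surjective (elem x cx)) refl))
          (subst (λ c → B.to c Q.≈ elem y cy) (sym eq) (proj₂ (B.surjective (elem y cy)) refl)))

-- The complete program on encoded series

rangeT : ∀ {m} → Term (2 + m)
rangeT = case (var v0) nil (case (var v0) nil (cons (var v3) (app (var v5) (cons (var v1) (cons nil (var v3))))))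

upFrom : ℕ → Value → Value
upFrom zero    k = nil
upFrom (suc m) k = cons k (upFrom m (cons nil k))

-- The order is not given as a number: the list of indices is produced by counting along the rows of
-- a multiplication table.
run-range : ∀ {A : Set} (f : A → Value) {m} (σ : Vec Value m) xs k →
            (cons (encodeList f xs) k ∷ closure rangeT σ ∷ σ) ⊢ rangeT ⇓ upFrom (length xs) k within (length xs * 13 + 5)
run-range f σ []       k = w-case-cons (w-var refl) (w-case-nil (w-var refl) w-nil)
run-range f σ (x ∷ xs) k = w-case-cons (w-var refl) (w-case-cons (w-var refl) (w-cons (w-var refl)
  (w-app (w-var refl) (w-cons (w-var refl) (w-cons w-nil (w-var refl))) (run-range f σ xs (cons nil k)))))

upFrom-range : ∀ n → rangeOf n ≡ upFrom (suc n) nil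
upFrom-range n = from (suc n) id nil encodeFin≡
  where
  bump : ℕ → Value → Value
  bump zero    k = k
  bump (suc j) k = bump j (cons nil k)
  bump-cons : ∀ j k → bump j (cons nil k) ≡ cons nil (bump j k)
  bump-cons zero    k = refl
  bump-cons (suc j) k = bump-cons j (cons nil k)
  encodeFin≡ : ∀ {m} (j : Fin m) → encodeFin j ≡ bump (toℕ j) nil
  encodeFin≡ zero    = refl
  encodeFin≡ (suc j) = trans (cong (λ v → Value.cons nil v) (encodeFin≡ j)) (sym (bump-cons (toℕ j) nil))
  from : ∀ {M} m (h : Fin m → Fin M) k → (∀ j → encodeFin (h j) ≡ bump (toℕ j) k) → encodeList encodeFin (List.tabulate h) ≡ upFrom m k
  from zero    h k h≡ = refl
  from (suc m) h k h≡ = cong₂ Value.cons (h≡ zero) (from m (h ∘ suc) (cons nil k) (λ j → h≡ (suc j)))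

inputX : Args (SERIES ⊗ SERIES ∷ []) (GRP ∷ GRP ∷ [])
inputX = call grpE (fst (var v0) ∷ []) ∷ call grpE (snd (var v0) ∷ []) ∷ []

startX : Exp (GRP ∷ GRP ∷ []) GUESS
startX = call emptyE (var v1 ∷ [])

module Guesses = Search {GRP ∷ GRP ∷ []} {GUESS} (call completeE (var v1 ∷ var v0 ∷ []))
  (call checkE (var v1 ∷ var v2 ∷ var v0 ∷ [])) (call passE (var v2 ∷ var v3 ∷ var v1 ∷ var v0 ∷ []))

-- Each `letT` shifts by two: the input is variable 2 when the context is built from it, and the
-- list of indices is variable 2 for the arguments and variable 4 for the search.
program : Program
program = letT (app (fun rangeT) (cons (hdT (hdT (var v0))) nil))
  (letT (cons (var v2) nil) (letT (compileArgs v2 v0 inputX nil)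
    (app (fun (Guesses.searchT v4 v0)) (compile v4 v0 startX))))

encodeList-map : ∀ {A B : Set} (e : B → Value) (f : A → B) xs → encodeList e (List.map f xs) ≡ encodeList (λ x → e (f x)) xs
encodeList-map e f []       = refl
encodeList-map e f (x ∷ xs) = cong (λ v → Value.cons (e (f x)) v) (encodeList-map e f xs)

encodeList-cong : ∀ {A : Set} {e f : A → Value} → (∀ x → e x ≡ f x) → ∀ xs → encodeList e xs ≡ encodeList f xs
encodeList-cong e≗f []       = refl
encodeList-cong e≗f (x ∷ xs) = cong₂ Value.cons (e≗f x) (encodeList-cong e≗f xs)

encode-table : ∀ {n τ} (f : Fin (suc n) → El n τ) → encode {n} (arr τ) (table f) ≡ encodeList (λ x → encode τ (f x)) (allFin (suc n))
encode-table {n} {τ} f = trans (cong (encodeList (encode τ)) (trans (cong Vec.toList (table≡ f)) (trans (toList-tabulate f)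
  (sym (Listₚ.map-tabulate id f))))) (encodeList-map (encode τ) f (allFin (suc n)))

encode-tableOf : ∀ {n} (G : FiniteGroup (suc n)) → encode {n} (arr (arr ix)) (tableOf G) ≡ encodeGroup G
encode-tableOf {n} G = trans (encode-table {n} {arr ix} (λ x → table (x ∙_)))
  (encodeList-cong (λ x → encode-table {n} {ix} (x ∙_)) (allFin (suc n)))
  where open FiniteGroup G

preparation : Poly
preparation = size ⊛ con 13 ⊕ costArgs inputX ⊕ cost startX ⊕ con 29

module Correctness {n : ℕ} {G H : FiniteGroup (suc n)} (S : CompositionSeries G) (S′ : CompositionSeries H) where
  private
    module S = SeriesFlag S
    module S′ = SeriesFlag S′
    module I = SeriesIso S S′
  open Guessing G S.C S.flag H S′.C S′.flag

  δ : Env n (GRP ∷ GRP ∷ [])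
  δ = (tableOf G , S.C) , (tableOf H , S′.C) , tt

  start : Guess
  start = eval startX δ

  start-unassigned : ∀ t → assigned start t ≡ false
  start-unassigned t = cong proj₁ (eval-tab (pair fls (call ldivE (var v1 ∷ var v0 ∷ var v0 ∷ []))) ((tableOf H , S′.C) , tt) t)

  search : ℕ → Guess → Bool
  search = Guesses.search δ

  search-sound : ∀ b st → search b st ≡ true → ∃ λ st → checkB st ≡ true
  search-sound b st found = [ (λ c → st , trans (sym (if-true c)) found) , (λ ¬c → continue b (trans (sym (if-false ¬c)) found)) ]′ (true-or-not (completeB st))
    where
    continue : ∀ b → Guesses.further δ b st ≡ true → ∃ λ st → checkB st ≡ true
    continue zero    ()
    continue (suc b) found = let w , found′ = anyL-elim (λ w → search b (pass st w)) (allFin (suc n)) found in search-sound b (pass st w) found′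

  module _ (iso : FlagIso G S.C H S′.C) where
    open Consistency iso

    search-complete : ∀ b st → (∀ t → openIn st t ≤ b) → Consistent st → search b st ≡ true
    search-complete zero st bd consistent = let c = openIn-zero bd in trans (if-true c) (check-complete c consistent)
    search-complete (suc b) st bd consistent = [ (λ c → trans (if-true c) (check-complete c consistent)) , (λ ¬c → trans (if-false ¬c) go) ]′ (true-or-not (completeB st))
      where
      next = pass-consistent st consistent
      go : anyL (λ w → search b (pass st w)) (allFin (suc n)) ≡ true
      go = anyL-intro (λ w → search b (pass st w)) (allFin (suc n)) (∈ₚ.∈-allFin (proj₁ next))
        (search-complete b (pass st (proj₁ next)) (pass-openIn bd (proj₁ next)) (proj₂ next))

  search⇔≅ : ∀ b → (∀ t → openIn start t ≤ b) → search b start ≡ true ⇔ S ≅ S′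
  search⇔≅ b bd = mk⇔
    (λ found → let st , ok = search-sound b start found in I.FlagIso⇒≅ (check-sound {st} ok))
    (λ S≅S′ → search-complete (I.≅⇒FlagIso S≅S′) b start bd (λ t _ a → ⊥-elim (not-both (trans (sym (start-unassigned t)) a))))
    where
    not-both : ¬ false ≡ true
    not-both ()

  input : Value
  input = cons (encodeSeries S) (encodeSeries S′)

  input≡ : input ≡ encode {n} (SERIES ⊗ SERIES) ((tableOf G , S.terms) , (tableOf H , S′.terms))
  input≡ = cong₂ (λ a b → Value.cons (cons a (encodeList encodeSubset S.terms)) (cons b (encodeList encodeSubset S′.terms)))
    (sym (encode-tableOf G)) (sym (encode-tableOf H))

  run-program : ∀ b → (∀ t → openIn start t ≤ b) →
                (input ∷ []) ⊢ program ⇓ encodeBool (search b start) within ((preparation at n) + (Guesses.base at n) * (Guesses.base at n) ^ b)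
  run-program b bd = within-≤ (ℕₚ.≤-reflexive total) (w-let range (w-let (w-cons (w-var input≡) w-nil)
      (w-let (runArgs inputX (((tableOf G , S.terms) , (tableOf H , S′.terms)) , tt) refl refl)
        (w-app w-fun (run startX δ refl refl)
          (Guesses.run-search δ (λ b st → ∀ t → openIn st t ≤ b) openIn-zero pass-openIn refl refl b start bd)))))
    where
    rows = allFin (suc n)
    row : Fin (suc n) → Value
    row x = encodeList (λ y → encodeFin (FiniteGroup._∙_ G x y)) (allFin (suc n))
    range : (input ∷ []) ⊢ app (fun rangeT) (cons (hdT (hdT (var v0))) nil) ⇓ rangeOf n within suc (1 + 7 + (suc n * 13 + 5))
    range = subst₂ (λ v k → (input ∷ []) ⊢ app (fun rangeT) (cons (hdT (hdT (var v0))) nil) ⇓ v within suc (1 + 7 + (k * 13 + 5)))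
      (trans (cong (λ k → upFrom k nil) (Listₚ.length-tabulate {n = suc n} id)) (sym (upFrom-range n))) (Listₚ.length-tabulate {n = suc n} id)
      (w-app w-fun (w-cons (w-hd (w-hd (w-var refl))) w-nil) (run-range row (input ∷ []) rows nil))
    total : suc (suc (suc (1 + 7 + (suc n * 13 + 5)) + 1) + suc (suc (suc (1 + 1) + 1) + suc (suc ((costArgs inputX at n) + 1 + 1)
              + suc (1 + (cost startX at n) + (Guesses.base at n) * (Guesses.base at n) ^ b)))) ≡
            (preparation at n) + (Guesses.base at n) * (Guesses.base at n) ^ b
    total = eq (suc n) (costArgs inputX at n) (cost startX at n) ((Guesses.base at n) * (Guesses.base at n) ^ b)
      where
      eq : ∀ k a c s → suc (suc (suc (1 + 7 + (k * 13 + 5)) + 1) + suc (suc (suc (1 + 1) + 1) + suc (suc (a + 1 + 1) + suc (1 + c + s)))) ≡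
                       (k * 13 + a + c + 29) + s
      eq = solve 4 (λ k a c s → con 1 :+ (con 1 :+ (con 1 :+ (con 8 :+ (k :* con 13 :+ con 5)) :+ con 1) :+
             (con 1 :+ (con 5 :+ (con 1 :+ (con 1 :+ (a :+ con 1 :+ con 1) :+ (con 1 :+ (con 1 :+ c :+ s))))))) :=
             (k :* con 13 :+ a :+ c :+ con 29) :+ s) refl
        where open +-*-Solver

-- The running time

module Exponents (p q : ℕ → ℕ) (exponent : ℕ) (total≤ : ∀ n → p n + q n ≤ suc (suc n) ^ exponent) (1≤q : ∀ n → 1 ≤ q n) where
  -- The first summand controls the exponent, because 2 e (2 + α) ≤ 6 e α for α ≥ 1. The second is
  -- the bound at order 1 and depth 1, where a power of the order contributes nothing.
  constant : ℕ
  constant = 6 * exponent + 2 ^ exponent * 2 ^ exponent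

  1≤constant : 1 ≤ constant
  1≤constant = ℕₚ.≤-trans (ℕₚ.*-mono-≤ {1} {2 ^ exponent} {1} (ℕₚ.m^n>0 2 exponent) (ℕₚ.m^n>0 2 exponent)) (ℕₚ.m≤n+m _ (6 * exponent))

  steps≤ : ∀ n b → p n + q n * q n ^ b ≤ (suc (suc n) ^ exponent) ^ suc b
  steps≤ n b = begin
    p n + q n * q n ^ b                 ≤⟨ ℕₚ.+-mono-≤ (ℕₚ.≤-trans (ℕₚ.≤-reflexive (sym (ℕₚ.*-identityʳ (p n)))) (ℕₚ.*-monoʳ-≤ (p n) (1≤^ b)))
                                             (ℕₚ.*-monoʳ-≤ (q n) (ℕₚ.^-monoˡ-≤ b (ℕₚ.m≤n+m (q n) (p n)))) ⟩
    p n * r ^ b + q n * r ^ b           ≡⟨ ℕₚ.*-distribʳ-+ (r ^ b) (p n) (q n) ⟨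
    r ^ suc b                     ≤⟨ ℕₚ.^-monoˡ-≤ (suc b) (total≤ n) ⟩
    (suc (suc n) ^ exponent) ^ suc b    ∎
    where
    open ℕₚ.≤-Reasoning
    r = p n + q n
    1≤^ : ∀ b → 1 ≤ r ^ b
    1≤^ zero    = ℕₚ.≤-refl
    1≤^ (suc b) = ℕₚ.*-mono-≤ {1} {r} {1} (ℕₚ.≤-trans (1≤q n) (ℕₚ.m≤n+m (q n) (p n))) (1≤^ b)

  trivial-order : ∀ α → p 0 + q 0 * q 0 ^ 1 ≤ constant * 1 ^ (constant * α)
  trivial-order α = begin
    p 0 + q 0 * q 0 ^ 1 ≤⟨ steps≤ 0 1 ⟩
    (2 ^ exponent) ^ 2                    ≡⟨ cong (2 ^ exponent *_) (ℕₚ.*-identityʳ (2 ^ exponent)) ⟩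
    2 ^ exponent * 2 ^ exponent           ≤⟨ ℕₚ.m≤n+m _ (6 * exponent) ⟩
    constant                              ≡⟨ ℕₚ.*-identityʳ constant ⟨
    constant * 1                          ≡⟨ cong (constant *_) (ℕₚ.^-zeroˡ (constant * α)) ⟨
    constant * 1 ^ (constant * α)         ∎
    where open ℕₚ.≤-Reasoning

  -- The polynomial bound is a power of N + 1, which is at most N² for N ≥ 2, at the price of
  -- doubling the exponent. The 2 + α is the depth `suc α` and one more for the factor outside the
  -- power.
  larger-order : ∀ n α → 1 ≤ α → p (suc n) + q (suc n) * q (suc n) ^ suc α ≤
                 constant * suc (suc n) ^ (constant * α)
  larger-order n α 1≤α = begin
    p (suc n) + q (suc n) * q (suc n) ^ suc α ≤⟨ steps≤ (suc n) (suc α) ⟩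
    ((3 + n) ^ exponent) ^ (2 + α)        ≤⟨ ℕₚ.^-monoˡ-≤ (2 + α) (ℕₚ.^-monoˡ-≤ exponent 3+n≤) ⟩
    ((N ^ 2) ^ exponent) ^ (2 + α)        ≡⟨ cong (_^ (2 + α)) (ℕₚ.^-*-assoc N 2 exponent) ⟩
    (N ^ (2 * exponent)) ^ (2 + α)        ≡⟨ ℕₚ.^-*-assoc N (2 * exponent) (2 + α) ⟩
    N ^ (2 * exponent * (2 + α))          ≤⟨ ℕₚ.^-monoʳ-≤ N exponents ⟩
    N ^ (constant * α)                    ≡⟨ ℕₚ.*-identityˡ _ ⟨
    1 * N ^ (constant * α)                ≤⟨ ℕₚ.*-monoˡ-≤ (N ^ (constant * α)) 1≤constant ⟩
    constant * N ^ (constant * α)         ∎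
    where
    open ℕₚ.≤-Reasoning
    N = suc (suc n)
    3+n≤ : 3 + n ≤ N ^ 2
    3+n≤ = ℕₚ.≤-trans (ℕₚ.m≤m+n (3 + n) (1 + 3 * n + n * n)) (ℕₚ.≤-reflexive (eq n))
      where
      eq : ∀ n → 3 + n + (1 + 3 * n + n * n) ≡ suc (suc n) * (suc (suc n) * 1)
      eq = solve 1 (λ n → con 3 :+ n :+ (con 1 :+ con 3 :* n :+ n :* n) := (con 2 :+ n) :* ((con 2 :+ n) :* con 1)) refl where open +-*-Solver
    exponents : 2 * exponent * (2 + α) ≤ constant * α
    exponents = begin
      2 * exponent * (2 + α)       ≤⟨ ℕₚ.*-monoʳ-≤ (2 * exponent) (ℕₚ.+-monoˡ-≤ α (ℕₚ.*-monoʳ-≤ 2 1≤α)) ⟩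
      2 * exponent * (2 * α + α)   ≡⟨ eq exponent α ⟩
      6 * exponent * α             ≤⟨ ℕₚ.*-monoˡ-≤ α (ℕₚ.m≤m+n (6 * exponent) _) ⟩
      constant * α                 ∎
      where
      eq : ∀ e a → 2 * e * (2 * a + a) ≡ 6 * e * a
      eq = solve 2 (λ e a → con 2 :* e :* (con 2 :* a :+ a) := con 6 :* e :* a) refl where open +-*-Solver

sum-bound : ∀ p q → ∃ λ c → ∀ n → (p at n) + (q at n) ≤ suc (suc n) ^ c
sum-bound p q = poly-bound (p ⊕ q)

-- Abstract, since the exponent is a huge numeral that should never be computed; only its existence
-- matters.
abstract
  program-bound : ∃ λ c → ∀ n → (preparation at n) + (Guesses.base at n) ≤ suc (suc n) ^ c
  program-bound = sum-bound preparation Guesses.base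

open Exponents (preparation at_) (Guesses.base at_) (proj₁ program-bound) (proj₂ program-bound) Guesses.1≤base

-- A group with two elements has a series of positive length, and any factor contains its identity.
-- So constants added to α in the exponent can be absorbed into a multiple of α.
factor-bound-positive : ∀ {n α} {G : FiniteGroup (suc (suc n))} (S : CompositionSeries G) → FactorOrders≤ S α → 1 ≤ α
factor-bound-positive {n} {α} S orders = [ nonempty , (λ le → ⊥-elim (trivial le)) ]′ (ℕₚ.<-≤-connex 0 Se.length)
  where
  module S = SeriesFlag S
  module Se = CompositionSeries S
  trivial : ¬ Se.length ≤ 0
  trivial le with () ← trans (S.Mem-zero {zero} (S.Mem-full le)) (sym (S.Mem-zero {suc zero} (S.Mem-full le)))
  nonempty : 0 < Se.length → 1 ≤ α
  nonempty lt = let k , order , k≤α = orders (S.inner lt) in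
    ℕₚ.≤-trans (inhabited (proj₁ (Bijection.surjective order (Group.ε (Se.factor (S.inner lt)))))) k≤α
    where
    inhabited : ∀ {k} → Fin k → 1 ≤ k
    inhabited zero    = s≤s z≤n
    inhabited (suc _) = s≤s z≤n

theorem4p12 : Σ[ P ∈ Program ] Σ[ C ∈ ℕ ] (∀ (n α : ℕ) {G H : FiniteGroup n}
    (S : CompositionSeries G) (S′ : CompositionSeries H) →
    FactorOrders≤ S α → FactorOrders≤ S′ α →
    Decides P (cons (encodeSeries S) (encodeSeries S′)) (S ≅ S′) (C * n ^ (C * α)))
theorem4p12 = program , constant , decides
  where
  decided : ∀ {n T} {G H : FiniteGroup (suc n)} (S : CompositionSeries G) (S′ : CompositionSeries H) b →
            (∀ t → Guessing.openIn G (SeriesFlag.C S) (SeriesFlag.flag S) H (SeriesFlag.C S′) (SeriesFlag.flag S′) (Correctness.start S S′) t ≤ b) →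
            (preparation at n) + (Guesses.base at n) * (Guesses.base at n) ^ b ≤ T →
            Decides program (cons (encodeSeries S) (encodeSeries S′)) (S ≅ S′) T
  decided S S′ b bound ≤T =
    let t , run , t≤ = Correctness.run-program S S′ b bound
    in _ , t , run , ℕₚ.≤-trans t≤ ≤T , Correctness.search⇔≅ S S′ b bound

  decides : ∀ n α {G H : FiniteGroup n} (S : CompositionSeries G) (S′ : CompositionSeries H) →
            FactorOrders≤ S α → FactorOrders≤ S′ α →
            Decides program (cons (encodeSeries S) (encodeSeries S′)) (S ≅ S′) (constant * n ^ (constant * α))
  decides zero α {G} _ _ _ _ with () ← FiniteGroup.ε G
  -- In the trivial group α may be 0, so the depth is bounded by the single element instead, and the
  -- whole running time is constant.
  decides (suc zero) α S S′ _ _ =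
    decided S S′ 1 (λ t → LeaderCount.openIn≤length S S′ (Correctness.start S S′) t) (trivial-order α)
  decides (suc (suc n)) α S S′ orders _ =
    decided S S′ (suc α) (λ t → LeaderCount.openIn≤ S S′ orders (Correctness.start S S′) t)
      (larger-order n α (factor-bound-positive S orders))
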